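{- Let $X=\{x_1<\cdots<x_N\}\subset\mathbb{R}$ with $d(x,y)=|x-y|$, and consider an input with $Q$ request occurrences, arrival epochs $(R_1,a_1),\ldots,(R_m,a_m)$ and initial server position $s_0\in X$. Let $F[0,s_0]=0$, $F[0,z]=+\infty$ for $z\ne s_0$, and for $j\ge1$, $z\in X$, $$F[j,z]=\min_{\substack{1\le p\le j\\ y\in X}}\bigl\{F[p-1,y]+K_{p,j}(y,z)+a_j-a_p\bigr\}.$$ Then this recurrence computes the exact automatic-service optimum, i.e. $\operatorname{OPT}_{\mathrm{auto}}=\min_{z\in X}F[m,z]$, in $O(Q+m^2N)$ time and $O(mN)$ working space beyond the input. Moreover, an optimal automatic-service trajectory is obtained by reconstructing the walks of the elective dynamic program by traceback and replaying them automatically (as described in the context).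
   Context: Model. $(X,d)$ is a finite metric space and $s_0\in X$ is the initial server position. An input is a finite set of request occurrences; each request $q$ has an arrival time $a(q)\ge 0$ and a location $x(q)\in X$. The distinct arrival times are $a_1<\cdots<a_m$, and the epoch $R_h$ is the nonempty set of requests arriving at $a_h$. A walk $P=(v_0,\ldots,v_\ell)$ in $X$ ($\ell\ge 0$) is executed instantaneously at one time, visits its listed vertices, and has length $\operatorname{len}(P)=\sum_i d(v_{i-1},v_i)$; on the line, a monotone move may list all sites in between. A schedule is a finite sequence of atomic actions with nondecreasing timestamps. At time $t$ the complete epoch arriving at $t$ is processed first; then one action at $t$ performs a finite ordered sequence of walks, and no further arrival is processed until the action ends. The first walk starts at $s_0$ and every later one starts where its predecessor ended. A walk $P$ at time $t$ during which a nonempty set $B$ of pending requests is served is one service event of cost $\operatorname{len}(P)+\max_{q\in B}(t-a(q))$; a walk serving no request costs $\operatorname{len}(P)$. The cost of a schedule is the sum of these costs; every request must eventually be served. Automatic service: every pending request whose location is visited by a walk is served in that event (so a pure movement becomes a service event if it visits a pending request), and a request arriving at the current server position is served immediately (at zero cost). Elective service: a visited pending request may, but need not, be served. $\operatorname{OPT}_{\mathrm{auto}}$ is the infimum of the cost over feasible automatic schedules. Kernel. For $1\le p\le j\le m$ let $L_{p,j}$ and $U_{p,j}$ be the minimum and maximum of $x(q)$ over $q\in R_p\cup\cdots\cup R_j$, and for $y,z\in X$ let $$K_{p,j}(y,z)=(U_{p,j}-L_{p,j})+\min\bigl\{|y-L_{p,j}|+|U_{p,j}-z|,\ |y-U_{p,j}|+|L_{p,j}-z|\bigr\}.$$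 Computation. Running time counts arithmetic operations and comparisons at unit cost. The recurrence is implemented using $G_h(x)=\min_{y\in X}\{F[h,y]+|y-x|\}$ (all values and minimizers computed per layer by a forward and a backward scan), scanning for each $j$ the values $p=j,\ldots,1$ while maintaining $L_{p,j},U_{p,j}$ incrementally, and relaxing $F[j,z]$ with $(U_{p,j}-L_{p,j})+(a_j-a_p)+\min\{G_{p-1}(L_{p,j})+|U_{p,j}-z|,\,G_{p-1}(U_{p,j})+|L_{p,j}-z|\}$; traceback pointers are stored. Reconstruction and replay. Traceback from a minimizer of $F[m,\cdot]$ yields a partition of the epochs into consecutive blocks $[p,j]$ with endpoints $y$ (start) and $z$ (end), and for each block a walk from $y$ to $z$ of length $K_{p,j}(y,z)$ visiting both extremes $L_{p,j}$ and $U_{p,j}$ and all requested sites of the block, assigned to time $a_j$. Automatic replay: follow exactly these walks at exactly these times, staying parked at the current endpoint in between, with automatic service (arrivals at the parked point are served at once; every remaining pending request hit by a block's walk is served in that event; a walk is kept as pure repositioning if all requests of its block are already served). -}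

module Defs where

open import Algebra.Structures using (IsAbelianGroup)
import Algebra.Construct.NaturalChoice.Max as NaturalMax
import Algebra.Construct.NaturalChoice.Min as NaturalMin
open import Data.Bool.Base using (Bool; if_then_else_)
open import Data.Fin.Base as Fin using (Fin; Fin′; zero; suc; toℕ; fromℕ; fromℕ<; inject; inject!)
open import Data.Fin.Induction using () renaming (<-wellFounded to Fin-<-wellFounded)
import Data.Fin.Properties as Fin
open import Data.List.Base as List
  using (List; []; _∷_; _++_; _∷ʳ_; length; map; filter; foldl; concatMap; takeWhile; dropWhile;
         allFin; cartesianProductWith)
import Data.List.Extrema as Extrema
open import Data.List.NonEmpty as List⁺ using (List⁺; _∷_; toList)
open import Data.List.Properties using (map-cong)
open import Data.List.Relation.Unary.All using (All)
open import Data.List.Relation.Unary.Linked using (Linked)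
open import Data.List.Membership.Propositional using (_∈_)
import Data.Maybe.Base as Maybe
open import Data.Nat.Base as ℕ using (ℕ; zero; suc)
open import Data.Nat.ListAction using (sum)
import Data.Nat.Properties as ℕ
open import Data.Product.Base using (∃-syntax; _×_; _,_; proj₂)
open import Data.Unit.Polymorphic.Base using (⊤)
open import Data.Vec.Base as Vec using (Vec)
open import Data.Vec.Properties using (lookup∘tabulate; tabulate-cong)
open import Data.Vec.Functional as Vector using (Vector)
open import Function.Base using (_∘_)
open import Induction.WellFounded using (WfRec; module All; module FixPoint)
open import Level using () renaming (_⊔_ to _⊔ˡ_; suc to lsuc)
open import Relation.Binary.Bundles using (TotalOrder; DecTotalOrder)
open import Relation.Binary.Core using (Rel)
open import Relation.Binary.PropositionalEquality
  using (_≡_; refl; sym; trans; cong; cong₂; subst)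
open import Relation.Binary.Structures using (IsDecTotalOrder)
open import Relation.Nullary.Construct.Add.Supremum using (_⁺; ⊤⁺; [_])
import Relation.Binary.Construct.Add.Supremum.NonStrict as Supremum
open import Relation.Nullary.Decidable using (Dec; does; yes; no; ¬?)
open import Relation.Nullary.Negation using (¬_)

------------------------------------------------------------------------
-- Scalars

-- The library has no real numbers.  Everything below uses only addition,
-- subtraction and comparison of scalars, so it is stated over an arbitrary
-- linearly ordered abelian group; (ℝ, +, ≤) is the intended one.  The order is
-- decidable because comparisons are primitive steps of the machine.

record LinearlyOrderedAbelianGroup c ℓ : Set (lsuc (c ⊔ˡ ℓ)) where
  infix  8 -_
  infixl 6 _+_ _-_
  infix  4 _≤_ _<_
  field
    Carrier         : Set c
    _≤_             : Rel Carrier ℓ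
    _+_             : Carrier → Carrier → Carrier
    0#              : Carrier
    -_              : Carrier → Carrier
    isAbelianGroup  : IsAbelianGroup _≡_ _+_ 0# -_
    isDecTotalOrder : IsDecTotalOrder _≡_ _≤_
    +-monoˡ-≤       : ∀ {x y} z → x ≤ y → x + z ≤ y + z

  decTotalOrder : DecTotalOrder c c ℓ
  decTotalOrder = record { isDecTotalOrder = isDecTotalOrder }

  open DecTotalOrder decTotalOrder public using (_≤?_; isTotalOrder; totalOrder)
  open NaturalMin totalOrder public using (_⊓_)
  open NaturalMax totalOrder public using (_⊔_)
  open Extrema totalOrder public using (min; max)

  _<_ : Rel Carrier (c ⊔ˡ ℓ)
  x < y = x ≤ y × ¬ x ≡ y

  _-_ : Carrier → Carrier → Carrier
  x - y = x + (- y)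

  ∣_∣ : Carrier → Carrier
  ∣ x ∣ = x ⊔ (- x)

  open Supremum _≤_ public using (_≤⁺_)

  totalOrder⁺ : TotalOrder c c (c ⊔ˡ ℓ)
  totalOrder⁺ = record { isTotalOrder = Supremum.≤⁺-isTotalOrder-≡ _≤_ isTotalOrder }

  open Extrema totalOrder⁺ using () renaming (min to min-or)

  min⁺ : List (Carrier ⁺) → Carrier ⁺
  min⁺ = min-or ⊤⁺

  infixl 6 _+⁺_
  _+⁺_ : Carrier ⁺ → Carrier → Carrier ⁺
  x +⁺ y = Maybe.map (_+ y) x

  IsInfimum : ∀ {p} → (Carrier → Set p) → Carrier ⁺ → Set (c ⊔ˡ ℓ ⊔ˡ p)
  IsInfimum P v = (∀ x → P x → v ≤⁺ [ x ])
                × (∀ w → (∀ x → P x → w ≤⁺ [ x ]) → w ≤⁺ v)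

------------------------------------------------------------------------
-- Inputs

-- Sites are indexed from left to right.  Epochs are indexed from 0, and an
-- epoch lists the sites of its request occurrences (with repetitions).

record Input {c ℓ} (R : LinearlyOrderedAbelianGroup c ℓ) : Set (c ⊔ˡ ℓ) where
  open LinearlyOrderedAbelianGroup R
  field
    N            : ℕ
    pos          : Fin N → Carrier
    pos-mono     : ∀ {u v} → u Fin.< v → pos u < pos v
    s₀           : Fin N
    m            : ℕ
    arrival      : Fin m → Carrier
    arrival-mono : ∀ {h k} → h Fin.< k → arrival h < arrival k
    arrival≥0    : ∀ h → 0# ≤ arrival h
    epoch        : Fin m → List⁺ (Fin N)

  Q : ℕ
  Q = sum (map (List⁺.length ∘ epoch) (allFin m))

module _ {c ℓ} {R : LinearlyOrderedAbelianGroup c ℓ} (I : Input R) where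

  open LinearlyOrderedAbelianGroup R
  open Input I

  dist : Fin N → Fin N → Carrier
  dist u v = ∣ pos u - pos v ∣

  ----------------------------------------------------------------------
  -- Automatic-service schedules

  Walk : Set
  Walk = List⁺ (Fin N)

  lenFrom : Fin N → List (Fin N) → Carrier
  lenFrom u []       = 0#
  lenFrom u (v ∷ vs) = dist u v + lenFrom v vs

  len : Walk → Carrier
  len (v ∷ vs) = lenFrom v vs

  record Action : Set c where
    constructor _at_
    field
      walks : List Walk
      time  : Carrier
  open Action public

  Schedule : Set c
  Schedule = List Action

  -- A pending request occurrence: its epoch and its site.
  Request : Set
  Request = Fin m × Fin N

  record State : Set c where
    field
      server  : Fin N
      pending : List Request
      unseen  : List (Fin m)
      spent   : Carrier
  open State public

  initial : State
  initial = record { server = s₀ ; pending = [] ; unseen = allFin m ; spent = 0# }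

  -- Occurrences arriving at the current server position are served at once,
  -- at zero cost, and hence never become pending.
  arrive : State → Fin m → State
  arrive S h = record S
    { pending = pending S ++
                map (h ,_) (filter (λ x → ¬? (x Fin.≟ server S)) (toList (epoch h))) }

  admitUpTo : Carrier → State → State
  admitUpTo t S = record (foldl arrive S (takeWhile (λ h → arrival h ≤? t) (unseen S)))
    { unseen = dropWhile (λ h → arrival h ≤? t) (unseen S) }

  admitAll : State → State
  admitAll S = record (foldl arrive S (unseen S)) { unseen = [] }

  wait : Carrier → Request → Carrier
  wait t (h , _) = t - arrival h

  delayCost : Carrier → List Request → Carrier
  delayCost t []       = 0#
  delayCost t (q ∷ qs) = max (wait t q) (map (wait t) qs)

  visited? : (P : Walk) (q : Request) → Dec (proj₂ q ∈ toList P)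
  visited? P q = proj₂ q ∈? toList P
    where open import Data.List.Membership.DecPropositional (Fin._≟_ {N}) using (_∈?_)

  traverse : Carrier → State → Walk → State
  traverse t S P = record S
    { server  = List⁺.last P
    ; pending = filter (λ q → ¬? (visited? P q)) (pending S)
    ; spent   = spent S + (len P + delayCost t (filter (visited? P) (pending S)))
    }

  perform : State → Action → State
  perform S (Ps at t) = foldl (traverse t) (admitUpTo t S) Ps

  run : Schedule → State
  run σ = admitAll (foldl perform initial σ)

  cost : Schedule → Carrier
  cost σ = spent (run σ)

  Connected : Fin N → List Walk → Set
  Connected u []       = ⊤
  Connected u (P ∷ Ps) = List⁺.head P ≡ u × Connected (List⁺.last P) Ps

  record Feasible (σ : Schedule) : Set (c ⊔ˡ ℓ) where
    field
      chronological : Linked (λ α β → time α ≤ time β) σ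
      connected     : Connected s₀ (concatMap walks σ)
      allServed     : pending (run σ) ≡ []

  AutoCost : Carrier → Set (c ⊔ˡ ℓ)
  AutoCost x = ∃[ σ ] Feasible σ × cost σ ≡ x

  IsOPTauto : Carrier ⁺ → Set (c ⊔ˡ ℓ)
  IsOPTauto = IsInfimum AutoCost

  OptimalAuto : Schedule → Set (c ⊔ˡ ℓ)
  OptimalAuto σ = Feasible σ × (∀ τ → Feasible τ → cost σ ≤ cost τ)

  ----------------------------------------------------------------------
  -- The kernel and the recurrence

  blockSites : Fin m → Fin m → List (Fin N)
  blockSites p j = concatMap (toList ∘ epoch) (filter (p Fin.≤?_) (filter (Fin._≤? j) (allFin m)))

  -- Used for p ≤ j only; then the default value is itself one of the values
  -- over which the extremum is taken.
  Lo Hi : Fin m → Fin m → Carrier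
  Lo p j = min (pos (List⁺.head (epoch p))) (map pos (blockSites p j))
  Hi p j = max (pos (List⁺.head (epoch p))) (map pos (blockSites p j))

  K : Fin m → Fin m → Fin N → Fin N → Carrier
  K p j y z = (Hi p j - Lo p j)
            + ((∣ pos y - Lo p j ∣ + ∣ Hi p j - pos z ∣) ⊓ (∣ pos y - Hi p j ∣ + ∣ Lo p j - pos z ∣))

  -- K + aⱼ - aₚ
  blockCost : Fin m → Fin m → Fin N → Fin N → Carrier
  blockCost p j y z = K p j y z + arrival j - arrival p

  -- Layer 0 of F precedes all epochs and layer `suc j` is the one whose last
  -- epoch is j.  A block ending with epoch j is given by p : Fin′ (suc j): its
  -- first epoch is `inject! p ≤ j`, and the layer just before it is `inject p`,
  -- both with the same underlying number as p.

  inject-< : ∀ {j : Fin m} (p : Fin′ (suc j)) → inject {i = suc j} p Fin.< suc j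
  inject-< {j} p = subst (ℕ._< suc (toℕ j)) (sym (Fin.toℕ-inject {i = suc j} p)) (Fin.toℕ<n p)

  private
    Layer : Fin (suc m) → Set c
    Layer _ = Vec (Carrier ⁺) N

    base : Fin N → Carrier ⁺
    base z = if does (z Fin.≟ s₀) then [ 0# ] else ⊤⁺

    candidates : ∀ j → (Fin′ (suc j) → Fin N → Carrier ⁺) → Fin N → List (Carrier ⁺)
    candidates j f z = cartesianProductWith
      (λ p y → f p y +⁺ blockCost (inject! {i = suc j} p) j y z)
      (allFin (suc (toℕ j))) (allFin N)

    layerStep : ∀ i → WfRec Fin._<_ Layer i → Layer i
    layerStep zero    rec = Vec.tabulate base
    layerStep (suc j) rec = Vec.tabulate λ z →
      min⁺ (candidates j (λ p → Vec.lookup (rec (inject-< {j} p))) z)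

  F : Fin (suc m) → Fin N → Carrier ⁺
  F i = Vec.lookup (All.wfRec Fin-<-wellFounded _ Layer layerStep i)

  F-zero : ∀ z → F zero z ≡ (if does (z Fin.≟ s₀) then [ 0# ] else ⊤⁺)
  F-suc  : ∀ j z → F (suc j) z ≡ min⁺ (cartesianProductWith
             (λ p y → F (inject {i = suc j} p) y +⁺ blockCost (inject! {i = suc j} p) j y z)
             (allFin (suc (toℕ j))) (allFin N))

  private
    cpw-cong : ∀ {a b d} {A : Set a} {B : Set b} {D : Set d} {f g : A → B → D} →
               (∀ x y → f x y ≡ g x y) → ∀ xs ys →
               cartesianProductWith f xs ys ≡ cartesianProductWith g xs ys
    cpw-cong f≗g []       ys = refl
    cpw-cong f≗g (x ∷ xs) ys = cong₂ _++_ (map-cong (f≗g x) ys) (cpw-cong f≗g xs ys)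

    layerStep-ext : ∀ i {IH IH′ : WfRec Fin._<_ Layer i} →
                    (∀ {k} (k<i : k Fin.< i) → IH {k} k<i ≡ IH′ k<i) →
                    layerStep i IH ≡ layerStep i IH′
    layerStep-ext zero    eq = refl
    layerStep-ext (suc j) eq = tabulate-cong λ z → cong min⁺ (cpw-cong
      (λ p y → cong (λ v → Vec.lookup v y +⁺ blockCost (inject! {i = suc j} p) j y z) (eq _))
      (allFin (suc (toℕ j))) (allFin N))

    layer-unfold : ∀ i → All.wfRec Fin-<-wellFounded _ Layer layerStep i
                       ≡ layerStep i (λ {k} _ → All.wfRec Fin-<-wellFounded _ Layer layerStep k)
    layer-unfold i = FixPoint.unfold-wfRec Fin-<-wellFounded Layer layerStep layerStep-ext {i}

  F-zero z = trans (cong (λ v → Vec.lookup v z) (layer-unfold zero)) (lookup∘tabulate _ z)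
  F-suc j z = trans (cong (λ v → Vec.lookup v z) (layer-unfold (suc j))) (lookup∘tabulate _ z)

  final : Fin (suc m)
  final = fromℕ m

  minF : Carrier ⁺
  minF = min⁺ (map (F final) (allFin N))

  -- (p , y) attains the minimum defining F (suc j) z.
  Attains : (j : Fin m) (z : Fin N) → Fin′ (suc j) → Fin N → Set c
  Attains j z p y =
    F (suc j) z ≡ F (inject {i = suc j} p) y +⁺ blockCost (inject! {i = suc j} p) j y z

  ----------------------------------------------------------------------
  -- Traceback and replay

  record BlockWalk (p j : Fin m) (y z : Fin N) : Set c where
    field
      walk     : Walk
      from     : List⁺.head walk ≡ y
      to       : List⁺.last walk ≡ z
      length≡K : len walk ≡ K p j y z
      -- The extremes of the block are among its requested sites.
      covers   : All (_∈ toList walk) (blockSites p j)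

  data Reconstruction : Fin (suc m) → Fin N → Set c where
    start : Reconstruction zero s₀
    block : ∀ {j z} (p : Fin′ (suc j)) (y : Fin N) → Attains j z p y →
            Reconstruction (inject {i = suc j} p) y →
            BlockWalk (inject! {i = suc j} p) j y z →
            Reconstruction (suc j) z

  -- Automatic service is part of `run`.
  replay : ∀ {i z} → Reconstruction i z → Schedule
  replay start                 = []
  replay (block {j} p y _ r w) = replay r ∷ʳ ((BlockWalk.walk w ∷ []) at arrival j)

------------------------------------------------------------------------
-- A random access machine with integer and real cells

-- The input is read-only.  The working storage consists of finitely many
-- integer and real registers and arrays; their numbers are fixed by the
-- program.  Reals can only be copied, added, subtracted and compared.

record Storage : Set where
  field
    intRegs realRegs intArrays realArrays : ℕ

module _ (σ : Storage) where
  open Storage σ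

  infixl 6 _⊕_ _⊖_ _⊕ᴿ_ _⊖ᴿ_
  infixl 7 _⊗_
  infix  4 _<ᴵ_ _≤ᴿ_
  infixr 3 _⨾_

  data IntExp : Set where
    lit           : ℕ → IntExp
    reg           : Fin intRegs → IntExp
    get           : Fin intArrays → IntExp → IntExp
    _⊕_ _⊖_ _⊗_   : IntExp → IntExp → IntExp
    #sites        : IntExp
    #epochs       : IntExp
    startSite     : IntExp
    #requests     : IntExp → IntExp             -- in the given epoch
    requestSite   : IntExp → IntExp → IntExp    -- epoch, position in the epoch

  data RealExp : Set where
    reg           : Fin realRegs → RealExp
    get           : Fin realArrays → IntExp → RealExp
    _⊕ᴿ_ _⊖ᴿ_     : RealExp → RealExp → RealExp
    position      : IntExp → RealExp
    arrivalTime   : IntExp → RealExp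

  data Test : Set where
    _<ᴵ_ : IntExp → IntExp → Test
    _≤ᴿ_ : RealExp → RealExp → Test

  data Command : Set where
    skip : Command
    setᴵ : Fin intRegs → IntExp → Command
    setᴿ : Fin realRegs → RealExp → Command
    putᴵ : Fin intArrays → IntExp → IntExp → Command      -- array, index, value
    putᴿ : Fin realArrays → IntExp → RealExp → Command
    _⨾_  : Command → Command → Command
    cond : Test → Command → Command → Command
    -- `for i e c` evaluates e to n once and runs c with register i set to
    -- 0, …, n - 1 in turn.
    for  : Fin intRegs → IntExp → Command → Command

record Program : Set where
  field
    storage      : Storage
    body         : Command storage
    -- Where the results are found at the end; the arrays are two-dimensional
    -- tables in row-major order.
    valueReg     : Fin (Storage.realRegs storage)
    argminReg    : Fin (Storage.intRegs storage)
    tableF       : Fin (Storage.realArrays storage)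
    pointerBlock : Fin (Storage.intArrays storage)
    pointerSite  : Fin (Storage.intArrays storage)

  open Storage storage public

module _ {c ℓ} {R : LinearlyOrderedAbelianGroup c ℓ} (I : Input R) (σ : Storage) where

  open LinearlyOrderedAbelianGroup R using (Carrier; 0#; _+_; _-_; _≤?_)
  open Input I
  open Storage σ

  record Memory : Set c where
    field
      intReg    : Vector ℕ intRegs
      realReg   : Vector Carrier realRegs
      intArray  : Vector (ℕ → ℕ) intArrays
      realArray : Vector (ℕ → Carrier) realArrays
      steps     : ℕ
      -- 1 + the largest array index accessed so far, or 0.
      extent    : ℕ
  open Memory public

  blank : Memory
  blank = record
    { intReg    = λ _ → 0
    ; realReg   = λ _ → 0#
    ; intArray  = λ _ _ → 0
    ; realArray = λ _ _ → 0#
    ; steps     = 0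
    ; extent    = 0
    }

  -- Input cells outside the valid range read as a default value.
  readOr : ∀ {a} {A : Set a} {n} → A → (Fin n → A) → ℕ → A
  readOr {n = n} d f i with i ℕ.<? n
  ... | yes i<n = f (fromℕ< i<n)
  ... | no  _   = d

  write : ∀ {a} {A : Set a} → ℕ → A → (ℕ → A) → (ℕ → A)
  write i x f k = if does (k ℕ.≟ i) then x else f k

  evalᴵ : IntExp σ → Memory → ℕ
  evalᴵ (lit n)           M = n
  evalᴵ (reg r)           M = intReg M r
  evalᴵ (get A e)         M = intArray M A (evalᴵ e M)
  evalᴵ (e ⊕ f)           M = evalᴵ e M ℕ.+ evalᴵ f M
  evalᴵ (e ⊖ f)           M = evalᴵ e M ℕ.∸ evalᴵ f M
  evalᴵ (e ⊗ f)           M = evalᴵ e M ℕ.* evalᴵ f M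
  evalᴵ #sites            M = N
  evalᴵ #epochs           M = m
  evalᴵ startSite         M = toℕ s₀
  evalᴵ (#requests e)     M = readOr 0 (List⁺.length ∘ epoch) (evalᴵ e M)
  evalᴵ (requestSite e f) M =
    readOr 0 (λ h → readOr 0 (toℕ ∘ List.lookup (toList (epoch h))) (evalᴵ f M)) (evalᴵ e M)

  evalᴿ : RealExp σ → Memory → Carrier
  evalᴿ (reg r)         M = realReg M r
  evalᴿ (get A e)       M = realArray M A (evalᴵ e M)
  evalᴿ (e ⊕ᴿ f)        M = evalᴿ e M + evalᴿ f M
  evalᴿ (e ⊖ᴿ f)        M = evalᴿ e M - evalᴿ f M
  evalᴿ (position e)    M = readOr 0# pos (evalᴵ e M)
  evalᴿ (arrivalTime e) M = readOr 0# arrival (evalᴵ e M)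

  evalᵀ : Test σ → Memory → Bool
  evalᵀ (e <ᴵ f) M = does (evalᴵ e M ℕ.<? evalᴵ f M)
  evalᵀ (e ≤ᴿ f) M = does (evalᴿ e M ≤? evalᴿ f M)

  -- Evaluating an expression takes one step per node.

  stepsᴵ : IntExp σ → ℕ
  stepsᴵ (get A e)         = suc (stepsᴵ e)
  stepsᴵ (e ⊕ f)           = suc (stepsᴵ e ℕ.+ stepsᴵ f)
  stepsᴵ (e ⊖ f)           = suc (stepsᴵ e ℕ.+ stepsᴵ f)
  stepsᴵ (e ⊗ f)           = suc (stepsᴵ e ℕ.+ stepsᴵ f)
  stepsᴵ (#requests e)     = suc (stepsᴵ e)
  stepsᴵ (requestSite e f) = suc (stepsᴵ e ℕ.+ stepsᴵ f)
  stepsᴵ (lit _)           = 1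
  stepsᴵ (reg _)           = 1
  stepsᴵ #sites            = 1
  stepsᴵ #epochs           = 1
  stepsᴵ startSite         = 1

  stepsᴿ : RealExp σ → ℕ
  stepsᴿ (reg _)         = 1
  stepsᴿ (get A e)       = suc (stepsᴵ e)
  stepsᴿ (e ⊕ᴿ f)        = suc (stepsᴿ e ℕ.+ stepsᴿ f)
  stepsᴿ (e ⊖ᴿ f)        = suc (stepsᴿ e ℕ.+ stepsᴿ f)
  stepsᴿ (position e)    = suc (stepsᴵ e)
  stepsᴿ (arrivalTime e) = suc (stepsᴵ e)

  stepsᵀ : Test σ → ℕ
  stepsᵀ (e <ᴵ f) = suc (stepsᴵ e ℕ.+ stepsᴵ f)
  stepsᵀ (e ≤ᴿ f) = suc (stepsᴿ e ℕ.+ stepsᴿ f)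

  -- 1 + the largest array index accessed while evaluating, or 0.

  extentᴵ : IntExp σ → Memory → ℕ
  extentᴵ (get A e)         M = suc (evalᴵ e M) ℕ.⊔ extentᴵ e M
  extentᴵ (e ⊕ f)           M = extentᴵ e M ℕ.⊔ extentᴵ f M
  extentᴵ (e ⊖ f)           M = extentᴵ e M ℕ.⊔ extentᴵ f M
  extentᴵ (e ⊗ f)           M = extentᴵ e M ℕ.⊔ extentᴵ f M
  extentᴵ (#requests e)     M = extentᴵ e M
  extentᴵ (requestSite e f) M = extentᴵ e M ℕ.⊔ extentᴵ f M
  extentᴵ (lit _)           M = 0
  extentᴵ (reg _)           M = 0
  extentᴵ #sites            M = 0
  extentᴵ #epochs           M = 0
  extentᴵ startSite         M = 0

  extentᴿ : RealExp σ → Memory → ℕ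
  extentᴿ (reg _)         M = 0
  extentᴿ (get A e)       M = suc (evalᴵ e M) ℕ.⊔ extentᴵ e M
  extentᴿ (e ⊕ᴿ f)        M = extentᴿ e M ℕ.⊔ extentᴿ f M
  extentᴿ (e ⊖ᴿ f)        M = extentᴿ e M ℕ.⊔ extentᴿ f M
  extentᴿ (position e)    M = extentᴵ e M
  extentᴿ (arrivalTime e) M = extentᴵ e M

  extentᵀ : Test σ → Memory → ℕ
  extentᵀ (e <ᴵ f) M = extentᴵ e M ℕ.⊔ extentᴵ f M
  extentᵀ (e ≤ᴿ f) M = extentᴿ e M ℕ.⊔ extentᴿ f M

  charge : ℕ → ℕ → Memory → Memory
  charge s x M = record M { steps = steps M ℕ.+ s ; extent = extent M ℕ.⊔ x }

  -- repeat n f = f (n - 1) ∘ … ∘ f 0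
  repeat : ∀ {a} {A : Set a} → ℕ → (ℕ → A → A) → A → A
  repeat zero    f x = x
  repeat (suc n) f x = f n (repeat n f x)

  assignᴵ : Fin intRegs → ℕ → Memory → Memory
  assignᴵ r n M = record M { intReg = Vector.updateAt (intReg M) r (λ _ → n) }

  exec : Command σ → Memory → Memory
  exec skip         M = charge 1 0 M
  exec (setᴵ r e)   M = charge (suc (stepsᴵ e)) (extentᴵ e M) (assignᴵ r (evalᴵ e M) M)
  exec (setᴿ r e)   M = charge (suc (stepsᴿ e)) (extentᴿ e M)
    record M { realReg = Vector.updateAt (realReg M) r (λ _ → evalᴿ e M) }
  exec (putᴵ A i e) M =
    charge (suc (stepsᴵ i ℕ.+ stepsᴵ e)) (suc (evalᴵ i M) ℕ.⊔ extentᴵ i M ℕ.⊔ extentᴵ e M)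
      record M { intArray = Vector.updateAt (intArray M) A (write (evalᴵ i M) (evalᴵ e M)) }
  exec (putᴿ A i e) M =
    charge (suc (stepsᴵ i ℕ.+ stepsᴿ e)) (suc (evalᴵ i M) ℕ.⊔ extentᴵ i M ℕ.⊔ extentᴿ e M)
      record M { realArray = Vector.updateAt (realArray M) A (write (evalᴵ i M) (evalᴿ e M)) }
  exec (c ⨾ d)      M = exec d (exec c M)
  exec (cond b c d) M =
    if evalᵀ b M then exec c (charge (suc (stepsᵀ b)) (extentᵀ b M) M)
                 else exec d (charge (suc (stepsᵀ b)) (extentᵀ b M) M)
  exec (for r e c)  M =
    repeat (evalᴵ e M) (λ i M′ → exec c (charge 1 0 (assignᴵ r i M′)))
           (charge (suc (stepsᴵ e)) (extentᴵ e M) M)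

module _ {c ℓ} {R : LinearlyOrderedAbelianGroup c ℓ} (P : Program) (I : Input R) where

  open Program P
  open Input I

  result : Memory I storage
  result = exec I storage body (blank I storage)

  time-used : ℕ
  time-used = steps result

  -- All cells of all registers and of all arrays, each array counted up to the
  -- largest index accessed in any of them.
  space-used : ℕ
  space-used = intRegs ℕ.+ realRegs ℕ.+ (intArrays ℕ.+ realArrays) ℕ.* extent result

  cell : Fin m → Fin N → ℕ
  cell j z = toℕ j ℕ.* N ℕ.+ toℕ z

  record ComputesRecurrence : Set c where
    field
      value    : [ realReg result valueReg ] ≡ minF I
      argmin   : ∃[ z ] toℕ z ≡ intReg result argminReg × F I (final I) z ≡ minF I
      table    : ∀ j z → [ realArray result tableF (cell j z) ] ≡ F I (suc j) z
      pointers : ∀ j z → ∃[ p ] ∃[ y ]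
                   toℕ p ≡ intArray result pointerBlock (cell j z) ×
                   toℕ y ≡ intArray result pointerSite (cell j z) ×
                   Attains I j z p y

{-# OPTIONS --safe #-}

-- Lower bound: follow an automatic schedule and keep one open block of
-- consecutive epochs.  While the block is open, the delays paid reach from its
-- first epoch to the arrival of some pending request, whose own delay covers the
-- time from there to its service; once nothing is pending they cover the whole
-- block, and the movement made meanwhile visits both extremes and is therefore
-- at least K.  Closing the block is then a step of the recurrence.
--
-- Upper bound: every block of a reconstruction is walked at its last arrival
-- time, when all pending requests belong to the block; automatic service can
-- only remove requests from it beforehand, so the replay costs at most F.
--
-- Complexity: K is 1-Lipschitz in its last argument, so for h ≥ 1 the layer
-- F[h,·] coincides with G_h, and only G_0(x) = |s₀ - x| differs.  Hence a block
-- [p,j] contributes to F[j,z] just two offers, one for each extreme that may be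
-- visited first.  The program runs through p, then j ≥ p, then z; this order is
-- sound because row p - 1 has received all its offers when pass p reads it.

module Submission where

open import Defs
open import Algebra.Bundles using (AbelianGroup)
import Algebra.Construct.NaturalChoice.Max as NaturalMax
import Algebra.Construct.NaturalChoice.Min as NaturalMin
import Algebra.Properties.AbelianGroup as GroupProperties
import Algebra.Solver.CommutativeMonoid as MonoidSolver
import Algebra.Solver.CommutativeMonoid.Normal as MonoidNormal
open import Data.Bool.Base using (if_then_else_; true; false; T)
open import Data.Fin.Base as Fin
  using (Fin; Fin′; zero; suc; toℕ; inject; inject!; fromℕ<; opposite; inject₁)
open import Data.Fin.Patterns
import Data.Fin.Properties as Fin
open import Data.List.Base as List
  using (List; []; _∷_; _++_; map; filter; allFin; cartesianProductWith; foldl; takeWhile;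
         dropWhile; tabulate; concatMap; _∷ʳ_)
import Data.List.Extrema as Extrema
open import Data.List.Membership.Propositional using (_∈_; find; lose)
open import Data.List.Membership.Propositional.Properties
  using (∈-map⁺; ∈-map⁻; ∈-concatMap⁺; ∈-concatMap⁻; ∈-filter⁺; ∈-filter⁻; ∈-allFin;
         ∈-cartesianProductWith⁺; ∈-cartesianProductWith⁻; ∈-++⁺ˡ; ∈-++⁺ʳ; ∈-++⁻; ∈-tabulate⁺;
         ∈-lookup)
open import Data.List.NonEmpty as List⁺ using (List⁺; _∷_; toList)
open import Data.List.Properties using (foldl-∷ʳ; concatMap-++; filter-none; map-tabulate)
open import Data.List.Relation.Unary.All as All using (All; []; _∷_)
import Data.List.Relation.Unary.All.Properties as All
open import Data.List.Relation.Unary.AllPairs as AllPairs using (AllPairs; []; _∷_)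
import Data.List.Relation.Unary.AllPairs.Properties as AllPairs
open import Data.List.Relation.Unary.Any as Any using (here; there)
import Data.List.Relation.Unary.Any.Properties as Any
open import Data.List.Relation.Unary.Linked as Linked using (Linked; []; _∷_)
open import Data.List.Relation.Unary.Linked.Properties using (AllPairs⇒Linked)
open import Data.Nat.Base as ℕ using (ℕ; zero; suc; s≤s; z≤n)
open import Data.Nat.ListAction using (sum)
import Data.Nat.Properties as ℕ
open import Data.Nat.Tactic.RingSolver using (solve-∀)
open import Data.Product.Base using (∃-syntax; _×_; _,_; proj₁; proj₂)
open import Data.Sum.Base as Sum using (_⊎_; inj₁; inj₂)
open import Data.Unit.Polymorphic.Base using (tt)
open import Data.Vec.Base as Vec using (Vec)
open import Data.Vec.Functional as Vector using (Vector)
open import Data.Vec.N-ary using (N-ary; _$ⁿ_; Eq; curryⁿ; curryⁿ-cong)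
open import Function.Base using (_∘_; id)
import Level
open import Relation.Binary.Bundles using (TotalOrder; DecTotalOrder)
import Relation.Binary.Construct.Add.Supremum.NonStrict as Supremum
open import Relation.Binary.PropositionalEquality
open import Relation.Nullary.Construct.Add.Supremum using (_⁺; ⊤⁺; [_])
open import Relation.Nullary.Decidable using (Dec; does; yes; no; dec-true; ¬?; dec-false)
open import Relation.Nullary.Negation using (¬_; contradiction)

-- The elective problem never enters: the recurrence is compared with automatic runs from both
-- sides. Blocks are cut where the pending list becomes empty, not at service events, so an
-- arbitrary schedule needs no normal form. The delay of an event is a maximum and cannot be shared
-- among its requests; therefore a single pending request is followed at a time, and consecutive
-- ones take over from each other so that their waiting times tile the block. A replay is only shown
-- to cost at most `F`; the lower bound, which holds for every feasible schedule, turns this into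
-- optimality. The machine has no infinite value. Infinity occurs only in layer zero, so that layer
-- is not stored, and the first pass enters its first offer for each cell without looking at the old
-- content. Blank cells are thus never read as values. The time bound has no term N alone: without
-- epochs the program must not scan the sites. For m at least 1 every lower-order term is absorbed
-- by m · m · N, because `s₀` forces N to be at least 1.

-- Arithmetic in a linearly ordered abelian group.

module OrderedGroup {c ℓ} (R : LinearlyOrderedAbelianGroup c ℓ) where

  open LinearlyOrderedAbelianGroup R

  abelianGroup : AbelianGroup c c
  abelianGroup = record { isAbelianGroup = isAbelianGroup }

  open AbelianGroup abelianGroup public
    using (commutativeMonoid)
    renaming (assoc to +-assoc; comm to +-comm; identityˡ to +-identityˡ;
              identityʳ to +-identityʳ; inverseʳ to +-inverseʳ)
  open GroupProperties abelianGroup public using ()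
    renaming (∙-cancelʳ to +-cancelʳ)

  open DecTotalOrder decTotalOrder public using (total)
    renaming (refl to ≤-refl; reflexive to ≤-reflexive; trans to ≤-trans; antisym to ≤-antisym)
  open NaturalMax totalOrder public
    using (⊔-lub; x≤x⊔y; x≤y⊔x; x≤y⇒y⊔x≈y)
  open NaturalMin totalOrder public
    using (⊓-sel; x⊓y≤x; x⊓y≤y)

  open TotalOrder totalOrder⁺ public using ()
    renaming (reflexive to ≤⁺-reflexive; trans to ≤⁺-trans; antisym to ≤⁺-antisym)
  open Supremum _≤_ public using ([_]; _≤⊤⁺; [≤]-injective)

  -- Every expression is a difference of two monoid expressions, so identities
  -- in the group reduce to identities in its commutative monoid.
  module Solver where

    private
      module M = MonoidSolver commutativeMonoid
      module N = MonoidNormal commutativeMonoid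

    infixl 6 _:+_ _:-_
    infix  4 _:=_

    data Expr (n : ℕ) : Set where
      var       : Fin.Fin n → Expr n
      :0        : Expr n
      _:+_ _:-_ : Expr n → Expr n → Expr n

    _:=_ : ∀ {n} → Expr n → Expr n → Expr n × Expr n
    _:=_ = _,_

    ⟦_⟧ : ∀ {n} → Expr n → Vec Carrier n → Carrier
    ⟦ var i  ⟧ ρ = Vec.lookup ρ i
    ⟦ :0     ⟧ ρ = 0#
    ⟦ e :+ f ⟧ ρ = ⟦ e ⟧ ρ + ⟦ f ⟧ ρ
    ⟦ e :- f ⟧ ρ = ⟦ e ⟧ ρ - ⟦ f ⟧ ρ

    pos neg : ∀ {n} → Expr n → M.Expr n
    pos (var i)  = M.var i
    pos :0       = M.id
    pos (e :+ f) = pos e M.⊕ pos f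
    pos (e :- f) = pos e M.⊕ neg f
    neg (var i)  = M.id
    neg :0       = M.id
    neg (e :+ f) = neg e M.⊕ neg f
    neg (e :- f) = neg e M.⊕ pos f

    private
      interchange : ∀ a b c d → (a + b) + (c + d) ≡ (a + c) + (b + d)
      interchange = M.solve 4 (λ a b c d → (a M.⊕ b) M.⊕ (c M.⊕ d) M.⊜ (a M.⊕ c) M.⊕ (b M.⊕ d)) refl

      cancel-middle : ∀ a b c → (a + (- b)) + (c + b) ≡ a + c
      cancel-middle a b c = trans
        (M.solve 4 (λ a b b⁻ c → (a M.⊕ b⁻) M.⊕ (c M.⊕ b) M.⊜ (b M.⊕ b⁻) M.⊕ (a M.⊕ c)) refl a b (- b) c)
        (trans (cong (_+ (a + c)) (+-inverseʳ b)) (+-identityˡ (a + c)))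

    correct : ∀ {n} (e : Expr n) ρ → ⟦ e ⟧ ρ + M.⟦ neg e ⟧ ρ ≡ M.⟦ pos e ⟧ ρ
    correct (var i)  ρ = +-identityʳ _
    correct :0       ρ = +-identityʳ _
    correct (e :+ f) ρ = trans (interchange _ _ _ _) (cong₂ _+_ (correct e ρ) (correct f ρ))
    correct (e :- f) ρ = begin
      (⟦ e ⟧ ρ - ⟦ f ⟧ ρ) + (M.⟦ neg e ⟧ ρ + M.⟦ pos f ⟧ ρ)
        ≡⟨ cong (λ x → (⟦ e ⟧ ρ - ⟦ f ⟧ ρ) + (M.⟦ neg e ⟧ ρ + x))
             (trans (sym (correct f ρ)) (+-comm _ _)) ⟩
      (⟦ e ⟧ ρ - ⟦ f ⟧ ρ) + (M.⟦ neg e ⟧ ρ + (M.⟦ neg f ⟧ ρ + ⟦ f ⟧ ρ))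
        ≡⟨ cong ((⟦ e ⟧ ρ - ⟦ f ⟧ ρ) +_) (sym (+-assoc _ _ _)) ⟩
      (⟦ e ⟧ ρ - ⟦ f ⟧ ρ) + ((M.⟦ neg e ⟧ ρ + M.⟦ neg f ⟧ ρ) + ⟦ f ⟧ ρ)
        ≡⟨ cancel-middle _ _ _ ⟩
      ⟦ e ⟧ ρ + (M.⟦ neg e ⟧ ρ + M.⟦ neg f ⟧ ρ)
        ≡⟨ sym (+-assoc _ _ _) ⟩
      (⟦ e ⟧ ρ + M.⟦ neg e ⟧ ρ) + M.⟦ neg f ⟧ ρ
        ≡⟨ cong (_+ M.⟦ neg f ⟧ ρ) (correct e ρ) ⟩
      M.⟦ pos e ⟧ ρ + M.⟦ neg f ⟧ ρ ∎
      where open ≡-Reasoning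

    -- Adding both negative parts to both sides clears all subtractions, and what remains is decided
    -- by comparing normal forms in the commutative monoid.
    prove : ∀ {n} (e f : Expr n) ρ →
            M.normalise (pos e M.⊕ neg f) ≡ M.normalise (pos f M.⊕ neg e) → ⟦ e ⟧ ρ ≡ ⟦ f ⟧ ρ
    prove e f ρ eq = +-cancelʳ (M.⟦ neg e ⟧ ρ + M.⟦ neg f ⟧ ρ) _ _ (begin
      ⟦ e ⟧ ρ + (M.⟦ neg e ⟧ ρ + M.⟦ neg f ⟧ ρ)  ≡⟨ sym (+-assoc _ _ _) ⟩
      (⟦ e ⟧ ρ + M.⟦ neg e ⟧ ρ) + M.⟦ neg f ⟧ ρ  ≡⟨ cong (_+ M.⟦ neg f ⟧ ρ) (correct e ρ) ⟩
      M.⟦ pos e M.⊕ neg f ⟧ ρ                    ≡⟨ sym (N.correct (pos e M.⊕ neg f) ρ) ⟩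
      M.⟦ M.normalise (pos e M.⊕ neg f) ⟧⇓ ρ     ≡⟨ cong (λ v → M.⟦ v ⟧⇓ ρ) eq ⟩
      M.⟦ M.normalise (pos f M.⊕ neg e) ⟧⇓ ρ     ≡⟨ N.correct (pos f M.⊕ neg e) ρ ⟩
      M.⟦ pos f M.⊕ neg e ⟧ ρ                    ≡⟨ cong (_+ M.⟦ neg e ⟧ ρ) (sym (correct f ρ)) ⟩
      (⟦ f ⟧ ρ + M.⟦ neg f ⟧ ρ) + M.⟦ neg e ⟧ ρ  ≡⟨ +-assoc _ _ _ ⟩
      ⟦ f ⟧ ρ + (M.⟦ neg f ⟧ ρ + M.⟦ neg e ⟧ ρ)  ≡⟨ cong (⟦ f ⟧ ρ +_) (+-comm _ _) ⟩
      ⟦ f ⟧ ρ + (M.⟦ neg e ⟧ ρ + M.⟦ neg f ⟧ ρ)  ∎)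
      where open ≡-Reasoning

    module _ (n : ℕ) (f : N-ary n (Expr n) (Expr n × Expr n)) where

      private
        sides : Expr n × Expr n
        sides = f $ⁿ Vec.map var (Vec.allFin n)

      solve : M.normalise (pos (proj₁ sides) M.⊕ neg (proj₂ sides)) ≡
              M.normalise (pos (proj₂ sides) M.⊕ neg (proj₁ sides)) →
              Eq n _≡_ (curryⁿ ⟦ proj₁ sides ⟧) (curryⁿ ⟦ proj₂ sides ⟧)
      solve eq = curryⁿ-cong _≡_ ⟦ proj₁ sides ⟧ ⟦ proj₂ sides ⟧
                   (λ ρ → prove (proj₁ sides) (proj₂ sides) ρ eq)

  open Solver using (solve; _:+_; _:-_; _:=_; :0)

  infixl 6 _+-mono_
  _+-mono_ : ∀ {a b x y} → a ≤ b → x ≤ y → a + x ≤ b + y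
  _+-mono_ {a} {b} {x} {y} a≤b x≤y = ≤-trans (+-monoˡ-≤ x a≤b)
    (subst₂ _≤_ (+-comm x b) (+-comm y b) (+-monoˡ-≤ b x≤y))

  -- Every linear consequence of a sum a ≤ b of hypotheses has this form.
  by : ∀ {a b x y} → a ≤ b → x + b ≡ y + a → x ≤ y
  by {a} {b} {x} {y} a≤b eq = subst₂ _≤_ (drop x) (drop y)
    (+-monoˡ-≤ (- b) (≤-trans (≤-reflexive eq) (≤-refl +-mono a≤b)))
    where
    drop : ∀ z → (z + b) + (- b) ≡ z
    drop z = solve 2 (λ z b → (z :+ b) :- b := z) refl z b

  ≰⇒≥ : ∀ {x y} → ¬ x ≤ y → y ≤ x
  ≰⇒≥ {x} {y} x≰y with total x y
  ... | inj₁ x≤y = contradiction x≤y x≰y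
  ... | inj₂ y≤x = y≤x

  0≤- : ∀ {x y} → x ≤ y → 0# ≤ y - x
  0≤- {x} {y} x≤y = by x≤y (solve 2 (λ x y → :0 :+ y := y :- x :+ x) refl x y)

  x≤∣x∣ : ∀ x → x ≤ ∣ x ∣
  x≤∣x∣ x = x≤x⊔y x (- x)

  -x≤∣x∣ : ∀ x → - x ≤ ∣ x ∣
  -x≤∣x∣ x = x≤y⊔x x (- x)

  ∣x∣≤ : ∀ {x y} → x ≤ y → - x ≤ y → ∣ x ∣ ≤ y
  ∣x∣≤ = ⊔-lub

  0≤⇒∣x∣≡x : ∀ {x} → 0# ≤ x → ∣ x ∣ ≡ x
  0≤⇒∣x∣≡x {x} 0≤x = x≤y⇒y⊔x≈y
    (by (0≤x +-mono 0≤x)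
        (trans (+-comm (- x) (x + x)) (solve 1 (λ x → (x :+ x) :- x := x :+ (:0 :+ :0)) refl x)))

  -‿flip : ∀ x y → - (x - y) ≡ y - x
  -‿flip x y = trans (sym (+-identityˡ _)) (solve 2 (λ x y → :0 :- (x :- y) := y :- x) refl x y)

  ∣-∣-sym : ∀ x y → ∣ x - y ∣ ≡ ∣ y - x ∣
  ∣-∣-sym x y = ≤-antisym (half x y) (half y x)
    where
    half : ∀ x y → ∣ x - y ∣ ≤ ∣ y - x ∣
    half x y = ∣x∣≤
      (subst (_≤ ∣ y - x ∣) (-‿flip y x) (-x≤∣x∣ (y - x)))
      (subst (_≤ ∣ y - x ∣) (sym (-‿flip x y)) (x≤∣x∣ (y - x)))

  ≤⇒∣-∣≡ : ∀ {x y} → y ≤ x → ∣ x - y ∣ ≡ x - y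
  ≤⇒∣-∣≡ y≤x = 0≤⇒∣x∣≡x (0≤- y≤x)

  ≤⇒∣-∣≡′ : ∀ {x y} → x ≤ y → ∣ x - y ∣ ≡ y - x
  ≤⇒∣-∣≡′ {x} {y} x≤y = trans (∣-∣-sym x y) (≤⇒∣-∣≡ x≤y)

  ∣x-x∣≡0 : ∀ x → ∣ x - x ∣ ≡ 0#
  ∣x-x∣≡0 x = trans (≤⇒∣-∣≡ (≤-refl {x})) (+-inverseʳ x)

  0≤∣x-y∣ : ∀ x y → 0# ≤ ∣ x - y ∣
  0≤∣x-y∣ x y with total x y
  ... | inj₁ x≤y = subst (0# ≤_) (sym (≤⇒∣-∣≡′ x≤y)) (0≤- x≤y)
  ... | inj₂ y≤x = subst (0# ≤_) (sym (≤⇒∣-∣≡ y≤x)) (0≤- y≤x)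

  ∣-∣-triangle : ∀ x y z → ∣ x - z ∣ ≤ ∣ x - y ∣ + ∣ y - z ∣
  ∣-∣-triangle x y z = ∣x∣≤
    (by (x≤∣x∣ (x - y) +-mono x≤∣x∣ (y - z))
        (solve 5 (λ x y z u v → x :- z :+ (u :+ v) := u :+ v :+ (x :- y :+ (y :- z)))
               refl x y z ∣ x - y ∣ ∣ y - z ∣))
    (by (-x≤∣x∣ (x - y) +-mono -x≤∣x∣ (y - z))
        (trans (cong₂ (λ a b → a + b) (-‿flip x z) refl)
        (trans (solve 5 (λ x y z u v → z :- x :+ (u :+ v) := u :+ v :+ (y :- x :+ (z :- y)))
               refl x y z ∣ x - y ∣ ∣ y - z ∣)
          (cong₂ (λ a b → ∣ x - y ∣ + ∣ y - z ∣ + (a + b)) (sym (-‿flip x y)) (sym (-‿flip y z))))))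

  +⁺-monoˡ : ∀ {x y} a → x ≤⁺ y → x +⁺ a ≤⁺ y +⁺ a
  +⁺-monoˡ a [ x≤y ]   = [ +-monoˡ-≤ a x≤y ]
  +⁺-monoˡ a (_ ≤⊤⁺) = _ ≤⊤⁺

  +⁺-monoʳ : ∀ x {a b} → a ≤ b → x +⁺ a ≤⁺ x +⁺ b
  +⁺-monoʳ [ x ] a≤b = [ ≤-refl +-mono a≤b ]
  +⁺-monoʳ ⊤⁺    a≤b = ⊤⁺ ≤⊤⁺

  +⁺-assoc : ∀ x a b → (x +⁺ a) +⁺ b ≡ x +⁺ (a + b)
  +⁺-assoc [ x ] a b = cong [_] (+-assoc x a b)
  +⁺-assoc ⊤⁺    a b = refl

  +⁺-finite : ∀ x {a v} → x +⁺ a ≡ [ v ] → ∃[ u ] x ≡ [ u ] × u + a ≡ v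
  +⁺-finite [ x ] refl = x , refl , refl

  private
    module E = Extrema totalOrder⁺

  min⁺≤ : ∀ {x} xs → x ∈ xs → min⁺ xs ≤⁺ x
  min⁺≤ xs = All.lookup (E.min≤xs ⊤⁺ xs)

  -- `min⁺` folds from `⊤⁺`, so its value is either that default or an element; a finite upper bound
  -- rules the default out.
  min⁺-sel : ∀ {v} xs → min⁺ xs ≤⁺ [ v ] → min⁺ xs ∈ xs
  min⁺-sel xs h with min⁺ xs | E.argmin-sel (λ x → x) ⊤⁺ xs
  min⁺-sel xs () | _ | inj₁ refl
  ... | _ | inj₂ m∈xs = m∈xs

  min⁺-glb : ∀ {v} xs → (∀ {x} → x ∈ xs → v ≤⁺ x) → v ≤⁺ min⁺ xs
  min⁺-glb xs h = E.v≤min⁺ (_ ≤⊤⁺) (All.tabulate h)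

inject-toℕ≡ : ∀ {n} {i : Fin (suc n)} (k : Fin′ i) → toℕ (inject! k) ≡ toℕ k
inject-toℕ≡ {suc n} {suc i} zero    = refl
inject-toℕ≡ {suc n} {suc i} (suc k) = cong suc (inject-toℕ≡ k)

-- Recursion from the front, in step with `lenFrom`; `List⁺.last` goes through a snoc view and does
-- not reduce on a cons.
lastFrom : ∀ {a} {A : Set a} → A → List A → A
lastFrom x []       = x
lastFrom x (y ∷ ys) = lastFrom y ys

last≡lastFrom : ∀ {a} {A : Set a} (x : A) xs → List⁺.last (x ∷ xs) ≡ lastFrom x xs
last≡lastFrom x []       = refl
last≡lastFrom x (y ∷ ys) with List.initLast ys | last≡lastFrom y ys
... | List.[]       | eq = eq
... | zs List.∷ʳ′ z | eq = eq

lastFrom-++ : ∀ {a} {A : Set a} (x : A) xs ys → lastFrom x (xs ++ ys) ≡ lastFrom (lastFrom x xs) ys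
lastFrom-++ x []       ys = refl
lastFrom-++ x (z ∷ xs) ys = lastFrom-++ z xs ys

lastFrom∈ : ∀ {a} {A : Set a} (x : A) xs → lastFrom x xs ∈ x ∷ xs
lastFrom∈ x []       = here refl
lastFrom∈ x (y ∷ ys) = there (lastFrom∈ y ys)

-- Block extremes, the kernel as a shortest walk, and the recurrence.

module Recurrence {c ℓ} {R : LinearlyOrderedAbelianGroup c ℓ} (I : Input R) where

  open LinearlyOrderedAbelianGroup R
  open OrderedGroup R
  open Solver using (solve; _:+_; _:-_; _:=_; :0)
  open Input I

  pos-mono-≤ : ∀ {u v} → u Fin.≤ v → pos u ≤ pos v
  pos-mono-≤ {u} {v} u≤v with ℕ.m≤n⇒m<n∨m≡n u≤v
  ... | inj₁ u<v = proj₁ (pos-mono u<v)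
  ... | inj₂ u≡v = ≤-reflexive (cong pos (Fin.toℕ-injective u≡v))

  pos-cancel-≤ : ∀ {u v} → pos u ≤ pos v → u Fin.≤ v
  pos-cancel-≤ {u} {v} pu≤pv = ℕ.≮⇒≥ λ v<u →
    proj₂ (pos-mono v<u) (≤-antisym (proj₁ (pos-mono v<u)) pu≤pv)

  arrival-mono-≤ : ∀ {h k} → h Fin.≤ k → arrival h ≤ arrival k
  arrival-mono-≤ {u} {v} u≤v with ℕ.m≤n⇒m<n∨m≡n u≤v
  ... | inj₁ u<v = proj₁ (arrival-mono u<v)
  ... | inj₂ u≡v = ≤-reflexive (cong arrival (Fin.toℕ-injective u≡v))

  arrival-cancel-≤ : ∀ {h k} → arrival h ≤ arrival k → h Fin.≤ k
  arrival-cancel-≤ {h} {k} le = ℕ.≮⇒≥ λ k<h →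
    proj₂ (arrival-mono k<h) (≤-antisym (proj₁ (arrival-mono k<h)) le)
  -- Extremes of a block

  ∈-blockSites⁺ : ∀ {p j h v} → p Fin.≤ h → h Fin.≤ j → v ∈ toList (epoch h) → v ∈ blockSites I p j
  ∈-blockSites⁺ {p} {j} {h} p≤h h≤j v∈ = ∈-concatMap⁺ (toList ∘ epoch)
    (lose (∈-filter⁺ (p Fin.≤?_) (∈-filter⁺ (Fin._≤? j) (∈-allFin h) h≤j) p≤h) v∈)

  ∈-blockSites⁻ : ∀ {p j v} → v ∈ blockSites I p j →
                  ∃[ h ] p Fin.≤ h × h Fin.≤ j × v ∈ toList (epoch h)
  ∈-blockSites⁻ {p} {j} v∈ with find (∈-concatMap⁻ (toList ∘ epoch) v∈)
  ... | h , h∈ , v∈h with ∈-filter⁻ (p Fin.≤?_) {xs = filter (Fin._≤? j) (allFin m)} h∈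
  ... | h∈′ , p≤h = h , p≤h , proj₂ (∈-filter⁻ (Fin._≤? j) {xs = allFin m} h∈′) , v∈h

  -- Extremes as sites instead of scalars: sites are what walks visit and what the program keeps in
  -- integer registers. `Lo≡` and `Hi≡` translate to the real-valued extremes.
  record Extremes (p j : Fin m) (l u : Fin N) : Set where
    field
      lo∈ : l ∈ blockSites I p j
      hi∈ : u ∈ blockSites I p j
      lo≤ : ∀ {v} → v ∈ blockSites I p j → l Fin.≤ v
      ≤hi : ∀ {v} → v ∈ blockSites I p j → v Fin.≤ u

    lo≤hi : l Fin.≤ u
    lo≤hi = lo≤ hi∈

  private
    module E = Extrema totalOrder

    head∈ : ∀ {p j} → p Fin.≤ j → List⁺.head (epoch p) ∈ blockSites I p j
    head∈ {p} p≤j = ∈-blockSites⁺ {p} ℕ.≤-refl p≤j (here refl)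

    Lo≤ : ∀ {p j v} → v ∈ blockSites I p j → Lo I p j ≤ pos v
    Lo≤ {p} {j} v∈ = All.lookup (E.min≤xs _ (map pos (blockSites I p j))) (∈-map⁺ pos v∈)

    ≤Hi : ∀ {p j v} → v ∈ blockSites I p j → pos v ≤ Hi I p j
    ≤Hi {p} {j} v∈ = All.lookup (E.xs≤max _ (map pos (blockSites I p j))) (∈-map⁺ pos v∈)

    Lo-sel : ∀ {p j} → p Fin.≤ j → ∃[ l ] l ∈ blockSites I p j × Lo I p j ≡ pos l
    Lo-sel {p} {j} p≤j with E.argmin-sel (λ x → x) (pos (List⁺.head (epoch p))) (map pos (blockSites I p j))
    ... | inj₁ eq  = _ , head∈ p≤j , eq
    ... | inj₂ lo∈ = ∈-map⁻ pos lo∈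

    Hi-sel : ∀ {p j} → p Fin.≤ j → ∃[ u ] u ∈ blockSites I p j × Hi I p j ≡ pos u
    Hi-sel {p} {j} p≤j with E.argmax-sel (λ x → x) (pos (List⁺.head (epoch p))) (map pos (blockSites I p j))
    ... | inj₁ eq  = _ , head∈ p≤j , eq
    ... | inj₂ hi∈ = ∈-map⁻ pos hi∈

  extremes : ∀ {p j} → p Fin.≤ j → ∃[ l ] ∃[ u ] Extremes p j l u
  extremes p≤j with Lo-sel p≤j | Hi-sel p≤j
  ... | l , l∈ , Lo≡ | u , u∈ , Hi≡ = l , u , record
    { lo∈ = l∈
    ; hi∈ = u∈
    ; lo≤ = λ v∈ → pos-cancel-≤ (subst (_≤ _) Lo≡ (Lo≤ v∈))
    ; ≤hi = λ v∈ → pos-cancel-≤ (subst (_ ≤_) Hi≡ (≤Hi v∈))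
    }

  Extremes⇒≤ : ∀ {p j l u} → Extremes p j l u → p Fin.≤ j
  Extremes⇒≤ ex with ∈-blockSites⁻ (Extremes.lo∈ ex)
  ... | h , p≤h , h≤j , _ = ℕ.≤-trans p≤h h≤j

  Lo≡ : ∀ {p j l u} → Extremes p j l u → Lo I p j ≡ pos l
  Lo≡ {p} {j} ex with Lo-sel (Extremes⇒≤ ex)
  ... | l′ , l′∈ , eq = ≤-antisym (Lo≤ lo∈) (subst (_ ≤_) (sym eq) (pos-mono-≤ (lo≤ l′∈)))
    where open Extremes ex

  Hi≡ : ∀ {p j l u} → Extremes p j l u → Hi I p j ≡ pos u
  Hi≡ {p} {j} ex with Hi-sel (Extremes⇒≤ ex)
  ... | u′ , u′∈ , eq = ≤-antisym (subst (_≤ _) (sym eq) (pos-mono-≤ (≤hi u′∈))) (≤Hi hi∈)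
    where open Extremes ex
  -- The kernel

  private
    D : Fin N → Fin N → Carrier
    D = dist I

  dist-self : ∀ u → dist I u u ≡ 0#
  dist-self u = ∣x-x∣≡0 (pos u)

  dist-sym : ∀ u v → dist I u v ≡ dist I v u
  dist-sym u v = ∣-∣-sym (pos u) (pos v)

  dist-triangle : ∀ u v w → dist I u w ≤ dist I u v + dist I v w
  dist-triangle u v w = ∣-∣-triangle (pos u) (pos v) (pos w)

  0≤dist : ∀ u v → 0# ≤ dist I u v
  0≤dist u v = 0≤∣x-y∣ (pos u) (pos v)

  K≡ : ∀ {p j l u} → Extremes p j l u → ∀ y z →
       K I p j y z ≡ (pos u - pos l) + ((D y l + D u z) ⊓ (D y u + D l z))
  K≡ ex y z = cong₂
    (λ L U → (U - L) + ((∣ pos y - L ∣ + ∣ U - pos z ∣) ⊓ (∣ pos y - U ∣ + ∣ L - pos z ∣)))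
    (Lo≡ ex) (Hi≡ ex)

  dist-lo-hi : ∀ {p j l u} → Extremes p j l u → D l u ≡ pos u - pos l
  dist-lo-hi ex = ≤⇒∣-∣≡′ (pos-mono-≤ (Extremes.lo≤hi ex))

  -- The end site enters only through the last distance: keep the order of the extremes that is best
  -- for z and walk on from z to z′.
  K-lipschitz : ∀ {p j} → p Fin.≤ j → ∀ y z z′ → K I p j y z′ ≤ K I p j y z + D z z′
  K-lipschitz p≤j y z z′ with extremes p≤j
  ... | l , u , ex = subst₂ (λ a b → a ≤ b + D z z′) (sym (K≡ ex y z′)) (sym (K≡ ex y z))
    (≤-trans (≤-refl {pos u - pos l} +-mono step)
      (≤-reflexive (sym (+-assoc (pos u - pos l) ((D y l + D u z) ⊓ (D y u + D l z)) (D z z′)))))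
    where
    detour : ∀ x w → x + D w z′ ≤ x + D w z + D z z′
    detour x w = ≤-trans (≤-refl +-mono dist-triangle w z z′) (≤-reflexive (sym (+-assoc _ _ _)))

    step : (D y l + D u z′) ⊓ (D y u + D l z′) ≤ ((D y l + D u z) ⊓ (D y u + D l z)) + D z z′
    step with ⊓-sel (D y l + D u z) (D y u + D l z)
    ... | inj₁ eq = ≤-trans (x⊓y≤x _ _) (subst (λ a → _ ≤ a + D z z′) (sym eq) (detour (D y l) u))
    ... | inj₂ eq = ≤-trans (x⊓y≤y _ _) (subst (λ a → _ ≤ a + D z z′) (sym eq) (detour (D y u) l))

  dist≤lenFrom : ∀ y vs → D y (lastFrom y vs) ≤ lenFrom I y vs
  dist≤lenFrom y []       = ≤-reflexive (dist-self y)
  dist≤lenFrom y (v ∷ vs) = ≤-trans (dist-triangle y v _) (≤-refl +-mono dist≤lenFrom v vs)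

  0≤lenFrom : ∀ y vs → 0# ≤ lenFrom I y vs
  0≤lenFrom y vs = ≤-trans (0≤dist y (lastFrom y vs)) (dist≤lenFrom y vs)

  lenFrom-++ : ∀ y vs ws → lenFrom I y (vs ++ ws) ≡ lenFrom I y vs + lenFrom I (lastFrom y vs) ws
  lenFrom-++ y []       ws = sym (+-identityˡ _)
  lenFrom-++ y (v ∷ vs) ws = trans (cong (D y v +_) (lenFrom-++ v vs ws)) (sym (+-assoc _ _ _))

  via₁≤lenFrom : ∀ {y vs x} → x ∈ y ∷ vs → D y x + D x (lastFrom y vs) ≤ lenFrom I y vs
  via₁≤lenFrom {y} {vs} (here refl) =
    ≤-trans (≤-reflexive (trans (cong (_+ D y (lastFrom y vs)) (dist-self y)) (+-identityˡ (D y (lastFrom y vs)))))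
      (dist≤lenFrom y vs)
  via₁≤lenFrom {y} {v ∷ vs} {x} (there x∈) = by (dist-triangle y v x +-mono via₁≤lenFrom x∈)
    (solve 6 (λ a b c d e f → a :+ b :+ (c :+ d :+ e) := c :+ e :+ (a :+ (d :+ b))) refl
      (D y x) (D x (lastFrom v vs)) (D y v) (D v x) (lenFrom I v vs) 0#)

  -- The disjunct tells which extreme the walk meets first. Steps are peeled off until the current
  -- vertex is one of the two; from there `via₁≤lenFrom` accounts for the way through the other.
  via₂≤lenFrom : ∀ {y vs l u} → l ∈ y ∷ vs → u ∈ y ∷ vs →
                 (D y l + D u (lastFrom y vs) + D l u ≤ lenFrom I y vs) ⊎
                 (D y u + D l (lastFrom y vs) + D l u ≤ lenFrom I y vs)
  via₂≤lenFrom {y} {vs} {u = u} (here refl) u∈ = inj₁ (≤-trans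
    (≤-reflexive (trans (cong (λ a → a + D u _ + D y u) (dist-self y))
      (solve 2 (λ a b → :0 :+ a :+ b := b :+ a) refl (D u _) (D y u))))
    (via₁≤lenFrom u∈))
  via₂≤lenFrom {y} {vs} {l = l} l∈ (here refl) = inj₂ (≤-trans
    (≤-reflexive (trans (cong₂ (λ a b → a + D l _ + b) (dist-self y) (dist-sym l y))
      (solve 2 (λ a b → :0 :+ a :+ b := b :+ a) refl (D l _) (D y l))))
    (via₁≤lenFrom l∈))
  via₂≤lenFrom {y} {v ∷ vs} {l} {u} (there l∈) (there u∈) =
    Sum.map (extend l) (extend u) (via₂≤lenFrom l∈ u∈)
    where
    extend : ∀ x {a b} → D v x + a + b ≤ lenFrom I v vs → D y x + a + b ≤ D y v + lenFrom I v vs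
    extend x {a} {b} le = by (dist-triangle y v x +-mono le)
      (solve 6 (λ p q r s a b → p :+ a :+ b :+ (q :+ r :+ s) := q :+ s :+ (p :+ (r :+ a :+ b))) refl
        (D y x) (D y v) (D v x) (lenFrom I v vs) a b)

  K≤lenFrom : ∀ {p j} → p Fin.≤ j → ∀ y vs →
              (∀ {x} → x ∈ blockSites I p j → x ∈ y ∷ vs) →
              K I p j y (lastFrom y vs) ≤ lenFrom I y vs
  K≤lenFrom p≤j y vs covers with extremes p≤j
  ... | l , u , ex = ≤-trans (≤-reflexive (K≡ ex y (lastFrom y vs)))
    (subst (λ a → a + ((D y l + D u (lastFrom y vs)) ⊓ (D y u + D l (lastFrom y vs))) ≤ lenFrom I y vs)
      (dist-lo-hi ex) bound)
    where
    bound : D l u + ((D y l + D u (lastFrom y vs)) ⊓ (D y u + D l (lastFrom y vs))) ≤ lenFrom I y vs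
    bound with via₂≤lenFrom (covers (Extremes.lo∈ ex)) (covers (Extremes.hi∈ ex))
    ... | inj₁ le = ≤-trans (≤-refl +-mono x⊓y≤x _ _) (≤-trans (≤-reflexive (+-comm _ _)) le)
    ... | inj₂ le = ≤-trans (≤-refl +-mono x⊓y≤y _ _) (≤-trans (≤-reflexive (+-comm _ _)) le)
  -- The recurrence

  -- F itself unfolds through well-founded recursion as soon as it is normalised.
  abstract
    F° : Fin (suc m) → Fin N → Carrier ⁺
    F° = F I

    F°≡F : ∀ i z → F° i z ≡ F I i z
    F°≡F i z = refl

  candidate : (j : Fin m) (z : Fin N) → Fin′ (suc j) → Fin N → Carrier ⁺
  candidate j z p y = F° (inject {i = suc j} p) y +⁺ blockCost I (inject! {i = suc j} p) j y z

  abstract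
    F°-zero : ∀ z → F° zero z ≡ (if does (z Fin.≟ s₀) then [ 0# ] else ⊤⁺)
    F°-zero = F-zero I

    F°-suc : ∀ j z → F° (suc j) z ≡
             min⁺ (cartesianProductWith (candidate j z) (allFin (suc (toℕ j))) (allFin N))
    F°-suc = F-suc I

    Attains⁺ : ∀ {j z} p y → F° (suc j) z ≡ candidate j z p y → Attains I j z p y
    Attains⁺ p y eq = eq

    Attains⁻ : ∀ {j z} p y → Attains I j z p y → F° (suc j) z ≡ candidate j z p y
    Attains⁻ p y eq = eq

    minF≡ : minF I ≡ min⁺ (map (F° (final I)) (allFin N))
    minF≡ = refl

  block≤ : ∀ j (p : Fin′ (suc j)) → inject! {i = suc j} p Fin.≤ j
  block≤ j p = ℕ.≤-pred (Fin.inject!-< {n = m} {i = suc j} p)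

  toℕ-block : ∀ j (p : Fin′ (suc j)) → toℕ (inject! {i = suc j} p) ≡ toℕ (inject {i = suc j} p)
  toℕ-block j p = trans (inject-toℕ≡ {n = m} {i = suc j} p) (sym (Fin.toℕ-inject {i = suc j} p))

  blockAt : ∀ {j : Fin m} (i : Fin (suc m)) → toℕ i ℕ.≤ toℕ j → ∃[ p ] inject {i = suc j} p ≡ i
  blockAt {j} i i≤j = fromℕ< (s≤s i≤j) , Fin.toℕ-injective
    (trans (Fin.toℕ-inject {i = suc j} (fromℕ< (s≤s i≤j))) (Fin.toℕ-fromℕ< (s≤s i≤j)))

  private
    candidates : ∀ j z → List (Carrier ⁺)
    candidates j z = cartesianProductWith (candidate j z) (allFin (suc (toℕ j))) (allFin N)

    ∈-candidates⁻ : ∀ j z {x} → x ∈ candidates j z → ∃[ p ] ∃[ y ] x ≡ candidate j z p y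
    ∈-candidates⁻ j z x∈ =
      let p , y , _ , _ , eq = ∈-cartesianProductWith⁻ (candidate j z) (allFin (suc (toℕ j))) (allFin N) x∈
      in p , y , eq

  F≤ : ∀ j z p y → F° (suc j) z ≤⁺ candidate j z p y
  F≤ j z p y = subst (_≤⁺ candidate j z p y) (sym (F°-suc j z))
    (min⁺≤ (candidates j z) (∈-cartesianProductWith⁺ (candidate j z) (∈-allFin p) (∈-allFin y)))

  F-glb : ∀ j z {v} → (∀ p y → v ≤⁺ candidate j z p y) → v ≤⁺ F° (suc j) z
  F-glb j z {v} h = subst (v ≤⁺_) (sym (F°-suc j z)) (min⁺-glb (candidates j z) λ x∈ →
    let p , y , eq = ∈-candidates⁻ j z x∈ in subst (v ≤⁺_) (sym eq) (h p y))

  F-attained : ∀ j z {v} → F° (suc j) z ≤⁺ [ v ] → ∃[ p ] ∃[ y ] F° (suc j) z ≡ candidate j z p y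
  F-attained j z {v} le =
    let p , y , eq = ∈-candidates⁻ j z
                       (min⁺-sel (candidates j z) (subst (_≤⁺ [ v ]) (F°-suc j z) le))
    in p , y , trans (F°-suc j z) eq

  F-zero-start : F° zero s₀ ≡ [ 0# ]
  F-zero-start = trans (F°-zero s₀)
    (cong (λ b → if b then [ 0# ] else ⊤⁺) (dec-true (s₀ Fin.≟ s₀) refl))

  F-zero-finite : ∀ {z v} → F° zero z ≤⁺ [ v ] → z ≡ s₀
  F-zero-finite {z} {v} le = decide (z Fin.≟ s₀) (subst (_≤⁺ [ v ]) (F°-zero z) le)
    where
    decide : (d : Dec (z ≡ s₀)) → (if does d then [ 0# ] else ⊤⁺) ≤⁺ [ v ] → z ≡ s₀
    decide (yes eq) _ = eq

  -- The single block from epoch 0 to j, started at `s₀`, is always a candidate. Hence infinity is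
  -- confined to layer zero, and every stored table entry is an ordinary scalar.
  F-suc-finite : ∀ j z → ∃[ v ] F° (suc j) z ≡ [ v ]
  F-suc-finite j z = below (subst (λ x → F° (suc j) z ≤⁺ x +⁺ b) F-zero-start (F≤ j z zero s₀))
    where
    b : Carrier
    b = blockCost I (inject! {i = suc j} zero) j s₀ z

    below : ∀ {x} → x ≤⁺ [ 0# + b ] → ∃[ v ] x ≡ [ v ]
    below {[ v ]} _ = v , refl

  blockCost-lipschitz : ∀ {p j} → p Fin.≤ j → ∀ y z z′ →
                        blockCost I p j y z′ ≤ blockCost I p j y z + D z z′
  blockCost-lipschitz {p} {j} p≤j y z z′ =
    shift (K I p j y z) (K I p j y z′) (arrival j) (arrival p) (D z z′) (K-lipschitz p≤j y z z′)
    where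
    shift : ∀ k k′ a b d → k′ ≤ k + d → (k′ + a) - b ≤ ((k + a) - b) + d
    shift k k′ a b d le = by le
      (solve 5 (λ k k′ a b d → k′ :+ a :- b :+ (k :+ d) := k :+ a :- b :+ d :+ k′) refl k k′ a b d)

  -- Keep the last block and its start site from an optimal choice for z and change only where that
  -- block ends.
  F-lipschitz : ∀ j z z′ → F° (suc j) z′ ≤⁺ F° (suc j) z +⁺ D z z′
  F-lipschitz j z z′ = extend (F-attained j z (≤⁺-reflexive (proj₂ (F-suc-finite j z))))
    where
    extend : ∃[ p ] ∃[ y ] F° (suc j) z ≡ candidate j z p y → F° (suc j) z′ ≤⁺ F° (suc j) z +⁺ D z z′
    extend (p , y , att) = ≤⁺-trans (F≤ j z′ p y)
      (≤⁺-trans (+⁺-monoʳ x (blockCost-lipschitz (block≤ j p) y z z′))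
        (≤⁺-reflexive (trans (sym (+⁺-assoc x _ (D z z′))) (cong (_+⁺ D z z′) (sym att)))))
      where
      x : Carrier ⁺
      x = F° (inject {i = suc j} p) y

  private
    finals : List (Carrier ⁺)
    finals = map (F° (final I)) (allFin N)

  minF≤ : ∀ z → minF I ≤⁺ F° (final I) z
  minF≤ z = subst (_≤⁺ F° (final I) z) (sym minF≡) (min⁺≤ finals (∈-map⁺ (F° (final I)) (∈-allFin z)))

  minF-attained : ∀ {v} → minF I ≤⁺ [ v ] → ∃[ z ] minF I ≡ F° (final I) z
  minF-attained {v} le =
    let z , _ , eq = ∈-map⁻ (F° (final I)) (min⁺-sel finals (subst (_≤⁺ [ v ]) minF≡ le))
    in z , trans minF≡ eq

-- Lower bound: charging an automatic run to blocks of the recurrence.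

data Ascending {m} : ℕ → List (Fin m) → Set where
  []   : Ascending m []
  next : ∀ {n h hs} → toℕ h ≡ n → Ascending (suc n) hs → Ascending n (h ∷ hs)

Ascending⇒≤ : ∀ {m n} {hs : List (Fin m)} → Ascending n hs → n ℕ.≤ m
Ascending⇒≤ []                   = ℕ.≤-refl
Ascending⇒≤ (next {h = h} refl _) = Fin.toℕ≤n h

Ascending-tabulate : ∀ {m} k n (f : Fin k → Fin m) → (∀ i → toℕ (f i) ≡ n ℕ.+ toℕ i) → n ℕ.+ k ≡ m →
                     Ascending n (tabulate f)
Ascending-tabulate {m} zero n f f≡ eq = subst (λ n → Ascending {m} n []) (trans (sym eq) (ℕ.+-identityʳ n)) []
Ascending-tabulate (suc k) n f f≡ eq = next (trans (f≡ zero) (ℕ.+-identityʳ n))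
  (Ascending-tabulate k (suc n) (f ∘ suc) (λ i → trans (f≡ (suc i)) (ℕ.+-suc n (toℕ i)))
    (trans (sym (ℕ.+-suc n k)) eq))

Ascending-allFin : ∀ m → Ascending 0 (allFin m)
Ascending-allFin m = Ascending-tabulate m 0 id (λ _ → refl) refl

module LowerBound {c ℓ} {R : LinearlyOrderedAbelianGroup c ℓ} (I : Input R) where

  open LinearlyOrderedAbelianGroup R
  open OrderedGroup R
  open Solver using (solve; _:+_; _:-_; _:=_; :0)
  open Input I
  open Recurrence I

  private
    module E = Extrema totalOrder

  wait≤delayCost : ∀ {t q qs} → q ∈ qs → wait I t q ≤ delayCost I t qs
  wait≤delayCost {t} {qs = q ∷ qs} (here refl) = E.⊥≤max (wait I t q) (map (wait I t) qs)
  wait≤delayCost {t} {qs = q ∷ qs} (there q∈)  = All.lookup (E.xs≤max _ (map (wait I t) qs)) (∈-map⁺ (wait I t) q∈)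

  delayCost≤ : ∀ {t v} qs → 0# ≤ v → (∀ {q} → q ∈ qs → wait I t q ≤ v) → delayCost I t qs ≤ v
  delayCost≤ []       0≤v h = 0≤v
  delayCost≤ (q ∷ qs) 0≤v h = E.max≤v⁺ (h (here refl)) (All.map⁺ (All.tabulate (h ∘ there)))

  0≤delayCost : ∀ {t} qs → (∀ {q} → q ∈ qs → arrival (proj₁ q) ≤ t) → 0# ≤ delayCost I t qs
  0≤delayCost []       h = ≤-refl
  0≤delayCost (q ∷ qs) h = ≤-trans (0≤- (h (here refl))) (wait≤delayCost {qs = q ∷ qs} (here refl))

  -- What an automatic schedule has paid after n epochs, with the server at u,
  -- the requests ps pending and x spent, is attributed to a solution of the
  -- recurrence up to layer p and to one open block starting there: vs is the
  -- movement and D the delay paid within the open block.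
  record Attribution (u : Fin N) (ps : List (Request I)) (x : Carrier) (n : ℕ) : Set (c Level.⊔ ℓ) where
    field
      p      : Fin (suc m)
      y      : Fin N
      vs     : List (Fin N)
      f D    : Carrier
      F≤f    : F° p y ≤⁺ [ f ]
      paid   : f + lenFrom I y vs + D ≤ x
      end    : lastFrom y vs ≡ u
      served : ∀ {h v} → toℕ p ℕ.≤ toℕ h → toℕ h ℕ.< n → v ∈ toList (epoch h) →
               v ∈ y ∷ vs ⊎ (h , v) ∈ ps
      seen   : ∀ {q} → q ∈ ps → toℕ (proj₁ q) ℕ.< n

  -- While the block is open, the delay paid so far reaches from its first
  -- epoch to the arrival of some pending request, whose own delay will
  -- eventually cover the time after that arrival.
  data Status (ps : List (Request I)) (n : ℕ) (p : Fin (suc m)) (D : Carrier) : Set (c Level.⊔ ℓ) where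
    idle : toℕ p ≡ n → ps ≡ [] → 0# ≤ D → Status ps n p D
    open-block : ∀ e q → toℕ e ≡ toℕ p → toℕ p ℕ.< n → q ∈ ps → arrival (proj₁ q) - arrival e ≤ D →
                 Status ps n p D

  record Invariant (u : Fin N) (ps : List (Request I)) (x : Carrier) (n : ℕ) : Set (c Level.⊔ ℓ) where
    constructor _,,_
    field
      attribution : Attribution u ps x n
    open Attribution attribution public
    field
      status : Status ps n p D

  open Attribution using (p; D)

  Inv : State I → ℕ → Set (c Level.⊔ ℓ)
  Inv S = Invariant (server S) (pending S) (spent S)

  -- Closing the block. Nothing is pending, so the movement since `y` covers every site requested in
  -- epochs e to j and is at least K; with the delay D this pays for one more step of the
  -- recurrence, from layer `p` to layer `suc j`, ending at the server.
  settle : ∀ {u x} {e j : Fin m} (A : Attribution u [] x (suc (toℕ j))) →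
           toℕ e ≡ toℕ (p A) → e Fin.≤ j → arrival j - arrival e ≤ D A →
           Invariant u [] x (suc (toℕ j))
  settle {u} {x} {e} {j} A e≡p e≤j a≤D = record
    { p = suc j
    ; y = u
    ; vs = []
    -- Everything paid so far, slack included, moves into the new `f`, which only has to bound `F`
    -- from above.
    ; f = f A + lenFrom I (y A) (vs A) + D A
    ; D = 0#
    ; F≤f = subst (λ z → F° (suc j) z ≤⁺ _) (end A) (≤⁺-trans bound [ total≤ ])
    ; paid = ≤-trans (≤-reflexive (trans (+-identityʳ _) (+-identityʳ _))) (paid A)
    ; end = refl
    ; served = λ j<h h≤j _ → contradiction (ℕ.<-≤-trans h≤j j<h) (ℕ.<-irrefl refl)
    ; seen = λ ()
    } ,, idle refl refl ≤-refl
    where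
    open Attribution hiding (p; D)
    z = lastFrom (y A) (vs A)

    covers : ∀ {v} → v ∈ blockSites I e j → v ∈ y A ∷ vs A
    covers v∈ with ∈-blockSites⁻ v∈
    ... | h , e≤h , h≤j , v∈h with served A (subst (ℕ._≤ toℕ h) e≡p e≤h) (s≤s h≤j) v∈h
    -- The other case would be a pending request, and none is left.
    ... | inj₁ v∈vs = v∈vs

    bound : F° (suc j) z ≤⁺ [ f A + blockCost I e j (y A) z ]
    bound with blockAt {j} (p A) (subst (ℕ._≤ toℕ j) e≡p e≤j)
    ... | k , k≡p = ≤⁺-trans
      (subst₂ (λ i h → F° (suc j) z ≤⁺ F° i (y A) +⁺ blockCost I h j (y A) z) k≡p
        (Fin.toℕ-injective (trans (toℕ-block j k) (trans (cong toℕ k≡p) (sym e≡p)))) (F≤ j z k (y A)))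
      (+⁺-monoˡ _ (F≤f A))

    combine : ∀ {f k a b l d} → k ≤ l → a - b ≤ d → f + ((k + a) - b) ≤ (f + l) + d
    combine {f} {k} {a} {b} {l} {d} k≤l a-b≤d = by (k≤l +-mono a-b≤d)
      (solve 6 (λ f k a b l d → f :+ (k :+ a :- b) :+ (l :+ d) := f :+ l :+ d :+ (k :+ (a :- b))) refl
        f k a b l d)

    total≤ : f A + blockCost I e j (y A) z ≤ f A + lenFrom I (y A) (vs A) + D A
    total≤ = combine (K≤lenFrom e≤j (y A) (vs A) covers) a≤D

  fresh : Fin N → Fin m → List (Fin N)
  fresh u h = filter (λ v → ¬? (v Fin.≟ u)) (toList (epoch h))

  arrive-attribution : ∀ {u ps x} h → Attribution u ps x (toℕ h) →
                       Attribution u (ps ++ map (h ,_) (fresh u h)) x (suc (toℕ h))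
  arrive-attribution {u} {ps} {x} h A = record
    { p = p A ; y = y ; vs = vs ; f = f ; D = D A ; F≤f = F≤f ; paid = paid ; end = end
    ; served = served′
    ; seen = λ q∈ → seen′ (∈-++⁻ ps q∈)
    }
    where
    open Attribution A hiding (p; D)

    new : List (Request I)
    new = map (h ,_) (fresh u h)

    seen′ : ∀ {q} → q ∈ ps ⊎ q ∈ new → toℕ (proj₁ q) ℕ.< suc (toℕ h)
    seen′ (inj₁ q∈) = ℕ.m<n⇒m<1+n (seen q∈)
    seen′ (inj₂ q∈) with ∈-map⁻ (h ,_) q∈
    ... | _ , _ , refl = ℕ.≤-refl

    now : ∀ {v} → v ∈ toList (epoch h) → v ∈ y ∷ vs ⊎ (h , v) ∈ ps ++ new
    now {v} v∈ with v Fin.≟ u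
    -- Such a request is served on arrival; its site counts as covered because the server stands at
    -- the last vertex of the movement.
    ... | yes refl = inj₁ (subst (_∈ y ∷ vs) end (lastFrom∈ y vs))
    ... | no v≢u   = inj₂ (∈-++⁺ʳ ps (∈-map⁺ (h ,_) (∈-filter⁺ (λ v → ¬? (v Fin.≟ u)) v∈ v≢u)))

    served′ : ∀ {k v} → toℕ (p A) ℕ.≤ toℕ k → toℕ k ℕ.< suc (toℕ h) → v ∈ toList (epoch k) →
              v ∈ y ∷ vs ⊎ (k , v) ∈ ps ++ new
    served′ {k} p≤k k≤h v∈ with ℕ.m≤n⇒m<n∨m≡n (ℕ.≤-pred k≤h)
    ... | inj₁ k<h = Sum.map₂ ∈-++⁺ˡ (served p≤k k<h v∈)
    ... | inj₂ k≡h with refl ← Fin.toℕ-injective k≡h = now v∈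

  arrive-invariant : ∀ (S : State I) h → Inv S (toℕ h) → Inv (arrive I S h) (suc (toℕ h))
  arrive-invariant S h (A ,, open-block e q e≡p p<n q∈ d≤D) =
    arrive-attribution h A ,, open-block e q e≡p (ℕ.m<n⇒m<1+n p<n) (∈-++⁺ˡ q∈) d≤D
  arrive-invariant S h (A ,, idle p≡n ps≡[] 0≤D) =
    cases (map (h ,_) (fresh (server S) h)) ps≡[] (arrive-attribution h A) p≡n
      (≤-trans (≤-reflexive (+-inverseʳ (arrival h))) 0≤D)
    where
    -- A block opens with epoch h. The pending list is generalised to a variable so that its
    -- emptiness can be matched on.
    cases : ∀ {u ps x} new → ps ≡ [] → (A : Attribution u (ps ++ new) x (suc (toℕ h))) →
            toℕ (p A) ≡ toℕ h → arrival h - arrival h ≤ D A →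
            Invariant u (ps ++ new) x (suc (toℕ h))
    -- The whole epoch lies at the server's site, so the block consisting of h alone closes at once,
    -- with delay zero required.
    cases []        refl A p≡h d≤D = settle {e = h} A (sym p≡h) ℕ.≤-refl d≤D
    cases (q ∷ new) refl A p≡h d≤D = A ,,
      open-block h q (sym p≡h) (ℕ.≤-reflexive (cong suc p≡h)) (here refl)
        (≤-trans (+-monoˡ-≤ (- arrival h) (arrival-mono-≤ (ℕ.≤-pred (Attribution.seen A (here refl))))) d≤D)

  SeenBy : Carrier → ℕ → Set ℓ
  SeenBy t n = ∀ h → toℕ h ℕ.< n → arrival h ≤ t

  admit-invariant : ∀ t (S : State I) {n} hs → Ascending n hs → Inv S n → SeenBy t n →
    ∃[ n′ ] Ascending n′ (dropWhile (λ h → arrival h ≤? t) hs)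
          × Inv (foldl (arrive I) S (takeWhile (λ h → arrival h ≤? t) hs)) n′ × SeenBy t n′
  admit-invariant t S []       []            inv before = _ , [] , inv , before
  admit-invariant t S (h ∷ hs) (next refl hs↑) inv before with arrival h ≤? t
  ... | no  _   = _ , next refl hs↑ , inv , before
  ... | yes h≤t = admit-invariant t (arrive I S h) hs hs↑ (arrive-invariant S h inv) before′
    where
    before′ : SeenBy t (suc (toℕ h))
    before′ k k≤h with ℕ.m≤n⇒m<n∨m≡n (ℕ.≤-pred k≤h)
    ... | inj₁ k<h = before k k<h
    ... | inj₂ k≡h = subst (λ k → arrival k ≤ t) (sym (Fin.toℕ-injective k≡h)) h≤t

  arrivals-invariant : ∀ (S : State I) {n} hs → Ascending n hs → Inv S n → Inv (foldl (arrive I) S hs) m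
  arrivals-invariant S []       []              inv = inv
  arrivals-invariant S (h ∷ hs) (next refl hs↑) inv =
    arrivals-invariant (arrive I S h) hs hs↑ (arrive-invariant S h inv)

  module _ (t : Carrier) {u : Fin N} {ps : List (Request I)} {x : Carrier} {n : ℕ}
           (ws : List (Fin N)) (n≤m : n ℕ.≤ m) (before : SeenBy t n) where

    private
      P : Walk I
      P = u ∷ ws

      hit missed : List (Request I)
      hit    = filter (visited? I P) ps
      missed = filter (λ q → ¬? (visited? I P q)) ps

      delay x′ : Carrier
      delay = delayCost I t hit
      x′    = x + (len I P + delay)

    traverse-attribution : Attribution u ps x n → Attribution (lastFrom u ws) missed x′ n
    traverse-attribution A = record
      { p = p A ; y = y ; vs = vs ++ ws ; f = f ; D = D A + delay ; F≤f = F≤f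
      ; paid = pay (lenFrom-++ y vs ws) (cong (λ v → lenFrom I v ws) end) paid
      ; end = trans (lastFrom-++ y vs ws) (cong (λ v → lastFrom v ws) end)
      ; served = λ p≤h h<n v∈ → served′ (served p≤h h<n v∈)
      ; seen = λ q∈ → seen (proj₁ (∈-filter⁻ (λ q → ¬? (visited? I P q)) {xs = ps} q∈))
      }
      where
      open Attribution A hiding (p; D)

      pay : ∀ {l l₁ l₂ l₃ D d} → l ≡ l₁ + l₂ → l₂ ≡ l₃ → f + l₁ + D ≤ x →
            f + l + (D + d) ≤ x + (l₃ + d)
      pay {l₁ = l₁} {l₂} {D = D} {d} refl refl le = by le
        (solve 6 (λ f l₁ l₂ D d x → f :+ (l₁ :+ l₂) :+ (D :+ d) :+ x := x :+ (l₂ :+ d) :+ (f :+ l₁ :+ D)) refl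
          f l₁ l₂ D d x)

      grow : ∀ {v} → v ∈ y ∷ vs → v ∈ y ∷ vs ++ ws
      grow = ∈-++⁺ˡ {xs = y ∷ vs}

      walked : ∀ {v} → v ∈ toList P → v ∈ y ∷ vs ++ ws
      walked (here refl) = grow (subst (_∈ y ∷ vs) end (lastFrom∈ y vs))
      walked (there v∈)  = ∈-++⁺ʳ (y ∷ vs) v∈

      served′ : ∀ {h v} → v ∈ y ∷ vs ⊎ (h , v) ∈ ps → v ∈ y ∷ vs ++ ws ⊎ (h , v) ∈ missed
      served′ (inj₁ v∈) = inj₁ (grow v∈)
      served′ {h} {v} (inj₂ q∈) with visited? I P (h , v)
      ... | yes v∈ = inj₁ (walked v∈)
      ... | no  v∉ = inj₂ (∈-filter⁺ (λ q → ¬? (visited? I P q)) q∈ v∉)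

    private
      0≤delay : Attribution u ps x n → 0# ≤ delay
      0≤delay A = 0≤delayCost hit (λ {q} q∈ → before (proj₁ q)
        (Attribution.seen A (proj₁ (∈-filter⁻ (visited? I P) {xs = ps} q∈))))

    -- If the followed request q is missed, it stays in charge. If it is hit, its waiting time is at
    -- most the delay of this event, so the delays now reach from epoch e to the present time t. No
    -- arrival seen so far is later than t, so any request still pending can take over from q; if
    -- there is none, the last epoch seen has been reached and the block closes.
    traverse-invariant : Invariant u ps x n → Invariant (lastFrom u ws) missed x′ n
    traverse-invariant (A ,, idle p≡n ps≡[] 0≤D) = traverse-attribution A ,,
      idle p≡n (cong (filter (λ q → ¬? (visited? I P q))) ps≡[])
        (≤-trans (≤-reflexive (sym (+-identityˡ 0#))) (0≤D +-mono 0≤delay A))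
    traverse-invariant (A ,, open-block e q e≡p p<n q∈ d≤D) with visited? I P q
    ... | no q∉ = traverse-attribution A ,,
      open-block e q e≡p p<n (∈-filter⁺ (λ q → ¬? (visited? I P q)) q∈ q∉)
        (≤-trans (≤-reflexive (sym (+-identityʳ _))) (d≤D +-mono 0≤delay A))
    ... | yes q∈P = cases n n≤m before (subst (ℕ._< n) (sym e≡p) p<n) missed
                      (traverse-attribution A) e≡p reach
      where
      reach : t - arrival e ≤ D A + delay
      reach = by (d≤D +-mono wait≤delayCost {t} (∈-filter⁺ (visited? I P) q∈ q∈P))
        (solve 5 (λ t e q D d → t :- e :+ (D :+ d) := D :+ d :+ (q :- e :+ (t :- q))) refl
          t (arrival e) (arrival (proj₁ q)) (D A) delay)

      cases : ∀ n → n ℕ.≤ m → SeenBy t n → toℕ e ℕ.< n →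
              ∀ {u x} ps → (A′ : Attribution u ps x n) → toℕ e ≡ toℕ (p A′) →
              t - arrival e ≤ D A′ → Invariant u ps x n
      cases n n≤m before e<n (q′ ∷ ps) A′ e≡p r = A′ ,,
        open-block e q′ e≡p (subst (ℕ._< n) e≡p e<n) (here refl)
          (≤-trans (+-monoˡ-≤ (- arrival e) (before (proj₁ q′) (Attribution.seen A′ (here refl)))) r)
      -- With `suc n` epochs seen, the block ends with the epoch of index `n`.
      cases (suc n) n<m before e≤n [] A′ e≡p r = close (fromℕ< n<m) (Fin.toℕ-fromℕ< n<m) before e≤n A′ e≡p r
        where
        close : ∀ j {n} → toℕ j ≡ n → SeenBy t (suc n) → toℕ e ℕ.< suc n →
                ∀ {u x} (A′ : Attribution u [] x (suc n)) → toℕ e ≡ toℕ (p A′) →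
                t - arrival e ≤ D A′ → Invariant u [] x (suc n)
        close j refl before e≤j A′ e≡p r = settle {e = e} {j = j} A′ e≡p (ℕ.≤-pred e≤j)
          (≤-trans (+-monoˡ-≤ (- arrival e) (before j ℕ.≤-refl)) r)

  server-arrivals : ∀ (S : State I) hs → server (foldl (arrive I) S hs) ≡ server S
  server-arrivals S []       = refl
  server-arrivals S (h ∷ hs) = server-arrivals (arrive I S h) hs

  spent-arrivals : ∀ (S : State I) hs → spent (foldl (arrive I) S hs) ≡ spent S
  spent-arrivals S []       = refl
  spent-arrivals S (h ∷ hs) = spent-arrivals (arrive I S h) hs

  module _ {t : Carrier} {n : ℕ} (n≤m : n ℕ.≤ m) (before : SeenBy t n) where

    walks-invariant : ∀ Ps {rest} (S : State I) → Connected I (server S) (Ps ++ rest) → Inv S n →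
      let S′ = foldl (traverse I t) S Ps in
      Connected I (server S′) rest × Inv S′ n × unseen S′ ≡ unseen S
    walks-invariant []               S con         inv = con , inv , refl
    walks-invariant ((v ∷ ws) ∷ Ps) {rest} S (refl , con) inv =
      walks-invariant Ps (traverse I t S (v ∷ ws)) con
        (subst (λ u → Invariant u (pending S′) (spent S′) n) (sym (last≡lastFrom v ws))
          (traverse-invariant t ws n≤m before inv))
      where
      S′ : State I
      S′ = traverse I t S (v ∷ ws)

  actions-invariant : ∀ α σ (S : State I) {n} → Ascending n (unseen S) → Inv S n →
    Linked (λ α β → time α ≤ time β) (α ∷ σ) →
    Connected I (server S) (concatMap walks (α ∷ σ)) → SeenBy (time α) n →
    Inv (admitAll I (foldl (perform I) S (α ∷ σ))) m
  actions-invariant α σ S up inv linked con before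
    with admit-invariant (time α) S (unseen S) up inv before
  ... | n′ , up′ , inv′ , before′
    with walks-invariant (Ascending⇒≤ up′) before′ (walks α) {concatMap walks σ} (admitUpTo I (time α) S)
           (subst (λ u → Connected I u (concatMap walks (α ∷ σ)))
             (sym (server-arrivals S (takeWhile (λ h → arrival h ≤? time α) (unseen S)))) con) inv′
  ... | con″ , inv″ , unseen≡ = continue σ linked con″
    where
    S″ : State I
    S″ = perform I S α

    up″ : Ascending n′ (unseen S″)
    up″ = subst (Ascending n′) (sym unseen≡) up′

    continue : ∀ σ → Linked (λ α β → time α ≤ time β) (α ∷ σ) →
               Connected I (server S″) (concatMap walks σ) →
               Inv (admitAll I (foldl (perform I) S″ σ)) m
    continue []      _              _   = arrivals-invariant S″ (unseen S″) up″ inv″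
    continue (β ∷ σ) (α≤β ∷ linked) con =
      actions-invariant β σ S″ up″ inv″ linked con (λ h h<n → ≤-trans (before′ h h<n) α≤β)

  initial-invariant : Inv (initial I) 0
  initial-invariant = record
    { p = zero ; y = s₀ ; vs = [] ; f = 0# ; D = 0# ; F≤f = ≤⁺-reflexive F-zero-start
    ; paid = ≤-reflexive (trans (+-identityʳ _) (+-identityʳ _))
    ; end = refl ; served = λ _ () ; seen = λ () } ,, idle refl refl ≤-refl

  run-invariant : ∀ σ → Feasible I σ → Inv (run I σ) m
  run-invariant []      _  = arrivals-invariant (initial I) (allFin m) (Ascending-allFin m) initial-invariant
  run-invariant (α ∷ σ) fe = actions-invariant α σ (initial I) (Ascending-allFin m) initial-invariant
    (Feasible.chronological fe) (Feasible.connected fe) (λ _ ())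

  -- An open block has a pending request, which feasibility excludes at the end. The final state is
  -- therefore idle at layer m; movement and delay since the last closed block are nonnegative and
  -- dropped.
  minF≤cost : ∀ σ → Feasible I σ → minF I ≤⁺ [ cost I σ ]
  minF≤cost σ fe = conclude (run-invariant σ fe)
    where
    conclude : Inv (run I σ) m → minF I ≤⁺ [ cost I σ ]
    conclude (A ,, open-block _ _ _ _ q∈ _) with () ← subst (_ ∈_) (Feasible.allServed fe) q∈
    conclude (A ,, idle p≡m _ 0≤D) = ≤⁺-trans (minF≤ y) (≤⁺-trans
      (subst (λ i → F° i y ≤⁺ [ f ]) (Fin.toℕ-injective (trans p≡m (sym (Fin.toℕ-fromℕ m)))) F≤f)
      [ by (paid +-mono 0≤lenFrom y vs +-mono 0≤D)
          (solve 4 (λ f x l d → f :+ (x :+ l :+ d) := x :+ (f :+ l :+ d :+ :0 :+ :0)) refl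
            f (cost I σ) (lenFrom I y vs) (D A)) ])
      where open Attribution A hiding (p; D)

-- Upper bound: block walks, traceback and automatic replay.

opposite-antitone : ∀ {n} {i j : Fin n} → i Fin.≤ j → opposite j Fin.≤ opposite i
opposite-antitone {n} {i} {j} i≤j =
  subst₂ ℕ._≤_ (sym (Fin.opposite-prop j)) (sym (Fin.opposite-prop i)) (ℕ.∸-monoʳ-≤ n (s≤s i≤j))

exhausted : ∀ {m n} {hs : List (Fin m)} → n ≡ m → Ascending n hs → hs ≡ []
exhausted n≡m []                = refl
exhausted n≡m (next {h = h} h≡n _) = contradiction (trans h≡n n≡m) (ℕ.<⇒≢ (Fin.toℕ<n h))

module Replay {c ℓ} {R : LinearlyOrderedAbelianGroup c ℓ} (I : Input R) where

  open LinearlyOrderedAbelianGroup R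
  open OrderedGroup R
  open Solver using (solve; _:+_; _:-_; _:=_; :0)
  open Input I
  open Recurrence I
  open LowerBound I

  -- Used with g = pos for ascending walks and with its negation for descending ones.
  lenFrom-monotone : ∀ (g : Fin N → Carrier) x xs →
                     Linked (λ u v → dist I u v ≡ g v - g u) (x ∷ xs) →
                     lenFrom I x xs ≡ g (lastFrom x xs) - g x
  lenFrom-monotone g x []       _            = sym (+-inverseʳ (g x))
  lenFrom-monotone g x (v ∷ vs) (eq ∷ linked) = trans (cong₂ _+_ eq (lenFrom-monotone g v vs linked))
    (solve 3 (λ a b c → b :- a :+ (c :- b) := c :- a) refl (g x) (g v) (g (lastFrom v vs)))

  -- One construction for both directions: from y to a, monotonically through all sites between a
  -- and b, then to z. Along the monotone part distances are differences of `g` and telescope.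
  -- Listing all sites in between covers the requested ones. Repeating a and b adds length zero and
  -- makes the ends of the path evident.
  module Sweep (g : Fin N → Carrier) (_≼_ : Fin N → Fin N → Set) (_≼?_ : ∀ u v → Dec (u ≼ v))
               (dist≡ : ∀ {u v} → u ≼ v → dist I u v ≡ g v - g u)
               (sites : List (Fin N)) (sorted : AllPairs _≼_ sites) (all∈ : ∀ v → v ∈ sites)
               {a b : Fin N} (a≼b : a ≼ b) (y z : Fin N) where

    private
      after-a : List (Fin N)
      after-a = filter (a ≼?_) sites

      between : List (Fin N)
      between = filter (_≼? b) after-a

      between⁻ : ∀ {v} → v ∈ between → a ≼ v × v ≼ b
      between⁻ v∈ with ∈-filter⁻ (_≼? b) {xs = after-a} v∈
      ... | v∈′ , v≼b = proj₂ (∈-filter⁻ (a ≼?_) {xs = sites} v∈′) , v≼b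

      path : List (Fin N)
      path = between ∷ʳ b

      path-sorted : AllPairs _≼_ (a ∷ path)
      path-sorted = All.++⁺ (All.tabulate (proj₁ ∘ between⁻)) (a≼b ∷ []) ∷
        AllPairs.++⁺ (AllPairs.filter⁺ (_≼? b) (AllPairs.filter⁺ (a ≼?_) sorted)) ([] ∷ [])
          (All.tabulate (λ v∈ → proj₂ (between⁻ v∈) ∷ []))

    walk : Walk I
    walk = y ∷ a ∷ path ∷ʳ z

    walk-last : List⁺.last walk ≡ z
    walk-last = trans (last≡lastFrom y (a ∷ path ∷ʳ z)) (lastFrom-++ a path (z ∷ []))

    walk-covers : ∀ {v} → a ≼ v → v ≼ b → v ∈ toList walk
    walk-covers {v} a≼v v≼b = there (there (∈-++⁺ˡ (∈-++⁺ˡ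
      (∈-filter⁺ (_≼? b) (∈-filter⁺ (a ≼?_) (all∈ v) a≼v) v≼b))))

    walk-length : len I walk ≡ dist I y a + ((g b - g a) + dist I b z)
    walk-length = cong (dist I y a +_) (trans (lenFrom-++ a path (z ∷ []))
      (cong₂ _+_
        (trans (lenFrom-monotone g a path (Linked.map dist≡ (AllPairs⇒Linked path-sorted)))
          (cong (λ v → g v - g a) (lastFrom-++ a between (b ∷ []))))
        (trans (cong (λ v → dist I v z + 0#) (lastFrom-++ a between (b ∷ []))) (+-identityʳ _))))

  -- The order of the extremes that attains the minimum in `K` decides whether the sweep goes up or
  -- down.
  blockWalk : ∀ {p j} → p Fin.≤ j → ∀ y z → BlockWalk I p j y z
  blockWalk {p} {j} p≤j y z with extremes p≤j
  ... | l , u , ex with ⊓-sel (dist I y l + dist I u z) (dist I y u + dist I l z)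
  ... | inj₁ eq = record
    { walk = walk ; from = refl ; to = walk-last
    ; length≡K = trans walk-length (trans
        (solve 4 (λ a b u l → a :+ (u :- l :+ b) := u :- l :+ (a :+ b)) refl
          (dist I y l) (dist I u z) (pos u) (pos l))
        (trans (cong ((pos u - pos l) +_) (sym eq)) (sym (K≡ ex y z))))
    ; covers = All.tabulate (λ v∈ → walk-covers (lo≤ v∈) (≤hi v∈))
    }
    where
    open Extremes ex
    open Sweep pos Fin._≤_ Fin._≤?_ (λ u≤v → ≤⇒∣-∣≡′ (pos-mono-≤ u≤v))
      (allFin N) (AllPairs.tabulate⁺-< ℕ.<⇒≤) ∈-allFin {l} {u} lo≤hi y z
  ... | inj₂ eq = record
    { walk = walk ; from = refl ; to = walk-last
    ; length≡K = trans walk-length (trans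
        (negated (dist I y u) (dist I l z) (pos u) (pos l))
        (trans (cong ((pos u - pos l) +_) (sym eq)) (sym (K≡ ex y z))))
    ; covers = All.tabulate (λ v∈ → walk-covers (≤hi v∈) (lo≤ v∈))
    }
    where
    open Extremes ex
    -- The negated position, written as a difference because the solver knows binary subtraction
    -- only.
    open Sweep (λ v → 0# - pos v) Fin._≥_ (λ u v → v Fin.≤? u)
      (λ {u} {v} v≤u → trans (≤⇒∣-∣≡ (pos-mono-≤ v≤u))
        (solve 2 (λ a b → a :- b := (:0 :- b) :- (:0 :- a)) refl (pos u) (pos v)))
      (tabulate opposite) (AllPairs.tabulate⁺-< (opposite-antitone ∘ ℕ.<⇒≤))
      (λ v → subst (_∈ tabulate opposite) (Fin.opposite-involutive v) (∈-tabulate⁺ (opposite v)))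
      {u} {l} lo≤hi y z

    negated : ∀ a b u l → a + (((0# - l) - (0# - u)) + b) ≡ (u - l) + (a + b)
    negated = solve 4 (λ a b u l → a :+ ((:0 :- l) :- (:0 :- u) :+ b) := u :- l :+ (a :+ b)) refl

  -- `n` is fuel, since `inject p` is smaller but not a subterm. Finiteness of the value is handed
  -- down to the predecessor, so the traceback that reaches layer zero does so at `s₀`.
  reconstruct : ∀ n i z {v} → toℕ i ℕ.< n → F° i z ≡ [ v ] → Reconstruction I i z
  reconstruct (suc n) zero    z i<n eq
    = subst (Reconstruction I zero) (sym (F-zero-finite (≤⁺-reflexive eq))) start
  reconstruct (suc n) (suc j) z i<n eq =
    let p , y , att = F-attained j z (≤⁺-reflexive eq)
        _ , fin , _ = +⁺-finite (F° (inject {i = suc j} p) y) (trans (sym att) eq)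
    in block p y (Attains⁺ p y att)
         (reconstruct n (inject {i = suc j} p) y (ℕ.<-≤-trans (inject-< I {j} p) (ℕ.≤-pred i<n)) fin)
         (blockWalk (block≤ j p) y z)
  -- Replay

  -- Arrival times are strictly increasing, so admitting everything up to time `arrival j` stops
  -- exactly after epoch j; what is newly pending comes from epochs n to j.
  admit-block : ∀ (j : Fin m) (S : State I) {n} hs → Ascending n hs → n ℕ.≤ suc (toℕ j) →
    Ascending (suc (toℕ j)) (dropWhile (λ h → arrival h ≤? arrival j) hs) ×
    (∀ {h v} → (h , v) ∈ pending (foldl (arrive I) S (takeWhile (λ h → arrival h ≤? arrival j) hs)) →
      (h , v) ∈ pending S ⊎ (n ℕ.≤ toℕ h × h Fin.≤ j × v ∈ toList (epoch h)))
  admit-block j S []       []            m≤j =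
    subst (λ n → Ascending {m} n []) (ℕ.≤-antisym m≤j (Fin.toℕ<n j)) [] , inj₁
  admit-block j S (h ∷ hs) (next refl hs↑) h≤1+j with arrival h ≤? arrival j
  ... | no  h≰j = subst (λ n → Ascending n (h ∷ hs))
                    (ℕ.≤-antisym h≤1+j (ℕ.≰⇒> (h≰j ∘ arrival-mono-≤))) (next refl hs↑) , inj₁
  ... | yes le  = proj₁ rest , λ q∈ → origin (proj₂ rest q∈)
    where
    h≤j : h Fin.≤ j
    h≤j = arrival-cancel-≤ le

    rest = admit-block j (arrive I S h) hs hs↑ (s≤s h≤j)

    origin : ∀ {k v} →
      (k , v) ∈ pending (arrive I S h) ⊎ (suc (toℕ h) ℕ.≤ toℕ k × k Fin.≤ j × v ∈ toList (epoch k)) →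
      (k , v) ∈ pending S ⊎ (toℕ h ℕ.≤ toℕ k × k Fin.≤ j × v ∈ toList (epoch k))
    origin (inj₂ (h<k , k≤j , v∈)) = inj₂ (ℕ.<⇒≤ h<k , k≤j , v∈)
    origin (inj₁ q∈) with ∈-++⁻ (pending S) q∈
    ... | inj₁ q∈S = inj₁ q∈S
    ... | inj₂ q∈h with ∈-map⁻ (h ,_) q∈h
    ... | v , v∈ , refl =
      inj₂ (ℕ.≤-refl , h≤j , proj₁ (∈-filter⁻ (λ v → ¬? (v Fin.≟ server S)) {xs = toList (epoch h)} v∈))

  replayed : ∀ {i z} → Reconstruction I i z → State I
  replayed r = foldl (perform I) (initial I) (replay I r)

  record Replayed (i : Fin (suc m)) (z : Fin N) (S : State I) : Set (c Level.⊔ ℓ) where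
    field
      value     : Carrier
      F≡value   : F° i z ≡ [ value ]
      spent≤    : spent S ≤ value
      server≡   : server S ≡ z
      pending≡[] : pending S ≡ []
      upcoming  : Ascending (toℕ i) (unseen S)

  replay-block : ∀ {j z} (p : Fin′ (suc j)) y → F° (suc j) z ≡ candidate j z p y →
    (w : BlockWalk I (inject! {i = suc j} p) j y z) → ∀ S → Replayed (inject {i = suc j} p) y S →
    Replayed (suc j) z (perform I S ((BlockWalk.walk w ∷ []) at arrival j))
  replay-block {j} {z} p y att w S rep = record
    { value = value + blockCost I e j y z
    ; F≡value = trans att (cong (_+⁺ blockCost I e j y z) F≡value)
    ; spent≤ = pay (subst (_≤ value) (sym (spent-arrivals S taken)) spent≤) length≡K
                 -- The hit list may be empty, when the walk is pure repositioning; this is where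
                 -- the bound has to be nonnegative.
                 (delayCost≤ _ (0≤- (arrival-mono-≤ (block≤ j p))) λ {q} q∈ →
                   late {q} (proj₁ (∈-filter⁻ (visited? I walk) {xs = pending S′} q∈)))
    ; server≡ = to
    ; pending≡[] = filter-none (λ q → ¬? (visited? I walk q)) (All.tabulate λ {q} q∈ q∉ → q∉ (hit {q} q∈))
    ; upcoming = proj₁ admitted
    }
    where
    open BlockWalk w
    open Replayed rep

    e : Fin m
    e = inject! {i = suc j} p

    taken : List (Fin m)
    taken = takeWhile (λ h → arrival h ≤? arrival j) (unseen S)

    S′ : State I
    S′ = foldl (arrive I) S taken

    admitted = admit-block j S (unseen S) upcoming
      (ℕ.<⇒≤ (inject-< I {j} p))

    in-block : ∀ {h v} → (h , v) ∈ pending S′ → e Fin.≤ h × h Fin.≤ j × v ∈ toList (epoch h)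
    in-block {h} {v} q∈ with proj₂ admitted q∈
    ... | inj₁ q∈[] with () ← subst ((h , v) ∈_) pending≡[] q∈[]
    ... | inj₂ (e≤h , rest) = subst (ℕ._≤ toℕ h) (sym (toℕ-block j p)) e≤h , rest

    hit : ∀ {q} → q ∈ pending S′ → proj₂ q ∈ toList walk
    hit q∈ with in-block q∈
    ... | e≤h , h≤j , v∈ = All.lookup covers (∈-blockSites⁺ {e} {j} e≤h h≤j v∈)

    late : ∀ {q} → q ∈ pending S′ → wait I (arrival j) q ≤ arrival j - arrival e
    late {q} q∈ = by (arrival-mono-≤ {e} {proj₁ q} (proj₁ (in-block q∈)))
      (solve 3 (λ a e q → a :- q :+ q := a :- e :+ e) refl (arrival j) (arrival e) (arrival (proj₁ q)))

    pay : ∀ {s v l k d a b} → s ≤ v → l ≡ k → d ≤ a - b → s + (l + d) ≤ v + ((k + a) - b)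
    pay {s} {v} {l} {_} {d} {a} {b} s≤v refl d≤ = by (s≤v +-mono d≤)
      (solve 6 (λ s v l d a b → s :+ (l :+ d) :+ (v :+ (a :- b)) := v :+ (l :+ a :- b) :+ (s :+ d)) refl
        s v l d a b)

  replay-correct : ∀ {i z} (r : Reconstruction I i z) → Replayed i z (replayed r)
  replay-correct start = record
    { F≡value = F-zero-start ; spent≤ = ≤-refl ; server≡ = refl ; pending≡[] = refl
    ; upcoming = Ascending-allFin m }
  replay-correct (block {j} {z} p y att r w) = subst (Replayed (suc j) z)
    (sym (foldl-∷ʳ (perform I) (initial I) ((BlockWalk.walk w ∷ []) at arrival j) (replay I r)))
    (replay-block p y (Attains⁻ p y att) w (replayed r) (replay-correct r))

  -- Stated against all later epochs, because layer zero has no last epoch to compare with.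
  replay-times : ∀ {i z} (r : Reconstruction I i z) →
                 All (λ α → ∀ k → toℕ i ℕ.≤ toℕ k → time α ≤ arrival k) (replay I r)
  replay-times start = []
  replay-times (block {j} p y att r w) = All.++⁺
    (All.map (λ le k j<k → le k (ℕ.≤-trans (ℕ.<⇒≤ (inject-< I {j} p)) j<k)) (replay-times r))
    ((λ k j<k → arrival-mono-≤ (ℕ.<⇒≤ j<k)) ∷ [])

  replay-chronological : ∀ {i z} (r : Reconstruction I i z) →
                         AllPairs (λ α β → time α ≤ time β) (replay I r)
  replay-chronological start = []
  replay-chronological (block {j} p y att r w) = AllPairs.++⁺ (replay-chronological r) ([] ∷ [])
    (All.map (λ le → le j (ℕ.≤-pred (inject-< I {j} p)) ∷ []) (replay-times r))

  endpoint : Fin N → List (Walk I) → Fin N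
  endpoint = foldl (λ _ P → List⁺.last P)

  Connected-∷ʳ : ∀ u Ps P → Connected I u Ps → List⁺.head P ≡ endpoint u Ps → Connected I u (Ps ∷ʳ P)
  Connected-∷ʳ u []       P _           eq = eq , tt
  Connected-∷ʳ u (Q ∷ Ps) P (from , con) eq = from , Connected-∷ʳ _ Ps P con eq

  replay-connected : ∀ {i z} (r : Reconstruction I i z) →
    Connected I s₀ (concatMap walks (replay I r)) × endpoint s₀ (concatMap walks (replay I r)) ≡ z
  replay-connected start = tt , refl
  replay-connected (block {j} {z} p y att r w) =
    let con , end≡ = replay-connected r
        eq = concatMap-++ walks (replay I r) (((BlockWalk.walk w ∷ []) at arrival j) ∷ [])
    in subst (Connected I s₀) (sym eq)
         (Connected-∷ʳ s₀ _ (BlockWalk.walk w) con (trans (BlockWalk.from w) (sym end≡)))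
     , trans (cong (endpoint s₀) eq)
         (trans (foldl-∷ʳ _ s₀ (BlockWalk.walk w) (concatMap walks (replay I r))) (BlockWalk.to w))

  module _ {z : Fin N} (r : Reconstruction I (final I) z) where

    open Replayed (replay-correct r)

    private
      run≡ : foldl (arrive I) (replayed r) (unseen (replayed r)) ≡ replayed r
      run≡ = cong (foldl (arrive I) (replayed r)) (exhausted (Fin.toℕ-fromℕ m) upcoming)

    replay-feasible : Feasible I (replay I r)
    replay-feasible = record
      { chronological = AllPairs⇒Linked (replay-chronological r)
      ; connected = proj₁ (replay-connected r)
      ; allServed = trans (cong pending run≡) pending≡[]
      }

    replay-cost : [ cost I (replay I r) ] ≤⁺ F° (final I) z
    replay-cost = subst ([ cost I (replay I r) ] ≤⁺_) (sym F≡value)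
      [ subst (_≤ value) (sym (cong spent run≡)) spent≤ ]

    -- The replay costs at most `F` at z, which is `minF`, and `minF` bounds the cost of every
    -- feasible schedule from below.
    replay-optimal : F° (final I) z ≡ minF I → OptimalAuto I (replay I r)
    replay-optimal eq = replay-feasible , λ τ fe →
      [≤]-injective (≤⁺-trans replay-cost (≤⁺-trans (≤⁺-reflexive eq) (minF≤cost τ fe)))

  F-final-finite : ∃[ z ] ∃[ v ] F° (final I) z ≡ [ v ]
  F-final-finite = finite (final I)
    where
    finite : ∀ i → ∃[ z ] ∃[ v ] F° i z ≡ [ v ]
    finite zero    = s₀ , 0# , F-zero-start
    finite (suc j) = s₀ , F-suc-finite j s₀

  minF-finite : ∃[ v ] minF I ≤⁺ [ v ]
  minF-finite with F-final-finite
  ... | z , v , eq = v , ≤⁺-trans (minF≤ z) (≤⁺-reflexive eq)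

  reconstruction : ∀ z → F° (final I) z ≡ minF I → Reconstruction I (final I) z
  reconstruction z eq = known refl (subst (_≤⁺ [ proj₁ minF-finite ]) (sym eq) (proj₂ minF-finite))
    where
    known : ∀ {x v} → F° (final I) z ≡ x → x ≤⁺ [ v ] → Reconstruction I (final I) z
    known {[ _ ]} eq _ = reconstruct (suc (toℕ (final I))) (final I) z ℕ.≤-refl eq

  minF-isOPT : IsOPTauto I (minF I)
  minF-isOPT = (λ { x (σ , fe , refl) → minF≤cost σ fe }) , greatest
    where
    greatest : ∀ w → (∀ x → AutoCost I x → w ≤⁺ [ x ]) → w ≤⁺ minF I
    greatest w lower =
      let z , eq = minF-attained (proj₂ minF-finite)
          r = reconstruction z (sym eq)
      in ≤⁺-trans (lower _ (replay I r , replay-feasible r , refl))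
           (≤⁺-trans (replay-cost r) (≤⁺-reflexive (sym eq)))

-- A program logic that counts steps and bounds array indices.

Σ< : ℕ → (ℕ → ℕ) → ℕ
Σ< zero    f = 0
Σ< (suc n) f = Σ< n f ℕ.+ f n

Σ<-const : ∀ n k → Σ< n (λ _ → k) ≡ n ℕ.* k
Σ<-const zero    k = refl
Σ<-const (suc n) k = trans (cong (ℕ._+ k) (Σ<-const n k)) (ℕ.+-comm (n ℕ.* k) k)

Σ<-front : ∀ n f → Σ< (suc n) f ≡ f 0 ℕ.+ Σ< n (f ∘ suc)
Σ<-front zero    f = ℕ.+-comm 0 (f 0)
Σ<-front (suc n) f = trans (cong (ℕ._+ f (suc n)) (Σ<-front n f)) (ℕ.+-assoc (f 0) _ _)

Σ<-tabulate : ∀ n (f : Fin n → ℕ) g → (∀ i → g (toℕ i) ≡ f i) → Σ< n g ≡ sum (tabulate f)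
Σ<-tabulate zero    f g eq = refl
Σ<-tabulate (suc n) f g eq = trans (Σ<-front n g)
  (cong₂ ℕ._+_ (eq zero) (Σ<-tabulate n (f ∘ suc) (g ∘ suc) (eq ∘ suc)))

Σ<-linear : ∀ n a b f → Σ< n (λ i → a ℕ.+ b ℕ.* f i) ≡ n ℕ.* a ℕ.+ b ℕ.* Σ< n f
Σ<-linear zero    a b f = sym (ℕ.*-zeroʳ b)
Σ<-linear (suc n) a b f = begin
  Σ< n (λ i → a ℕ.+ b ℕ.* f i) ℕ.+ (a ℕ.+ b ℕ.* f n)     ≡⟨ cong (ℕ._+ (a ℕ.+ b ℕ.* f n)) (Σ<-linear n a b f) ⟩
  (n ℕ.* a ℕ.+ b ℕ.* Σ< n f) ℕ.+ (a ℕ.+ b ℕ.* f n)       ≡⟨ interchange (n ℕ.* a) _ a _ ⟩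
  (n ℕ.* a ℕ.+ a) ℕ.+ (b ℕ.* Σ< n f ℕ.+ b ℕ.* f n)       ≡⟨ cong₂ ℕ._+_ (ℕ.+-comm (n ℕ.* a) a) (sym (ℕ.*-distribˡ-+ b _ _)) ⟩
  (a ℕ.+ n ℕ.* a) ℕ.+ b ℕ.* (Σ< n f ℕ.+ f n)             ∎
  where
  open ≡-Reasoning
  open import Algebra.Properties.CommutativeSemigroup ℕ.+-commutativeSemigroup using (interchange)

module Machine {c ℓ} {R : LinearlyOrderedAbelianGroup c ℓ} (I : Input R) (σ : Storage) where

  open LinearlyOrderedAbelianGroup R using (Carrier; 0#; _+_; _-_; _≤?_)
  open Storage σ

  -- A memory without its counters. Assertions speak about stores only, and the rules below carry
  -- the bounds on `steps` and `extent`.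
  record Store : Set c where
    field
      ints  : Vector ℕ intRegs
      reals : Vector Carrier realRegs
      intA  : Vector (ℕ → ℕ) intArrays
      realA : Vector (ℕ → Carrier) realArrays
  open Store public

  load : Store → ℕ → ℕ → Memory I σ
  load s n x = record { intReg = ints s ; realReg = reals s ; intArray = intA s ; realArray = realA s
                      ; steps = n ; extent = x }

  mem : Store → Memory I σ
  mem s = load s 0 0

  store : Memory I σ → Store
  store M = record { ints = intReg M ; reals = realReg M ; intA = intArray M ; realA = realArray M }

  setI : Fin intRegs → ℕ → Store → Store
  setI r n s = record s { ints = Vector.updateAt (ints s) r (λ _ → n) }

  setR : Fin realRegs → Carrier → Store → Store
  setR r x s = record s { reals = Vector.updateAt (reals s) r (λ _ → x) }

  putI : Fin intArrays → ℕ → ℕ → Store → Store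
  putI A i n s = record s { intA = Vector.updateAt (intA s) A (write I σ i n) }

  putR : Fin realArrays → ℕ → Carrier → Store → Store
  putR A i x s = record s { realA = Vector.updateAt (realA s) A (write I σ i x) }

  write-same : ∀ {a} {A : Set a} i (x : A) f → write I σ i x f i ≡ x
  write-same i x f = cong (λ b → if b then x else f i) (dec-true (i ℕ.≟ i) refl)

  write-other : ∀ {a} {A : Set a} {i k} (x : A) f → ¬ k ≡ i → write I σ i x f k ≡ f k
  write-other {i = i} {k} x f k≢i = cong (λ b → if b then x else f k) (dec-false (k ℕ.≟ i) k≢i)

  readOr-toℕ : ∀ {a} {A : Set a} {n} d (f : Fin n → A) i → readOr I σ d f (toℕ i) ≡ f i
  readOr-toℕ {n = n} d f i with toℕ i ℕ.<? n
  ... | yes i<n = cong f (Fin.fromℕ<-toℕ i i<n)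
  ... | no  i≮n = contradiction (Fin.toℕ<n i) i≮n

  private
    module _ (s : Store) (n x : ℕ) where

      -- Expressions never read the counters, so every rule may evaluate them in the representative
      -- `mem s`.
      evalI-mem : ∀ e → evalᴵ I σ e (load s n x) ≡ evalᴵ I σ e (mem s)
      evalI-mem (lit k)           = refl
      evalI-mem (reg r)           = refl
      evalI-mem (get A e)         = cong (intA s A) (evalI-mem e)
      evalI-mem (e ⊕ f)           = cong₂ ℕ._+_ (evalI-mem e) (evalI-mem f)
      evalI-mem (e ⊖ f)           = cong₂ ℕ._∸_ (evalI-mem e) (evalI-mem f)
      evalI-mem (e ⊗ f)           = cong₂ ℕ._*_ (evalI-mem e) (evalI-mem f)
      evalI-mem #sites            = refl
      evalI-mem #epochs           = refl
      evalI-mem startSite         = refl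
      evalI-mem (#requests e)     = cong (readOr I σ 0 (List⁺.length ∘ Input.epoch I)) (evalI-mem e)
      evalI-mem (requestSite e f) = cong₂
        (λ a b → readOr I σ 0 (λ h → readOr I σ 0 (toℕ ∘ List.lookup (List⁺.toList (Input.epoch I h))) b) a)
        (evalI-mem e) (evalI-mem f)

      evalR-mem : ∀ e → evalᴿ I σ e (load s n x) ≡ evalᴿ I σ e (mem s)
      evalR-mem (reg r)         = refl
      evalR-mem (get A e)       = cong (realA s A) (evalI-mem e)
      evalR-mem (e ⊕ᴿ f)        = cong₂ _+_ (evalR-mem e) (evalR-mem f)
      evalR-mem (e ⊖ᴿ f)        = cong₂ _-_ (evalR-mem e) (evalR-mem f)
      evalR-mem (position e)    = cong (readOr I σ 0# (Input.pos I)) (evalI-mem e)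
      evalR-mem (arrivalTime e) = cong (readOr I σ 0# (Input.arrival I)) (evalI-mem e)

      evalT-mem : ∀ b → evalᵀ I σ b (load s n x) ≡ evalᵀ I σ b (mem s)
      evalT-mem (e <ᴵ f) = cong₂ (λ a b → does (a ℕ.<? b)) (evalI-mem e) (evalI-mem f)
      evalT-mem (e ≤ᴿ f) = cong₂ (λ a b → does (a ≤? b)) (evalR-mem e) (evalR-mem f)

      extentI-mem : ∀ e → extentᴵ I σ e (load s n x) ≡ extentᴵ I σ e (mem s)
      extentI-mem (lit k)           = refl
      extentI-mem (reg r)           = refl
      extentI-mem (get A e)         = cong₂ (λ a b → suc a ℕ.⊔ b) (evalI-mem e) (extentI-mem e)
      extentI-mem (e ⊕ f)           = cong₂ ℕ._⊔_ (extentI-mem e) (extentI-mem f)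
      extentI-mem (e ⊖ f)           = cong₂ ℕ._⊔_ (extentI-mem e) (extentI-mem f)
      extentI-mem (e ⊗ f)           = cong₂ ℕ._⊔_ (extentI-mem e) (extentI-mem f)
      extentI-mem #sites            = refl
      extentI-mem #epochs           = refl
      extentI-mem startSite         = refl
      extentI-mem (#requests e)     = extentI-mem e
      extentI-mem (requestSite e f) = cong₂ ℕ._⊔_ (extentI-mem e) (extentI-mem f)

      extentR-mem : ∀ e → extentᴿ I σ e (load s n x) ≡ extentᴿ I σ e (mem s)
      extentR-mem (reg r)         = refl
      extentR-mem (get A e)       = cong₂ (λ a b → suc a ℕ.⊔ b) (evalI-mem e) (extentI-mem e)
      extentR-mem (e ⊕ᴿ f)        = cong₂ ℕ._⊔_ (extentR-mem e) (extentR-mem f)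
      extentR-mem (e ⊖ᴿ f)        = cong₂ ℕ._⊔_ (extentR-mem e) (extentR-mem f)
      extentR-mem (position e)    = extentI-mem e
      extentR-mem (arrivalTime e) = extentI-mem e

      extentT-mem : ∀ b → extentᵀ I σ b (load s n x) ≡ extentᵀ I σ b (mem s)
      extentT-mem (e <ᴵ f) = cong₂ ℕ._⊔_ (extentI-mem e) (extentI-mem f)
      extentT-mem (e ≤ᴿ f) = cong₂ ℕ._⊔_ (extentR-mem e) (extentR-mem f)

  module Bounded (X : ℕ) where

    Result : ∀ {q} → ℕ → (Store → Set q) → Memory I σ → Set q
    Result t Q M = Q (store M) × extent M ℕ.≤ X × steps M ℕ.≤ t

    -- A weakest precondition with a step budget `t`, uniform in the starting counters. Being a
    -- predicate on stores, it can itself serve as postcondition, which is how commands are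
    -- sequenced.
    record Runs {q} (k : Command σ) (t : ℕ) (Q : Store → Set q) (s : Store) : Set q where
      constructor runs
      field
        result-of : ∀ n x → x ℕ.≤ X → Result (t ℕ.+ n) Q (exec I σ k (load s n x))
    open Runs

    module _ {q} {Q : Store → Set q} where

      conseq : ∀ {q′} {Q′ : Store → Set q′} {k t s} → Runs k t Q s → (∀ s′ → Q s′ → Q′ s′) → Runs k t Q′ s
      conseq r h = runs λ n x x≤ → let a , b , e = result-of r n x x≤ in h _ a , b , e

      weaken : ∀ {k t t′ s} → t ℕ.≤ t′ → Runs k t Q s → Runs k t′ Q s
      weaken t≤ r = runs λ n x x≤ →
        let a , b , e = result-of r n x x≤ in a , b , ℕ.≤-trans e (ℕ.+-monoˡ-≤ n t≤)

      skip-rule : ∀ {s} → Q s → Runs skip 1 Q s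
      skip-rule q = runs λ n x x≤ → q , ℕ.⊔-lub x≤ z≤n , ℕ.≤-reflexive (ℕ.+-comm n 1)

      setI-rule : ∀ {r e s} → extentᴵ I σ e (mem s) ℕ.≤ X → Q (setI r (evalᴵ I σ e (mem s)) s) →
                  Runs (setᴵ r e) (suc (stepsᴵ I σ e)) Q s
      setI-rule {r} {e} {s} e≤ q = runs λ n x x≤ →
        subst (λ k → Q (setI r k s)) (sym (evalI-mem s n x e)) q ,
        ℕ.⊔-lub x≤ (subst (ℕ._≤ X) (sym (extentI-mem s n x e)) e≤) ,
        ℕ.≤-reflexive (ℕ.+-comm n _)

      setR-rule : ∀ {r e s} → extentᴿ I σ e (mem s) ℕ.≤ X → Q (setR r (evalᴿ I σ e (mem s)) s) →
                  Runs (setᴿ r e) (suc (stepsᴿ I σ e)) Q s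
      setR-rule {r} {e} {s} e≤ q = runs λ n x x≤ →
        subst (λ k → Q (setR r k s)) (sym (evalR-mem s n x e)) q ,
        ℕ.⊔-lub x≤ (subst (ℕ._≤ X) (sym (extentR-mem s n x e)) e≤) ,
        ℕ.≤-reflexive (ℕ.+-comm n _)

      putI-rule : ∀ {A i e s} → evalᴵ I σ i (mem s) ℕ.< X → extentᴵ I σ i (mem s) ℕ.≤ X →
                  extentᴵ I σ e (mem s) ℕ.≤ X →
                  Q (putI A (evalᴵ I σ i (mem s)) (evalᴵ I σ e (mem s)) s) →
                  Runs (putᴵ A i e) (suc (stepsᴵ I σ i ℕ.+ stepsᴵ I σ e)) Q s
      putI-rule {A} {i} {e} {s} i< i≤ e≤ q = runs λ n x x≤ →
        subst₂ (λ k l → Q (putI A k l s)) (sym (evalI-mem s n x i)) (sym (evalI-mem s n x e)) q ,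
        ℕ.⊔-lub x≤ (ℕ.⊔-lub (ℕ.⊔-lub (subst (ℕ._< X) (sym (evalI-mem s n x i)) i<)
                                     (subst (ℕ._≤ X) (sym (extentI-mem s n x i)) i≤))
                            (subst (ℕ._≤ X) (sym (extentI-mem s n x e)) e≤)) ,
        ℕ.≤-reflexive (ℕ.+-comm n _)

      putR-rule : ∀ {A i e s} → evalᴵ I σ i (mem s) ℕ.< X → extentᴵ I σ i (mem s) ℕ.≤ X →
                  extentᴿ I σ e (mem s) ℕ.≤ X →
                  Q (putR A (evalᴵ I σ i (mem s)) (evalᴿ I σ e (mem s)) s) →
                  Runs (putᴿ A i e) (suc (stepsᴵ I σ i ℕ.+ stepsᴿ I σ e)) Q s
      putR-rule {A} {i} {e} {s} i< i≤ e≤ q = runs λ n x x≤ →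
        subst₂ (λ k l → Q (putR A k l s)) (sym (evalI-mem s n x i)) (sym (evalR-mem s n x e)) q ,
        ℕ.⊔-lub x≤ (ℕ.⊔-lub (ℕ.⊔-lub (subst (ℕ._< X) (sym (evalI-mem s n x i)) i<)
                                     (subst (ℕ._≤ X) (sym (extentI-mem s n x i)) i≤))
                            (subst (ℕ._≤ X) (sym (extentR-mem s n x e)) e≤)) ,
        ℕ.≤-reflexive (ℕ.+-comm n _)

      seq-rule : ∀ {k l t t′ s} → Runs k t (Runs l t′ Q) s → Runs (k ⨾ l) (t ℕ.+ t′) Q s
      seq-rule {t = t} {t′} r = runs λ n x x≤ →
        let r′ , x′≤ , t≤ = result-of r n x x≤
            q , x″≤ , t′≤ = result-of r′ _ _ x′≤
        in q , x″≤ , ℕ.≤-trans t′≤ (ℕ.≤-trans (ℕ.+-monoʳ-≤ t′ t≤)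
             (ℕ.≤-reflexive (trans (sym (ℕ.+-assoc t′ t n)) (cong (ℕ._+ n) (ℕ.+-comm t′ t)))))

      cond-rule : ∀ {b k l t s} → extentᵀ I σ b (mem s) ℕ.≤ X →
                  (evalᵀ I σ b (mem s) ≡ true → Runs k t Q s) →
                  (evalᵀ I σ b (mem s) ≡ false → Runs l t Q s) →
                  Runs (cond b k l) (suc (stepsᵀ I σ b) ℕ.+ t) Q s
      cond-rule {b} {k} {l} {t} {s} b≤ yes-case no-case = runs λ n x x≤ →
        branch n x x≤ _ (sym (evalT-mem s n x b))
        where
        slow : ∀ {M : Memory I σ} {n} → Result (t ℕ.+ (n ℕ.+ suc (stepsᵀ I σ b))) Q M →
               Result (suc (stepsᵀ I σ b) ℕ.+ t ℕ.+ n) Q M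
        slow {n = n} (q , x≤ , t≤) = q , x≤ , ℕ.≤-trans t≤ (ℕ.≤-reflexive
          (trans (ℕ.+-comm t _) (trans (cong (ℕ._+ t) (ℕ.+-comm n _))
            (trans (ℕ.+-assoc (suc (stepsᵀ I σ b)) n t)
              (trans (cong (suc (stepsᵀ I σ b) ℕ.+_) (ℕ.+-comm n t)) (sym (ℕ.+-assoc (suc (stepsᵀ I σ b)) t n)))))))

        branch : ∀ n x → x ℕ.≤ X → ∀ v → evalᵀ I σ b (mem s) ≡ v →
                 let M = charge I σ (suc (stepsᵀ I σ b)) (extentᵀ I σ b (load s n x)) (load s n x) in
                 Result (suc (stepsᵀ I σ b) ℕ.+ t ℕ.+ n) Q (if v then exec I σ k M else exec I σ l M)
        branch n x x≤ true eq = slow {exec I σ k _} {n} (result-of (yes-case eq) _ _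
          (ℕ.⊔-lub x≤ (subst (ℕ._≤ X) (sym (extentT-mem s n x b)) b≤)))
        branch n x x≤ false eq = slow {exec I σ l _} {n} (result-of (no-case eq) _ _
          (ℕ.⊔-lub x≤ (subst (ℕ._≤ X) (sym (extentT-mem s n x b)) b≤)))

    -- The budget may depend on the iteration, so that scanning the epochs adds up to Q. The `suc`
    -- is the step charged for setting the loop register.
    loop-rule : ∀ {q r e k s} (Inv : ℕ → Store → Set q) {n} (t : ℕ → ℕ) →
                evalᴵ I σ e (mem s) ≡ n → extentᴵ I σ e (mem s) ℕ.≤ X → Inv 0 s →
                (∀ i s → i ℕ.< n → Inv i s → Runs k (t i) (Inv (suc i)) (setI r i s)) →
                Runs (for r e k) (suc (stepsᴵ I σ e) ℕ.+ Σ< n (suc ∘ t)) (Inv n) s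
    loop-rule {r = r} {e} {k} {s} Inv {n} t e≡n e≤ initially step = runs λ a x x≤ →
      subst (λ k′ → Result (suc (stepsᴵ I σ e) ℕ.+ Σ< n (suc ∘ t) ℕ.+ a) (Inv n)
                      (repeat I σ k′ (λ i M → exec I σ k (charge I σ 1 0 (assignᴵ I σ r i M)))
                        (charge I σ (suc (stepsᴵ I σ e)) (extentᴵ I σ e (load s a x)) (load s a x))))
        (sym (trans (evalI-mem s a x e) e≡n))
        (finish a (iterate n ℕ.≤-refl
          (charge I σ (suc (stepsᴵ I σ e)) (extentᴵ I σ e (load s a x)) (load s a x)) initially
          (ℕ.⊔-lub x≤ (subst (ℕ._≤ X) (sym (extentI-mem s a x e)) e≤))))
      where
      iterate : ∀ i → i ℕ.≤ n → ∀ M → Inv 0 (store M) → extent M ℕ.≤ X →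
                Result (Σ< i (suc ∘ t) ℕ.+ steps M) (Inv i)
                  (repeat I σ i (λ i M → exec I σ k (charge I σ 1 0 (assignᴵ I σ r i M))) M)
      iterate zero    _   M inv x≤ = inv , x≤ , ℕ.≤-refl
      iterate (suc i) i<n M inv x≤ =
        let inv′ , x′≤ , t≤ = iterate i (ℕ.<⇒≤ i<n) M inv x≤
            inv″ , x″≤ , t′≤ = result-of (step i _ i<n inv′) _ _ (ℕ.⊔-lub x′≤ z≤n)
        in inv″ , x″≤ , ℕ.≤-trans t′≤ (ℕ.≤-trans (ℕ.+-monoʳ-≤ (t i) (ℕ.+-monoˡ-≤ 1 t≤))
             (ℕ.≤-reflexive (rearrange (t i) (Σ< i (suc ∘ t)) (steps M))))
        where
        rearrange : ∀ a b c → a ℕ.+ (b ℕ.+ c ℕ.+ 1) ≡ b ℕ.+ suc a ℕ.+ c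
        rearrange = solve-∀

      finish : ∀ a {M} → Result (Σ< n (suc ∘ t) ℕ.+ (a ℕ.+ suc (stepsᴵ I σ e))) (Inv n) M →
               Result (suc (stepsᴵ I σ e) ℕ.+ Σ< n (suc ∘ t) ℕ.+ a) (Inv n) M
      finish a (q , x≤ , t≤) = q , x≤ , ℕ.≤-trans t≤ (ℕ.≤-reflexive
        (rearrange (Σ< n (suc ∘ t)) a (suc (stepsᴵ I σ e))))
        where
        rearrange : ∀ b a e → b ℕ.+ (a ℕ.+ e) ≡ e ℕ.+ b ℕ.+ a
        rearrange = solve-∀

run-program : ∀ {c ℓ} {R : LinearlyOrderedAbelianGroup c ℓ} (prog : Program) (I : Input R) →
  let open Machine I (Program.storage prog) in
  ∀ X {q} {Q : Store → Set q} {t} → Bounded.Runs X (Program.body prog) t Q (store (blank I (Program.storage prog))) →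
  Bounded.Result X (t ℕ.+ 0) Q (result prog I)
run-program prog I X r = Machine.Bounded.Runs.result-of r 0 0 z≤n

-- Relaxation: two offers per block and end site.

module Relaxation {c ℓ} {R : LinearlyOrderedAbelianGroup c ℓ} (I : Input R) where

  open LinearlyOrderedAbelianGroup R
  open OrderedGroup R
  open Solver using (solve; _:+_; _:-_; _:=_; :0)
  open Input I
  open Recurrence I

  -- `candidate` with the first epoch taken from `Fin m` instead of `Fin′ (suc j)`, since the
  -- program fixes p before j.
  option : (j : Fin m) (z : Fin N) → Fin m → Fin N → Carrier ⁺
  option j z p y = F° (inject₁ p) y +⁺ blockCost I p j y z

  private
    candidate≡option : ∀ j z (q : Fin′ (suc j)) {p} y → toℕ q ≡ toℕ p → candidate j z q y ≡ option j z p y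
    candidate≡option j z q {p} y q≡p = cong₂ (λ i e → F° i y +⁺ blockCost I e j y z)
      (Fin.toℕ-injective (trans (Fin.toℕ-inject {i = suc j} q) (trans q≡p (sym (Fin.toℕ-inject₁ p)))))
      (Fin.toℕ-injective (trans (inject-toℕ≡ {n = m} {i = suc j} q) q≡p))

    blockOf : ∀ {j p : Fin m} → p Fin.≤ j → ∃[ q ] toℕ {suc (toℕ j)} q ≡ toℕ p
    blockOf p≤j = Fin.fromℕ< (s≤s p≤j) , Fin.toℕ-fromℕ< (s≤s p≤j)

    epochOf : ∀ {j : Fin m} (q : Fin′ (suc j)) → ∃[ p ] p Fin.≤ j × toℕ q ≡ toℕ p
    epochOf {j} q = inject! {i = suc j} q , block≤ j q , sym (inject-toℕ≡ {n = m} {i = suc j} q)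

  F≤option : ∀ {j z p} y → p Fin.≤ j → F° (suc j) z ≤⁺ option j z p y
  F≤option {j} {z} y p≤j =
    let q , q≡p = blockOf p≤j in subst (F° (suc j) z ≤⁺_) (candidate≡option j z q y q≡p) (F≤ j z q y)

  F-glb-option : ∀ j z {v} → (∀ {p} → p Fin.≤ j → ∀ y → v ≤⁺ option j z p y) → v ≤⁺ F° (suc j) z
  F-glb-option j z {v} h = F-glb j z λ q y →
    let p , p≤j , q≡p = epochOf {j} q in subst (v ≤⁺_) (sym (candidate≡option j z q y q≡p)) (h p≤j y)

  option-attains : ∀ {j z p y} → p Fin.≤ j → F° (suc j) z ≡ option j z p y →
                   ∃[ q ] toℕ q ≡ toℕ p × Attains I j z q y
  option-attains {j} {z} {p} {y} p≤j eq =
    let q , q≡p = blockOf p≤j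
    in q , q≡p , Attains⁺ q y (trans eq (sym (candidate≡option j z q y q≡p)))

  -- g is the paper's G_i(x), with minimizer y.
  record Envelope (i : Fin (suc m)) (x y : Fin N) (g : Carrier) : Set (c Level.⊔ ℓ) where
    field
      attained : F° i y +⁺ dist I y x ≤⁺ [ g ]
      below    : ∀ y′ → [ g ] ≤⁺ F° i y′ +⁺ dist I y′ x

  envelope-zero : ∀ x → Envelope zero x s₀ (dist I s₀ x)
  envelope-zero x = record
    { attained = ≤⁺-reflexive (trans (cong (_+⁺ dist I s₀ x) F-zero-start) (cong [_] (+-identityˡ _)))
    ; below    = λ y′ → below′ y′ (F° zero y′) refl
    }
    where
    below′ : ∀ y′ v → F° zero y′ ≡ v → [ dist I s₀ x ] ≤⁺ F° zero y′ +⁺ dist I y′ x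
    below′ y′ ⊤⁺ eq = subst (λ v → [ dist I s₀ x ] ≤⁺ v +⁺ dist I y′ x) (sym eq) (_ ≤⊤⁺)
    below′ y′ [ v ] eq with F-zero-finite {y′} (≤⁺-reflexive eq)
    ... | refl = ≤⁺-reflexive (sym (trans (cong (_+⁺ dist I s₀ x) F-zero-start) (cong [_] (+-identityˡ _))))

  -- From layer 1 on, F is 1-Lipschitz and hence its own lower envelope, so the
  -- program needs no forward and backward scans.
  envelope-suc : ∀ j x {g} → [ g ] ≡ F° (suc j) x → Envelope (suc j) x x g
  envelope-suc j x {g} eq = record
    { attained = ≤⁺-reflexive (trans (cong₂ _+⁺_ (sym eq) (dist-self x)) (cong [_] (+-identityʳ g)))
    ; below    = λ y′ → subst (_≤⁺ F° (suc j) y′ +⁺ dist I y′ x) (sym eq) (F-lipschitz j y′ x)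
    }

  module _ {p j : Fin m} {l u : Fin N} (ex : Extremes p j l u) where

    -- The part of `blockCost` that depends on neither the start nor the end site; the program adds
    -- it once per row.
    width : Carrier
    width = (pos u - pos l) + (arrival j - arrival p)

    private
      shift : ∀ {K s a b} g x w → K ≡ s + x → g + (K + a - b) ≡ (g + w) + ((s + (a - b)) + (x - w))
      shift {_} {s} {a} {b} g x w refl =
        solve 6 (λ s a b g x w → g :+ (s :+ x :+ a :- b) := g :+ w :+ (s :+ (a :- b) :+ (x :- w))) refl s a b g x w

      cost≤ : ∀ {k e s a b x d} → k ≡ s + e → e ≤ x + d → k + a - b ≤ x + ((s + (a - b)) + d)
      cost≤ {_} {e} {s} {a} {b} {x} {d} refl le = by le
        (solve 6 (λ s e a b x d → s :+ e :+ a :- b :+ (x :+ d) := x :+ (s :+ (a :- b) :+ d) :+ e) refl s e a b x d)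

      ≤cost : ∀ {k e s a b x d} → k ≡ s + e → x + d ≡ e → x + ((s + (a - b)) + d) ≤ k + a - b
      ≤cost {_} {_} {s} {a} {b} {x} {d} refl refl = ≤-reflexive
        (solve 5 (λ s a b x d → x :+ (s :+ (a :- b) :+ d) := s :+ (x :+ d) :+ a :- b) refl s a b x d)

      K≡′ : ∀ y z → K I p j y z ≡ (pos u - pos l) + ((dist I y l + dist I z u) ⊓ (dist I y u + dist I z l))
      K≡′ y z = trans (K≡ ex y z) (cong₂ (λ a b → (pos u - pos l) + ((dist I y l + a) ⊓ (dist I y u + b)))
        (dist-sym u z) (dist-sym l z))

      upper : ∀ {x y z g d} → Envelope (inject₁ p) x y g → blockCost I p j y z ≤ dist I y x + (width + d) →
              option j z p y ≤⁺ [ (g + width) + d ]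
      upper {x} {y} {z} {g} {d} env le = ≤⁺-trans (+⁺-monoʳ (F° (inject₁ p) y) le)
        (≤⁺-trans (≤⁺-reflexive (sym (+⁺-assoc (F° (inject₁ p) y) (dist I y x) (width + d))))
          (≤⁺-trans (+⁺-monoˡ (width + d) (Envelope.attained env))
            (≤⁺-reflexive (cong [_] (sym (+-assoc g width d))))))

      lower : ∀ {x y y′ z g d} → Envelope (inject₁ p) x y g → dist I y′ x + (width + d) ≤ blockCost I p j y′ z →
              [ (g + width) + d ] ≤⁺ option j z p y′
      lower {x} {y} {y′} {z} {g} {d} env le = ≤⁺-trans (≤⁺-reflexive (cong [_] (+-assoc g width d)))
        (≤⁺-trans (+⁺-monoˡ (width + d) (Envelope.below env y′))
          (≤⁺-trans (≤⁺-reflexive (+⁺-assoc (F° (inject₁ p) y′) (dist I y′ x) (width + d)))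
            (+⁺-monoʳ (F° (inject₁ p) y′) le)))

    -- An offer fixes which extreme is visited first, so it is at least the true option for its
    -- minimizer. Conversely `dominate` picks, for any y, the order attaining the minimum in `K`;
    -- the offer for that order is no larger since the envelope minimizes over start sites. So the
    -- smaller offer is the minimum over y.
    option≤lo : ∀ {y z g} → Envelope (inject₁ p) l y g → option j z p y ≤⁺ [ (g + width) + dist I z u ]
    option≤lo {y} {z} env = upper env (cost≤ (K≡′ y z) (x⊓y≤x _ _))

    option≤hi : ∀ {y z g} → Envelope (inject₁ p) u y g → option j z p y ≤⁺ [ (g + width) + dist I z l ]
    option≤hi {y} {z} env = upper env (cost≤ (K≡′ y z) (x⊓y≤y _ _))

    dominate : ∀ {y₁ y₂ z g₁ g₂} → Envelope (inject₁ p) l y₁ g₁ → Envelope (inject₁ p) u y₂ g₂ → ∀ y →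
               ([ (g₁ + width) + dist I z u ] ≤⁺ option j z p y) ⊎
               ([ (g₂ + width) + dist I z l ] ≤⁺ option j z p y)
    dominate {z = z} env₁ env₂ y with ⊓-sel (dist I y l + dist I z u) (dist I y u + dist I z l)
    ... | inj₁ eq = inj₁ (lower env₁ (≤cost (K≡′ y z) (sym eq)))
    ... | inj₂ eq = inj₂ (lower env₂ (≤cost (K≡′ y z) (sym eq)))

  -- An entry is a value with its block and site pointers; it accounts for the
  -- blocks ending with j whose first epoch is among the first n epochs.
  record Cell (j : Fin m) (z : Fin N) (n : ℕ) (entry : Carrier × ℕ × ℕ) : Set (c Level.⊔ ℓ) where
    field
      bound   : ∀ {p} → p Fin.≤ j → toℕ p ℕ.< n → ∀ y → [ proj₁ entry ] ≤⁺ option j z p y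
      witness : 0 ℕ.< n → ∃[ p ] ∃[ y ] p Fin.≤ j × entry ≡ (proj₁ entry , toℕ p , toℕ y) ×
                option j z p y ≤⁺ [ proj₁ entry ]

  -- Before the first pass nothing is claimed, so the table need not be initialised.
  cell-zero : ∀ {j z entry} → Cell j z 0 entry
  cell-zero = record { bound = λ _ () ; witness = λ () }

  -- No block ending with j starts after j, so such a row is already complete.
  cell-skip : ∀ {j z n entry} → toℕ j ℕ.< n → Cell j z n entry → Cell j z (suc n) entry
  cell-skip j<n cell = record
    { bound   = λ p≤j _ → Cell.bound cell p≤j (ℕ.≤-<-trans p≤j j<n)
    ; witness = λ _ → Cell.witness cell (ℕ.≤-trans (s≤s z≤n) j<n)
    }

  module _ {j : Fin m} {z : Fin N} {n : ℕ} {entry : Carrier × ℕ × ℕ}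
           (j<n : toℕ j ℕ.< n) (cell : Cell j z n entry) where

    cell-value : [ proj₁ entry ] ≡ F° (suc j) z
    cell-value =
      let p , y , p≤j , _ , le = Cell.witness cell (ℕ.≤-trans (s≤s z≤n) j<n)
      in ≤⁺-antisym (F-glb-option j z (λ p≤j → Cell.bound cell p≤j (ℕ.≤-<-trans p≤j j<n)))
                    (≤⁺-trans (F≤option y p≤j) le)

    cell-pointers : ∃[ q ] ∃[ y ] toℕ q ≡ proj₁ (proj₂ entry) × toℕ y ≡ proj₂ (proj₂ entry) × Attains I j z q y
    cell-pointers =
      let p , y , p≤j , eq , le = Cell.witness cell (ℕ.≤-trans (s≤s z≤n) j<n)
          q , q≡p , att = option-attains p≤j
            (≤⁺-antisym (F≤option y p≤j) (≤⁺-trans le (≤⁺-reflexive cell-value)))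
      in q , y , trans q≡p (sym (cong (λ e → proj₁ (proj₂ e)) eq)) , sym (cong (λ e → proj₂ (proj₂ e)) eq) , att

  -- The entry after some of the offers for first epoch p.
  record Relaxed (j : Fin m) (z : Fin N) (p : Fin m) (old new : Carrier × ℕ × ℕ) : Set (c Level.⊔ ℓ) where
    field
      ≤old   : 0 ℕ.< toℕ p → proj₁ new ≤ proj₁ old
      source : (0 ℕ.< toℕ p × new ≡ old) ⊎
               (∃[ y ] new ≡ (proj₁ new , toℕ p , toℕ y) × option j z p y ≤⁺ [ proj₁ new ])

  cell-relaxed : ∀ {j z p old new c₁ c₂} → p Fin.≤ j → Cell j z (toℕ p) old → Relaxed j z p old new →
                 proj₁ new ≤ c₁ → proj₁ new ≤ c₂ →
                 (∀ y → ([ c₁ ] ≤⁺ option j z p y) ⊎ ([ c₂ ] ≤⁺ option j z p y)) →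
                 Cell j z (suc (toℕ p)) new
  cell-relaxed {j} {z} {p} {old} {new} p≤j cell rel ≤c₁ ≤c₂ dom = record
    { bound   = λ q≤j q≤p y → bound′ q≤j (ℕ.m≤n⇒m<n∨m≡n (ℕ.≤-pred q≤p)) y
    ; witness = λ _ → witness′ (Relaxed.source rel)
    }
    where
    bound′ : ∀ {q} → q Fin.≤ j → toℕ q ℕ.< toℕ p ⊎ toℕ q ≡ toℕ p → ∀ y → [ proj₁ new ] ≤⁺ option j z q y
    bound′ q≤j (inj₁ q<p) y = ≤⁺-trans [ Relaxed.≤old rel (ℕ.≤-trans (s≤s z≤n) q<p) ] (Cell.bound cell q≤j q<p y)
    bound′ q≤j (inj₂ q≡p) y with Fin.toℕ-injective q≡p
    ... | refl with dom y
    ... | inj₁ le = ≤⁺-trans [ ≤c₁ ] le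
    ... | inj₂ le = ≤⁺-trans [ ≤c₂ ] le

    witness′ : _ → ∃[ q ] ∃[ y ] q Fin.≤ j × new ≡ (proj₁ new , toℕ q , toℕ y) × option j z q y ≤⁺ [ proj₁ new ]
    witness′ (inj₁ (0<p , refl))   = Cell.witness cell 0<p
    witness′ (inj₂ (y , eq , le)) = p , y , p≤j , eq , le

-- The program.

module Code where

  layout : Storage
  layout = record { intRegs = 8 ; realRegs = 4 ; intArrays = 4 ; realArrays = 1 }

  -- `P` is the current epoch or first epoch of a block, `D` the offset of the last epoch from it
  -- (during the scan, the position in the epoch), `Z` the end site, `LO` and `HI` the extremes,
  -- `YL` and `YU` the start sites behind the low-first and high-first offers with bases `BL` and
  -- `BU`, `AM` and `BEST` the final argmin and value. `LOA` and `HIA` keep the extremes of single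
  -- epochs.
  pattern P  = 0F
  pattern D  = 1F
  pattern Z  = 2F
  pattern LO = 3F
  pattern HI = 4F
  pattern YL = 5F
  pattern YU = 6F
  pattern AM = 7F
  pattern BL   = 0F
  pattern BU   = 1F
  pattern V    = 2F
  pattern BEST = 3F
  pattern LOA = 0F
  pattern HIA = 1F
  pattern PB  = 2F
  pattern PS  = 3F
  pattern TAB = 0F

  last-epoch current : IntExp layout
  last-epoch = reg P ⊕ reg D
  current    = (reg P ⊕ reg D) ⊗ #sites ⊕ reg Z

  -- Truncated subtraction gives minima and maxima without branching.
  widen : IntExp layout → IntExp layout → Command layout
  widen e f = setᴵ LO (reg LO ⊖ (reg LO ⊖ e)) ⨾ setᴵ HI (reg HI ⊕ (f ⊖ reg HI))

  scan-epoch : Command layout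
  scan-epoch =
    -- Request 0 exists because epochs are nonempty; the loop merges it once more without effect.
    setᴵ LO (requestSite (reg P) (lit 0)) ⨾
    setᴵ HI (requestSite (reg P) (lit 0)) ⨾
    for D (#requests (reg P)) (widen (requestSite (reg P) (reg D)) (requestSite (reg P) (reg D))) ⨾
    putᴵ LOA (reg P) (reg LO) ⨾
    putᴵ HIA (reg P) (reg HI)

  measure : Fin 4 → IntExp layout → IntExp layout → Command layout
  measure r e f = cond (position e ≤ᴿ position f)
    (setᴿ r (position f ⊖ᴿ position e))
    (setᴿ r (position e ⊖ᴿ position f))

  -- Loads the envelope at both extremes. Row k of the table holds layer k + 1, so the layer before
  -- epoch P is row P - 1, and P = 0 is computed from the start site.
  sources : Command layout
  sources = cond (reg P <ᴵ lit 1)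
    (setᴵ YL startSite ⨾ setᴵ YU startSite ⨾
     measure BL startSite (reg LO) ⨾ measure BU startSite (reg HI))
    (setᴵ YL (reg LO) ⨾ setᴵ YU (reg HI) ⨾
     setᴿ BL (get TAB ((reg P ⊖ lit 1) ⊗ #sites ⊕ reg LO)) ⨾
     setᴿ BU (get TAB ((reg P ⊖ lit 1) ⊗ #sites ⊕ reg HI)))

  add-width : Fin 4 → Command layout
  add-width r = setᴿ r (reg r ⊕ᴿ ((position (reg HI) ⊖ᴿ position (reg LO)) ⊕ᴿ
                                  (arrivalTime last-epoch ⊖ᴿ arrivalTime (reg P))))

  enter offer : Fin 8 → Command layout
  enter y = putᴿ TAB current (reg V) ⨾ putᴵ PB current (reg P) ⨾ putᴵ PS current (reg y)
  offer y = cond (get TAB current ≤ᴿ reg V) skip (enter y)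

  relax-cell : Command layout
  relax-cell =
    measure V (reg Z) (reg HI) ⨾ setᴿ V (reg BL ⊕ᴿ reg V) ⨾
    -- In pass 0 the first offer overwrites whatever the cell holds; this replaces an initial
    -- infinity.
    cond (reg P <ᴵ lit 1) (enter YL) (offer YL) ⨾
    measure V (reg Z) (reg LO) ⨾ setᴿ V (reg BU ⊕ᴿ reg V) ⨾
    offer YU

  relax-row : Command layout
  relax-row =
    widen (get LOA last-epoch) (get HIA last-epoch) ⨾
    sources ⨾ add-width BL ⨾ add-width BU ⨾
    for Z #sites relax-cell

  relax-blocks : Command layout
  relax-blocks =
    setᴵ LO (get LOA (reg P)) ⨾ setᴵ HI (get HIA (reg P)) ⨾
    for D (#epochs ⊖ reg P) relax-row

  final-cell : Fin 8 → IntExp layout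
  final-cell r = (#epochs ⊖ lit 1) ⊗ #sites ⊕ reg r

  compare : Command layout
  compare = cond (reg BEST ≤ᴿ get TAB (final-cell Z)) skip
    (setᴿ BEST (get TAB (final-cell Z)) ⨾ setᴵ AM (reg Z))

  read-out : Command layout
  read-out = cond (#epochs <ᴵ lit 1)
    -- Without epochs the optimum is zero, produced by a subtraction since there are no real
    -- literals.
    (setᴵ AM startSite ⨾ setᴿ BEST (reg BEST ⊖ᴿ reg BEST))
    (setᴵ AM startSite ⨾ setᴿ BEST (get TAB (final-cell AM)) ⨾ for Z #sites compare)

  program : Program
  program = record
    { storage = layout
    ; body = for P #epochs scan-epoch ⨾ for P #epochs relax-blocks ⨾ read-out
    ; valueReg = BEST ; argminReg = AM
    ; tableF = TAB ; pointerBlock = PB ; pointerSite = PS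
    }

-- Correctness of the program: site ranges and a single cell.

does⇒ : ∀ {a} {A : Set a} (d : Dec A) → does d ≡ true → A
does⇒ (yes x) _ = x

does⇒¬ : ∀ {a} {A : Set a} (d : Dec A) → does d ≡ false → ¬ A
does⇒¬ (no ¬x) _ = ¬x

finite : ∀ {n i} → i ℕ.< n → ∃[ v ] toℕ {n} v ≡ i
finite i<n = fromℕ< i<n , Fin.toℕ-fromℕ< i<n

-- The numbers in two registers are the least and greatest site of a nonempty set. It serves for an
-- epoch, the scanned part of an epoch, and a block.
record Range {N q} (S : Fin N → Set q) (a b : ℕ) : Set q where
  constructor range
  field
    l u : Fin N
    a≡  : a ≡ toℕ l
    b≡  : b ≡ toℕ u
    l∈  : S l
    u∈  : S u
    l≤  : ∀ {v} → S v → l Fin.≤ v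
    ≤u  : ∀ {v} → S v → v Fin.≤ u

module _ {N q q₁ q₂} {S : Fin N → Set q} {S₁ : Fin N → Set q₁} {S₂ : Fin N → Set q₂} where

  private
    range-min : ∀ {a a′} (l l′ : Fin N) → a ≡ toℕ l → a′ ≡ toℕ l′ → S₁ l → S₂ l′ →
      (∀ {v} → S₁ v → S v) → (∀ {v} → S₂ v → S v) →
      ∃[ k ] a ℕ.∸ (a ℕ.∸ a′) ≡ toℕ k × S k × k Fin.≤ l × k Fin.≤ l′
    range-min l l′ refl refl l∈ l′∈ f₁ f₂ with ℕ.≤-total (toℕ l) (toℕ l′)
    ... | inj₁ le = l , cong (toℕ l ℕ.∸_) (ℕ.m≤n⇒m∸n≡0 le) , f₁ l∈ , ℕ.≤-refl , le
    ... | inj₂ ge = l′ , ℕ.m∸[m∸n]≡n ge , f₂ l′∈ , ge , ℕ.≤-refl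

    range-max : ∀ {b b′} (u u′ : Fin N) → b ≡ toℕ u → b′ ≡ toℕ u′ → S₁ u → S₂ u′ →
      (∀ {v} → S₁ v → S v) → (∀ {v} → S₂ v → S v) →
      ∃[ k ] b ℕ.+ (b′ ℕ.∸ b) ≡ toℕ k × S k × u Fin.≤ k × u′ Fin.≤ k
    range-max u u′ refl refl u∈ u′∈ f₁ f₂ with ℕ.≤-total (toℕ u) (toℕ u′)
    ... | inj₁ le = u′ , ℕ.m+[n∸m]≡n le , f₂ u′∈ , le , ℕ.≤-refl
    ... | inj₂ ge = u , trans (cong (toℕ u ℕ.+_) (ℕ.m≤n⇒m∸n≡0 ge)) (ℕ.+-identityʳ _) , f₁ u∈ , ℕ.≤-refl , ge

  range-∪ : ∀ {a b a′ b′} → Range S₁ a b → Range S₂ a′ b′ →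
            (∀ {v} → S₁ v → S v) → (∀ {v} → S₂ v → S v) → (∀ {v} → S v → S₁ v ⊎ S₂ v) →
            Range S (a ℕ.∸ (a ℕ.∸ a′)) (b ℕ.+ (b′ ℕ.∸ b))
  range-∪ (range l u a≡ b≡ l∈ u∈ l≤ ≤u) (range l′ u′ a′≡ b′≡ l′∈ u′∈ l′≤ ≤u′) f₁ f₂ f
    with range-min l l′ a≡ a′≡ l∈ l′∈ f₁ f₂ | range-max u u′ b≡ b′≡ u∈ u′∈ f₁ f₂
  ... | k , k≡ , k∈ , k≤l , k≤l′ | k′ , k′≡ , k′∈ , u≤k′ , u′≤k′ =
    range k k′ k≡ k′≡ k∈ k′∈
      (λ v∈ → Sum.[ (λ v∈₁ → ℕ.≤-trans k≤l (l≤ v∈₁)) , (λ v∈₂ → ℕ.≤-trans k≤l′ (l′≤ v∈₂)) ] (f v∈))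
      (λ v∈ → Sum.[ (λ v∈₁ → ℕ.≤-trans (≤u v∈₁) u≤k′) , (λ v∈₂ → ℕ.≤-trans (≤u′ v∈₂) u′≤k′) ] (f v∈))

range-resp : ∀ {N q q′} {S : Fin N → Set q} {S′ : Fin N → Set q′} {a b} →
             (∀ {v} → S v → S′ v) → (∀ {v} → S′ v → S v) →
             Range S a b → Range S′ a b
range-resp to from (range l u a≡ b≡ l∈ u∈ l≤ ≤u) =
  range l u a≡ b≡ (to l∈) (to u∈) (l≤ ∘ from) (≤u ∘ from)

range-single : ∀ {N} (v : Fin N) → Range (_≡ v) (toℕ v) (toℕ v)
range-single v = range v v refl refl refl refl
  (λ eq → ℕ.≤-reflexive (cong toℕ (sym eq))) (λ eq → ℕ.≤-reflexive (cong toℕ eq))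

module Verification {c ℓ} {R : LinearlyOrderedAbelianGroup c ℓ} (I : Input R) where

  open LinearlyOrderedAbelianGroup R
  open OrderedGroup R
  open Input I
  open Recurrence I
  open Relaxation I
  open Code
  open Machine I layout

  -- All array accesses stay below this bound.
  X : ℕ
  X = m ℕ.* N

  open Bounded X

  -- The literal step counts in the statements below add up what the rules of
  -- Bounded charge.
  within : ∀ {q} {Q : Store → Set q} {k s} t′ {t} → {T (t ℕ.≤ᵇ t′)} → Runs k t Q s → Runs k t′ Q s
  within t′ {t} {t≤} = weaken (ℕ.≤ᵇ⇒≤ t t′ t≤)

  1≤N : 1 ℕ.≤ N
  1≤N = ℕ.≤-trans (s≤s z≤n) (Fin.toℕ<n s₀)

  epoch<X : ∀ (h : Fin m) → toℕ h ℕ.< X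
  epoch<X h = ℕ.<-≤-trans (Fin.toℕ<n h) (ℕ.≤-trans (ℕ.≤-reflexive (sym (ℕ.*-identityʳ m))) (ℕ.*-monoʳ-≤ m 1≤N))

  index : Fin m → Fin N → ℕ
  index j z = toℕ j ℕ.* N ℕ.+ toℕ z

  private
    index≡ : ∀ j z → index j z ≡ toℕ (Fin.combine j z)
    index≡ j z = trans (cong (ℕ._+ toℕ z) (ℕ.*-comm (toℕ j) N)) (sym (Fin.toℕ-combine j z))

  index<X : ∀ j z → index j z ℕ.< X
  index<X j z = subst (ℕ._< X) (sym (index≡ j z)) (Fin.toℕ<n (Fin.combine j z))

  index-injective : ∀ {j z j′ z′} → index j z ≡ index j′ z′ → j ≡ j′ × z ≡ z′
  index-injective {j} {z} {j′} {z′} eq = Fin.combine-injective j z j′ z′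
    (Fin.toℕ-injective (trans (sym (index≡ j z)) (trans eq (index≡ j′ z′))))

  Entry : Set c
  Entry = Carrier × ℕ × ℕ

  entry : Store → ℕ → Entry
  entry s k = realA s TAB k , intA s PB k , intA s PS k

  position≡ : ∀ {k u} → k ≡ toℕ u → readOr I layout 0# pos k ≡ pos u
  position≡ {u = u} refl = readOr-toℕ 0# pos u

  arrival≡ : ∀ {k h} → k ≡ toℕ h → readOr I layout 0# arrival k ≡ arrival h
  arrival≡ {h = h} refl = readOr-toℕ 0# arrival h

  -- The budget adds up both branches although one of them runs. The conditions on extents say that
  -- neither index expression accesses an array.
  measure-rule : ∀ {q} {Q : Store → Set q} {r e f s u v} →
    evalᴵ I layout e (mem s) ≡ toℕ u → evalᴵ I layout f (mem s) ≡ toℕ v →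
    extentᴵ I layout e (mem s) ≡ 0 → extentᴵ I layout f (mem s) ≡ 0 →
    (∀ x → x ≡ dist I u v → Q (setR r x s)) →
    let a = stepsᴵ I layout e ; b = stepsᴵ I layout f in
    Runs (measure r e f)
      (2 ℕ.+ (suc a ℕ.+ suc b) ℕ.+ ((2 ℕ.+ (suc b ℕ.+ suc a)) ℕ.+ (2 ℕ.+ (suc a ℕ.+ suc b)))) Q s
  measure-rule {r = r} {e} {f} {s} {u} {v} e≡ f≡ e≤ f≤ q = cond-rule
    (zero-extent e≤ f≤)
    (λ eq → weaken (ℕ.m≤m+n _ _) (setR-rule (zero-extent f≤ e≤)
      (q _ (trans (cong₂ _-_ pf pe) (sym (≤⇒∣-∣≡′ (subst₂ _≤_ pe pf (does⇒ (_ ≤? _) eq))))))))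
    (λ eq → weaken (ℕ.m≤n+m _ (2 ℕ.+ (suc (stepsᴵ I layout f) ℕ.+ suc (stepsᴵ I layout e))))
      (setR-rule (zero-extent e≤ f≤)
      (q _ (trans (cong₂ _-_ pe pf) (sym (≤⇒∣-∣≡ (subst₂ _≤_ pf pe (≰⇒≥ (does⇒¬ (_ ≤? _) eq)))))))))
    where
    pe : evalᴿ I layout (position e) (mem s) ≡ pos u
    pe = position≡ e≡
    pf : evalᴿ I layout (position f) (mem s) ≡ pos v
    pf = position≡ f≡

    zero-extent : ∀ {a b} → a ≡ 0 → b ≡ 0 → a ℕ.⊔ b ℕ.≤ X
    zero-extent refl refl = z≤n

  -- The registers and arrays that relaxing a cell does not write. `key` computes through the writes
  -- to the others, so `Row (key s)` carries over definitionally.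
  record Key : Set c where
    field
      p d lo hi yl yu : ℕ
      bl bu           : Carrier
      loA hiA         : ℕ → ℕ

  key : Store → Key
  key s = record
    { p = ints s P ; d = ints s D ; lo = ints s LO ; hi = ints s HI ; yl = ints s YL ; yu = ints s YU
    ; bl = reals s BL ; bu = reals s BU ; loA = intA s LOA ; hiA = intA s HIA }

  EpochRange : Fin m → ℕ → ℕ → Set
  EpochRange h = Range (_∈ toList (epoch h))

  EpochRanges : (ℕ → ℕ) → (ℕ → ℕ) → Set
  EpochRanges A B = ∀ h → EpochRange h (A (toℕ h)) (B (toℕ h))

  -- Before the cells from number k on are relaxed for first epoch p.
  Tables : Fin m → ℕ → (ℕ → Entry) → Set (c Level.⊔ ℓ)
  Tables p k A = ∀ j z → (index j z ℕ.< k → Cell j z (suc (toℕ p)) (A (index j z)))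
                       × (k ℕ.≤ index j z → Cell j z (toℕ p) (A (index j z)))

  record Progress (p j : Fin m) (z : Fin N) (A A′ : ℕ → Entry) : Set (c Level.⊔ ℓ) where
    field
      elsewhere : ∀ i → ¬ i ≡ index j z → A′ i ≡ A i
      relaxed   : Relaxed j z p (A (index j z)) (A′ (index j z))

  tables-step : ∀ {p j z A A′ c₁ c₂} → p Fin.≤ j → Tables p (index j z) A → Progress p j z A A′ →
    proj₁ (A′ (index j z)) ≤ c₁ → proj₁ (A′ (index j z)) ≤ c₂ →
    (∀ y → ([ c₁ ] ≤⁺ option j z p y) ⊎ ([ c₂ ] ≤⁺ option j z p y)) →
    Tables p (suc (index j z)) A′
  tables-step {p} {j} {z} {A} {A′} p≤j tab pr ≤c₁ ≤c₂ dom j′ z′ = before , after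
    where
    open Progress pr

    before : index j′ z′ ℕ.< suc (index j z) → Cell j′ z′ (suc (toℕ p)) (A′ (index j′ z′))
    before lt with ℕ.m≤n⇒m<n∨m≡n (ℕ.≤-pred lt)
    ... | inj₁ lt′ = subst (Cell j′ z′ (suc (toℕ p))) (sym (elsewhere _ (ℕ.<⇒≢ lt′))) (proj₁ (tab j′ z′) lt′)
    ... | inj₂ eq with index-injective {j′} {z′} {j} {z} eq
    ... | refl , refl = cell-relaxed p≤j (proj₂ (tab j z) ℕ.≤-refl) relaxed ≤c₁ ≤c₂ dom

    after : suc (index j z) ℕ.≤ index j′ z′ → Cell j′ z′ (toℕ p) (A′ (index j′ z′))
    after lt = subst (Cell j′ z′ (toℕ p)) (sym (elsewhere _ (ℕ.>⇒≢ lt)))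
      (proj₂ (tab j′ z′) (ℕ.<⇒≤ lt))
  -- Relaxing a cell

  module _ {p j : Fin m} {d : ℕ} {l u yL yU : Fin N} {gL gU : Carrier}
           (p+d≡j : toℕ p ℕ.+ d ≡ toℕ j) (ex : Extremes p j l u)
           (envL : Envelope (inject₁ p) l yL gL) (envU : Envelope (inject₁ p) u yU gU) where

    record Row (K : Key) : Set c where
      open Key K renaming (p to p′; d to d′)
      field
        p≡  : p′ ≡ toℕ p
        d≡  : d′ ≡ d
        lo≡ : lo ≡ toℕ l
        hi≡ : hi ≡ toℕ u
        yl≡ : yl ≡ toℕ yL
        yu≡ : yu ≡ toℕ yU
        bl≡ : bl ≡ gL + width ex
        bu≡ : bu ≡ gU + width ex
        ranges : EpochRanges loA hiA

    module _ {z : Fin N} where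

      private
        k₀ : ℕ
        k₀ = index j z

      entered : Fin 8 → Store → Store
      entered y s = putI PS k (ints s y) (putI PB k (ints s P) (putR TAB k (reals s V) s))
        where k = (ints s P ℕ.+ ints s D) ℕ.* N ℕ.+ ints s Z

      current≡ : ∀ {s} → Row (key s) → ints s Z ≡ toℕ z → (ints s P ℕ.+ ints s D) ℕ.* N ℕ.+ ints s Z ≡ k₀
      current≡ row z≡ = cong₂ (λ a b → a ℕ.* N ℕ.+ b) (trans (cong₂ ℕ._+_ (Row.p≡ row) (Row.d≡ row)) p+d≡j) z≡

      current<X : ∀ {s} → Row (key s) → ints s Z ≡ toℕ z → (ints s P ℕ.+ ints s D) ℕ.* N ℕ.+ ints s Z ℕ.< X
      current<X {s} row z≡ = subst (ℕ._< X) (sym (current≡ {s} row z≡)) (index<X j z)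

      enter-rule : ∀ {q} {Q : Store → Set q} y {s} → Row (key s) → ints s Z ≡ toℕ z →
                   Q (entered y s) → Runs (enter y) 27 Q s
      enter-rule y {s} row z≡ q =
        seq-rule (putR-rule (current<X {s} row z≡) z≤n z≤n
          (seq-rule (putI-rule (current<X {s} row z≡) z≤n z≤n
            (putI-rule (current<X {s} row z≡) z≤n z≤n q))))

      module _ (y : Fin 8) (s : Store) (row : Row (key s)) (z≡ : ints s Z ≡ toℕ z) where

        entered-entry : entry (entered y s) k₀ ≡ (reals s V , ints s P , ints s y)
        entered-entry = subst (λ k → entry (entered y s) k ≡ (reals s V , ints s P , ints s y)) (current≡ {s} row z≡)
          (cong₂ _,_ (write-same _ _ (realA s TAB))
            (cong₂ _,_ (write-same _ _ (intA s PB)) (write-same _ _ (intA s PS))))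

        entered-elsewhere : ∀ i → ¬ i ≡ k₀ → entry (entered y s) i ≡ entry s i
        entered-elsewhere i i≢ = cong₂ _,_ (write-other _ (realA s TAB) i≢′)
          (cong₂ _,_ (write-other _ (intA s PB) i≢′) (write-other _ (intA s PS) i≢′))
          where
          i≢′ = λ eq → i≢ (trans eq (current≡ {s} row z≡))

        entered-progress : ∀ {A w} → (∀ i → ¬ i ≡ k₀ → entry s i ≡ A i) → ints s y ≡ toℕ w →
          option j z p w ≤⁺ [ reals s V ] → (0 ℕ.< toℕ p → reals s V ≤ proj₁ (A k₀)) →
          Progress p j z A (entry (entered y s))
        entered-progress {A} {w} else y≡ opt≤ ≤old = record
          { elsewhere = λ i i≢ → trans (entered-elsewhere i i≢) (else i i≢)
          ; relaxed = subst (Relaxed j z p (A k₀)) (sym entered-entry) record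
            { ≤old   = ≤old
            ; source = inj₂ (w , cong (reals s V ,_) (cong₂ _,_ (Row.p≡ row) y≡) , opt≤)
            }
          }

        offer-rule : ∀ {q} {Q : Store → Set q} {A w} → Progress p j z A (entry s) →
          ints s y ≡ toℕ w → option j z p w ≤⁺ [ reals s V ] →
          (∀ s′ → Row (key s′) → ints s′ Z ≡ toℕ z → Progress p j z A (entry s′) →
            proj₁ (entry s′ k₀) ≤ reals s V → proj₁ (entry s′ k₀) ≤ proj₁ (entry s k₀) → Q s′) →
          Runs (offer y) 38 Q s
        offer-rule pr y≡ opt≤ q = cond-rule (ℕ.⊔-lub (ℕ.⊔-lub (current<X {s} row z≡) z≤n) z≤n)
          (λ eq → within 27 (skip-rule (q s row z≡ pr (old≤ (does⇒ (_ ≤? _) eq)) ≤-refl)))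
          (λ eq → enter-rule y row z≡ (q (entered y s) row z≡
            (entered-progress (Progress.elsewhere pr) y≡ opt≤
              (λ 0<p → ≤-trans (≤old eq) (Relaxed.≤old (Progress.relaxed pr) 0<p)))
            (≤-reflexive (cong proj₁ entered-entry))
            (≤-trans (≤-reflexive (cong proj₁ entered-entry)) (≤old eq))))
          where
          current-TAB : realA s TAB ((ints s P ℕ.+ ints s D) ℕ.* N ℕ.+ ints s Z) ≡ proj₁ (entry s k₀)
          current-TAB = cong (realA s TAB) (current≡ {s} row z≡)

          old≤ : realA s TAB ((ints s P ℕ.+ ints s D) ℕ.* N ℕ.+ ints s Z) ≤ reals s V → proj₁ (entry s k₀) ≤ reals s V
          old≤ = subst (_≤ reals s V) current-TAB

          ≤old : evalᵀ I layout (get TAB current ≤ᴿ reg V) (mem s) ≡ false → reals s V ≤ proj₁ (entry s k₀)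
          ≤old eq = subst (reals s V ≤_) current-TAB (≰⇒≥ (does⇒¬ (_ ≤? _) eq))

      relax-cell-rule : ∀ {q} {Q : Store → Set q} {s} → Row (key s) → ints s Z ≡ toℕ z →
        (∀ s′ → Row (key s′) → Progress p j z (entry s) (entry s′) →
          proj₁ (entry s′ k₀) ≤ (gL + width ex) + dist I z u →
          proj₁ (entry s′ k₀) ≤ (gU + width ex) + dist I z l → Q s′) →
        Runs relax-cell 200 Q s
      -- The rules add up to 124 steps; 200 is a round bound.
      relax-cell-rule {Q = Q} {s} row z≡ q = within 200
        (seq-rule (measure-rule z≡ (Row.hi≡ row) refl refl λ x₁ x₁≡ →
          seq-rule (setR-rule z≤n (seq-rule (first (setR V (reals s BL + x₁) (setR V x₁ s)) refl row z≡
            (cong₂ _+_ (Row.bl≡ row) x₁≡))))))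
        where
        c₁ c₂ : Carrier
        c₁ = (gL + width ex) + dist I z u
        c₂ = (gU + width ex) + dist I z l

        second : ∀ s₁ → Row (key s₁) → ints s₁ Z ≡ toℕ z → Progress p j z (entry s) (entry s₁) →
                 proj₁ (entry s₁ k₀) ≤ c₁ →
                 Runs (measure V (reg Z) (reg LO) ⨾ setᴿ V (reg BU ⊕ᴿ reg V) ⨾ offer YU) 60 Q s₁
        second s₁ row₁ z≡₁ pr ≤c₁ = seq-rule (measure-rule z≡₁ (Row.lo≡ row₁) refl refl λ x₂ x₂≡ →
          seq-rule (setR-rule z≤n (offer-rule YU
            (setR V (reals s₁ BU + x₂) (setR V x₂ s₁)) row₁ z≡₁ pr (Row.yu≡ row₁)
            (≤⁺-trans (option≤hi ex envU) (≤⁺-reflexive (cong [_] (sym (c₂≡ x₂≡)))))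
            λ s₂ row₂ z≡₂ pr₂ ≤new ≤s₁ →
              q s₂ row₂ pr₂ (≤-trans ≤s₁ ≤c₁) (≤-trans ≤new (≤-reflexive (c₂≡ x₂≡))))))
          where
          c₂≡ : ∀ {x₂} → x₂ ≡ dist I z l → reals s₁ BU + x₂ ≡ c₂
          c₂≡ = cong₂ _+_ (Row.bu≡ row₁)

        first : ∀ s₀ → entry s₀ ≡ entry s → Row (key s₀) → ints s₀ Z ≡ toℕ z → reals s₀ V ≡ c₁ →
                Runs (cond (reg P <ᴵ lit 1) (enter YL) (offer YL)) 42
                  (Runs (measure V (reg Z) (reg LO) ⨾ setᴿ V (reg BU ⊕ᴿ reg V) ⨾ offer YU) 60 Q) s₀
        first s₀ entry≡ row₀ z≡₀ v≡ = cond-rule z≤n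
          (λ eq → within 38 (enter-rule YL row₀ z≡₀ (second (entered YL s₀) row₀ z≡₀
            (subst (λ A → Progress p j z A (entry (entered YL s₀))) entry≡
              (entered-progress YL s₀ row₀ z≡₀ (λ _ _ → refl) (Row.yl≡ row₀) opt≤
                -- In pass 0 there are no earlier blocks to preserve, so overwriting the entry is
                -- sound.
                (λ 0<p → contradiction (does⇒ (_ ℕ.<? _) eq) (ℕ.<⇒≱ (s≤s (subst (0 ℕ.<_) (sym (Row.p≡ row₀)) 0<p))))))
            (≤-reflexive (trans (cong proj₁ (entered-entry YL s₀ row₀ z≡₀)) v≡)))))
          (λ eq → offer-rule YL s₀ row₀ z≡₀
            (record { elsewhere = λ i _ → cong (λ f → f i) entry≡ ; relaxed = record
              { ≤old = λ _ → ≤-reflexive (cong (λ f → proj₁ (f k₀)) entry≡)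
              ; source = inj₁ (subst (0 ℕ.<_) (Row.p≡ row₀) (ℕ.≮⇒≥ (does⇒¬ (_ ℕ.<? _) eq)) , cong (λ f → f k₀) entry≡) } })
            (Row.yl≡ row₀) opt≤
            λ s₁ row₁ z≡₁ pr ≤new _ → second s₁ row₁ z≡₁ pr (≤-trans ≤new (≤-reflexive v≡)))
          where
          opt≤ : option j z p yL ≤⁺ [ reals s₀ V ]
          opt≤ = ≤⁺-trans (option≤lo ex envL) (≤⁺-reflexive (cong [_] (sym v≡)))

-- Correctness of the program: relaxing a row.

module Loops {c ℓ} {R : LinearlyOrderedAbelianGroup c ℓ} (I : Input R) where

  open LinearlyOrderedAbelianGroup R
  open OrderedGroup R
  open Input I
  open Recurrence I
  open Relaxation I
  open Code
  open Verification I
  open Machine I layout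
  open Bounded X

  -- Both branches deliver an envelope at each extreme, so the rest of the row is verified without
  -- distinguishing the first pass.
  sources-rule : ∀ {q} {Q : Store → Set q} {p l u} s → ints s P ≡ toℕ p → ints s LO ≡ toℕ l → ints s HI ≡ toℕ u →
    (∀ j z → toℕ j ℕ.< toℕ p → [ proj₁ (entry s (index j z)) ] ≡ F° (suc j) z) →
    (∀ a b x y yL yU → a ≡ toℕ yL → b ≡ toℕ yU → Envelope (inject₁ p) l yL x → Envelope (inject₁ p) u yU y →
      Q (setR BU y (setR BL x (setI YU b (setI YL a s))))) →
    Runs sources 44 Q s
  sources-rule {p = p} {l} {u} s p≡ lo≡ hi≡ filled q = cond-rule z≤n
    (λ eq → seq-rule (setI-rule z≤n (seq-rule (setI-rule z≤n
      (seq-rule (measure-rule refl lo≡ refl refl λ x x≡ → measure-rule refl hi≡ refl refl λ y y≡ →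
        q _ _ x y s₀ s₀ refl refl (first eq l x≡) (first eq u y≡)))))))
    (λ eq → within 40 (later (finite (pred<m eq)) eq))
    where
    first : evalᵀ I layout (reg P <ᴵ lit 1) (mem s) ≡ true → ∀ v {x} → x ≡ dist I s₀ v → Envelope (inject₁ p) v s₀ x
    first eq v refl = subst (λ i → Envelope i v s₀ (dist I s₀ v)) (Fin.toℕ-injective (sym
      (trans (Fin.toℕ-inject₁ p) (trans (sym p≡) (ℕ.n<1⇒n≡0 (does⇒ (_ ℕ.<? _) eq)))))) (envelope-zero v)

    1≤p : evalᵀ I layout (reg P <ᴵ lit 1) (mem s) ≡ false → 1 ℕ.≤ toℕ p
    1≤p eq = subst (1 ℕ.≤_) p≡ (ℕ.≮⇒≥ (does⇒¬ (_ ℕ.<? _) eq))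

    suc-pred : ∀ {n} → 1 ℕ.≤ n → suc (n ℕ.∸ 1) ≡ n
    suc-pred (s≤s _) = refl

    pred<m : evalᵀ I layout (reg P <ᴵ lit 1) (mem s) ≡ false → toℕ p ℕ.∸ 1 ℕ.< m
    pred<m eq = ℕ.≤-trans (ℕ.≤-reflexive (suc-pred (1≤p eq))) (ℕ.<⇒≤ (Fin.toℕ<n p))

    later : ∃[ k ] toℕ {m} k ≡ toℕ p ℕ.∸ 1 → evalᵀ I layout (reg P <ᴵ lit 1) (mem s) ≡ false →
            Runs _ 22 _ s
    later (k , k≡) eq = seq-rule (setI-rule z≤n (seq-rule (setI-rule z≤n
      (seq-rule (setR-rule (access l lo≡) (setR-rule (access u hi≡)
        (q _ _ _ _ l u lo≡ hi≡ (envelope l lo≡) (envelope u hi≡))))))))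
      where
      layer≡ : Fin.suc k ≡ inject₁ p
      layer≡ = Fin.toℕ-injective (trans (cong suc k≡) (trans (suc-pred (1≤p eq)) (sym (Fin.toℕ-inject₁ p))))

      location : ∀ {a} v → a ≡ toℕ v → (ints s P ℕ.∸ 1) ℕ.* N ℕ.+ a ≡ index k v
      location v refl = cong (λ b → b ℕ.* N ℕ.+ toℕ v) (trans (cong (ℕ._∸ 1) p≡) (sym k≡))

      access : ∀ {a} v → a ≡ toℕ v → suc ((ints s P ℕ.∸ 1) ℕ.* N ℕ.+ a) ℕ.≤ X
      access v a≡ = subst (ℕ._< X) (sym (location v a≡)) (index<X k v)

      envelope : ∀ {a} v → a ≡ toℕ v → Envelope (inject₁ p) v v (realA s TAB ((ints s P ℕ.∸ 1) ℕ.* N ℕ.+ a))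
      envelope v a≡ = subst₂ (λ i k → Envelope i v v (realA s TAB k)) layer≡ (sym (location v a≡))
        (envelope-suc k v (filled k v (ℕ.≤-reflexive (trans (cong suc k≡) (suc-pred (1≤p eq))))))

  -- The sites seen when the block starting with epoch p has been extended to
  -- its first d epochs; epoch p itself is loaded in advance.
  InBlock : Fin m → ℕ → Fin N → Set
  InBlock p d v = ∃[ h ] p Fin.≤ h × (toℕ h ℕ.< toℕ p ℕ.+ d ⊎ h ≡ p) × v ∈ toList (epoch h)

  record BlockInv (p : Fin m) (d : ℕ) (s : Store) : Set (c Level.⊔ ℓ) where
    field
      p≡     : ints s P ≡ toℕ p
      sites  : Range (InBlock p d) (ints s LO) (ints s HI)
      ranges : EpochRanges (intA s LOA) (intA s HIA)
      tables : Tables p ((toℕ p ℕ.+ d) ℕ.* N) (entry s)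

  -- Per site the 200 steps of `relax-cell` and one for the loop.
  sites-loop : ℕ
  sites-loop = 2 ℕ.+ Σ< N (λ _ → 201)

  module _ {p j : Fin m} {d : ℕ} (p+d≡j : toℕ p ℕ.+ d ≡ toℕ j) where

    private
      p≤j : p Fin.≤ j
      p≤j = subst (toℕ p ℕ.≤_) p+d≡j (ℕ.m≤m+n (toℕ p) d)

      block⇒ : ∀ {v} → v ∈ blockSites I p j → InBlock p (suc d) v
      block⇒ v∈ with ∈-blockSites⁻ v∈
      ... | h , p≤h , h≤j , v∈h = h , p≤h ,
        inj₁ (ℕ.≤-trans (s≤s h≤j) (ℕ.≤-reflexive (trans (cong suc (sym p+d≡j)) (sym (ℕ.+-suc (toℕ p) d))))) , v∈h

      ⇒block : ∀ {v} → InBlock p (suc d) v → v ∈ blockSites I p j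
      ⇒block (h , p≤h , inj₁ h< , v∈) = ∈-blockSites⁺ {p} {j} p≤h
        (ℕ.≤-pred (ℕ.≤-trans h< (ℕ.≤-reflexive (trans (ℕ.+-suc (toℕ p) d) (cong suc p+d≡j))))) v∈
      ⇒block (h , p≤h , inj₂ refl , v∈) = ∈-blockSites⁺ {p} {j} p≤h p≤j v∈

      extend : ∀ {v} → InBlock p d v → v ∈ blockSites I p j
      extend (h , p≤h , h< , v∈) =
        ⇒block (h , p≤h , Sum.map₁ (λ lt → ℕ.<-≤-trans lt (ℕ.+-monoʳ-≤ (toℕ p) (ℕ.n≤1+n d))) h< , v∈)

      split : ∀ {v} → v ∈ blockSites I p j → InBlock p d v ⊎ v ∈ toList (epoch j)
      split v∈ with ∈-blockSites⁻ v∈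
      ... | h , p≤h , h≤j , v∈h with ℕ.m≤n⇒m<n∨m≡n h≤j
      ... | inj₁ h<j = inj₁ (h , p≤h , inj₁ (subst (toℕ h ℕ.<_) (sym p+d≡j) h<j) , v∈h)
      ... | inj₂ h≡j = inj₂ (subst (λ h → _ ∈ toList (epoch h)) (Fin.toℕ-injective h≡j) v∈h)

    relax-row-rule : ∀ {s} → BlockInv p d s → Runs relax-row (94 ℕ.+ sites-loop) (BlockInv p (suc d)) (setI D d s)
    relax-row-rule {s} inv =
      seq-rule (seq-rule (setI-rule access (setI-rule access
        (continue (setI HI _ (setI LO _ (setI D d s))) p≡ refl sites′ ranges tables))))
      where
      open BlockInv inv

      location : ints s P ℕ.+ d ≡ toℕ j
      location = trans (cong (ℕ._+ d) p≡) p+d≡j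

      access : suc (ints s P ℕ.+ d) ℕ.≤ X
      access = subst (ℕ._< X) (sym location) (epoch<X j)

      sites′ : Range (_∈ blockSites I p j)
        (ints s LO ℕ.∸ (ints s LO ℕ.∸ intA s LOA (ints s P ℕ.+ d)))
        (ints s HI ℕ.+ (intA s HIA (ints s P ℕ.+ d) ℕ.∸ ints s HI))
      sites′ = range-∪ sites
        (subst (λ k → EpochRange j (intA s LOA k) (intA s HIA k)) (sym location) (ranges j))
        extend (∈-blockSites⁺ {p} {j} p≤j ℕ.≤-refl) split

      continue : ∀ s → ints s P ≡ toℕ p → ints s D ≡ d → Range (_∈ blockSites I p j) (ints s LO) (ints s HI) →
        EpochRanges (intA s LOA) (intA s HIA) → Tables p ((toℕ p ℕ.+ d) ℕ.* N) (entry s) →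
        Runs (sources ⨾ add-width BL ⨾ add-width BU ⨾ for Z #sites relax-cell) (76 ℕ.+ sites-loop)
          (BlockInv p (suc d)) s
      continue s p≡ d≡ sites@(range l u lo≡ hi≡ l∈ u∈ l≤ ≤u) ranges tables =
        seq-rule (sources-rule {p = p} {l} {u} s p≡ lo≡ hi≡ filled λ a b x y yL yU a≡ b≡ envL envU →
          seq-rule (setR-rule z≤n (seq-rule (setR-rule z≤n
            (conseq (loop-rule (λ i s → Row p+d≡j ex envL envU (key s) × Tables p (toℕ j ℕ.* N ℕ.+ i) (entry s))
                (λ _ → 200) refl z≤n
                (record { p≡ = p≡ ; d≡ = d≡ ; lo≡ = lo≡ ; hi≡ = hi≡ ; yl≡ = a≡ ; yu≡ = b≡
                        ; bl≡ = cong (x +_) width≡ ; bu≡ = cong (y +_) width≡ ; ranges = ranges }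
                , subst (λ k → Tables p k (entry s))
                    (trans (cong (ℕ._* N) p+d≡j) (sym (ℕ.+-identityʳ (toℕ j ℕ.* N)))) tables)
                λ i s i<N (row , tab) → body envL envU s row tab (finite i<N))
              λ s′ (row , tab) → finish {envL = envL} {envU} row tab)))))
        where
        ex : Extremes p j l u
        ex = record { lo∈ = l∈ ; hi∈ = u∈ ; lo≤ = l≤ ; ≤hi = ≤u }

        filled : ∀ k z → toℕ k ℕ.< toℕ p → [ proj₁ (entry s (index k z)) ] ≡ F° (suc k) z
        -- Row k lies before the current cell, so its entries account for first epochs up to p, and
        -- in particular for all blocks ending with k.
        filled k z k<p = cell-value (ℕ.m<n⇒m<1+n k<p) (proj₁ (tables k z)
          (ℕ.<-≤-trans (ℕ.+-monoʳ-< (toℕ k ℕ.* N) (Fin.toℕ<n z))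
            (ℕ.≤-trans (ℕ.≤-reflexive (ℕ.+-comm (toℕ k ℕ.* N) N))
              (ℕ.*-monoˡ-≤ N (ℕ.≤-trans k<p (ℕ.m≤m+n (toℕ p) d))))))

        width≡ : (readOr I layout 0# pos (ints s HI) - readOr I layout 0# pos (ints s LO)) +
                 (readOr I layout 0# arrival (ints s P ℕ.+ ints s D) - readOr I layout 0# arrival (ints s P)) ≡ width ex
        width≡ = cong₂ _+_ (cong₂ _-_ (position≡ hi≡) (position≡ lo≡))
          (cong₂ _-_ (arrival≡ (trans (cong₂ ℕ._+_ p≡ d≡) p+d≡j)) (arrival≡ p≡))

        module _ {yL yU : Fin N} {x y : Carrier} (envL : Envelope (inject₁ p) l yL x)
                 (envU : Envelope (inject₁ p) u yU y) where

          body : ∀ {i} s → Row p+d≡j ex envL envU (key s) → Tables p (toℕ j ℕ.* N ℕ.+ i) (entry s) →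
            ∃[ z ] toℕ {N} z ≡ i →
            Runs relax-cell 200
              (λ s → Row p+d≡j ex envL envU (key s) × Tables p (toℕ j ℕ.* N ℕ.+ suc i) (entry s)) (setI Z i s)
          body s row tab (z , refl) = relax-cell-rule p+d≡j ex envL envU {z} {s = setI Z (toℕ z) s} row refl
            λ s′ row′ pr ≤c₁ ≤c₂ → row′ , subst (λ k → Tables p k (entry s′)) (sym (ℕ.+-suc (toℕ j ℕ.* N) (toℕ z)))
              (tables-step p≤j tab pr ≤c₁ ≤c₂ (dominate ex envL envU))

        finish : ∀ {yL yU x y} {envL : Envelope (inject₁ p) l yL x} {envU : Envelope (inject₁ p) u yU y} {s} →
          Row p+d≡j ex envL envU (key s) → Tables p (toℕ j ℕ.* N ℕ.+ N) (entry s) → BlockInv p (suc d) s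
        finish {s = s} row tab = record
          { p≡ = Row.p≡ row
          ; sites = range-resp block⇒ ⇒block (range l u (Row.lo≡ row) (Row.hi≡ row) l∈ u∈ l≤ ≤u)
          ; ranges = Row.ranges row
          ; tables = subst (λ k → Tables p k (entry s))
              (trans (ℕ.+-comm (toℕ j ℕ.* N) N) (cong (ℕ._* N) (trans (cong suc (sym p+d≡j)) (sym (ℕ.+-suc (toℕ p) d))))) tab
          }

-- Correctness of the program: scan, passes and read-out.

module ProgramCorrect {c ℓ} {R : LinearlyOrderedAbelianGroup c ℓ} (I : Input R) where

  open LinearlyOrderedAbelianGroup R
  open OrderedGroup R
  open Input I
  open Recurrence I
  open Relaxation I
  open Code
  open Verification I
  open Loops I
  open Machine I layout
  open Bounded X
  -- Extremes of the epochs

  Scanned : ℕ → Store → Set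
  Scanned i s = ∀ h → toℕ h ℕ.< i → EpochRange h (intA s LOA (toℕ h)) (intA s HIA (toℕ h))

  -- The head is included from the start, as in the registers, so the set is nonempty even before
  -- the loop.
  Seen : (h : Fin m) → ℕ → Fin N → Set
  Seen h q v = v ≡ List⁺.head (epoch h) ⊎ (∃[ i ] toℕ i ℕ.< q × List.lookup (toList (epoch h)) i ≡ v)

  requests : ℕ → ℕ
  requests = readOr I layout 0 (List⁺.length ∘ epoch)

  module _ (h : Fin m) where

    request : ℕ → ℕ → ℕ
    request k q = readOr I layout 0 (λ h → readOr I layout 0 (toℕ ∘ List.lookup (toList (epoch h))) q) k

    request≡ : ∀ {k q} i → k ≡ toℕ h → q ≡ toℕ i → request k q ≡ toℕ (List.lookup (toList (epoch h)) i)
    request≡ i refl refl = trans (readOr-toℕ 0 _ h) (readOr-toℕ 0 (toℕ ∘ List.lookup (toList (epoch h))) i)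

    record ScanInv (A B : ℕ → ℕ) (q : ℕ) (s : Store) : Set where
      field
        p≡   : ints s P ≡ toℕ h
        loA≡ : intA s LOA ≡ A
        hiA≡ : intA s HIA ≡ B
        seen : Range (Seen h q) (ints s LO) (ints s HI)

    private
      widen-step : ∀ {A B q s} → q ℕ.< List⁺.length (epoch h) → ScanInv A B q s →
                   Runs (widen (requestSite (reg P) (reg D)) (requestSite (reg P) (reg D))) 16
                     (ScanInv A B (suc q)) (setI D q s)
      widen-step {A} {B} {q} {s} q< inv = seq-rule (setI-rule z≤n (setI-rule z≤n (record
        { p≡ = p≡ ; loA≡ = loA≡ ; hiA≡ = hiA≡ ; seen = widened (finite q<) })))
        where
        open ScanInv inv

        widened : ∃[ i ] toℕ {List⁺.length (epoch h)} i ≡ q → Range (Seen h (suc q))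
          (ints s LO ℕ.∸ (ints s LO ℕ.∸ request (ints s P) q))
          (ints s HI ℕ.+ (request (ints s P) q ℕ.∸ ints s HI))
        widened (i , refl) = range-∪ seen
          (subst (λ k → Range (_≡ v) k k) (sym (request≡ i p≡ refl)) (range-single v))
          (Sum.map₂ λ (k , k<i , eq) → k , ℕ.m<n⇒m<1+n k<i , eq)
          (λ v≡ → inj₂ (i , ℕ.≤-refl , sym v≡))
          split
          where
          v : Fin N
          v = List.lookup (toList (epoch h)) i

          split : ∀ {w} → Seen h (suc (toℕ i)) w → Seen h (toℕ i) w ⊎ w ≡ v
          split (inj₁ w≡) = inj₁ (inj₁ w≡)
          split (inj₂ (k , k≤i , eq)) with ℕ.m≤n⇒m<n∨m≡n (ℕ.≤-pred k≤i)
          ... | inj₁ k<i = inj₁ (inj₂ (k , k<i , eq))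
          ... | inj₂ k≡i = inj₂ (trans (sym eq) (cong (List.lookup (toList (epoch h))) (Fin.toℕ-injective k≡i)))

      all-seen : ∀ {a b} → Range (Seen h (List⁺.length (epoch h))) a b → EpochRange h a b
      all-seen = range-resp
        (λ { (inj₁ refl) → here refl ; (inj₂ (i , _ , refl)) → ∈-lookup {xs = toList (epoch h)} i })
        (λ v∈ → inj₂ (Any.index v∈ , Fin.toℕ<n (Any.index v∈) , sym (Any.lookup-index v∈)))

    scan-epoch-rule : ∀ {s} → Scanned (toℕ h) s →
                      Runs scan-epoch (17 ℕ.+ 17 ℕ.* requests (toℕ h)) (Scanned (suc (toℕ h))) (setI P (toℕ h) s)
    scan-epoch-rule {s} inv = weaken (ℕ.≤-reflexive steps≡) (seq-rule (setI-rule z≤n (seq-rule (setI-rule z≤n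
      (seq-rule (conseq (loop-rule (ScanInv (intA s LOA) (intA s HIA)) {List⁺.length (epoch h)} (λ _ → 16)
          (readOr-toℕ 0 _ h) z≤n
          (record { p≡ = refl ; loA≡ = refl ; hiA≡ = refl ; seen = first })
          (λ q s q< → widen-step q<))
        λ s′ inv′ → save s′ inv′))))))
      where
      first : Range (Seen h 0) (request (toℕ h) 0) (request (toℕ h) 0)
      first = subst (λ k → Range (Seen h 0) k k) (sym (request≡ {toℕ h} {0} 0F refl refl))
        (range-resp inj₁ (λ { (inj₁ eq) → eq ; (inj₂ (_ , () , _)) }) (range-single (List⁺.head (epoch h))))

      steps≡ : 11 ℕ.+ (Σ< (List⁺.length (epoch h)) (λ _ → 17) ℕ.+ 6) ≡ 17 ℕ.+ 17 ℕ.* requests (toℕ h)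
      steps≡ = cong (11 ℕ.+_) (trans (ℕ.+-comm _ 6) (cong (6 ℕ.+_) (trans (Σ<-const (List⁺.length (epoch h)) 17)
        (trans (ℕ.*-comm (List⁺.length (epoch h)) 17) (cong (17 ℕ.*_) (sym (readOr-toℕ 0 _ h)))))))

      save : ∀ s′ → ScanInv (intA s LOA) (intA s HIA) (List⁺.length (epoch h)) s′ →
             Runs (putᴵ LOA (reg P) (reg LO) ⨾ putᴵ HIA (reg P) (reg HI)) 6 (Scanned (suc (toℕ h))) s′
      save s′ inv′ = seq-rule (putI-rule access z≤n z≤n (putI-rule access z≤n z≤n scanned))
        where
        open ScanInv inv′

        access : ints s′ P ℕ.< X
        access = subst (ℕ._< X) (sym p≡) (epoch<X h)

        new : ∀ {k x} (A : ℕ → ℕ) → k ≡ toℕ h → write I layout k x A (toℕ h) ≡ x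
        new {x = x} A refl = write-same (toℕ h) x A

        old : ∀ {k x i} {A A′ : ℕ → ℕ} → k ≡ toℕ h → A ≡ A′ → i ℕ.< toℕ h → write I layout k x A i ≡ A′ i
        old {x = x} {A = A} refl refl i<h = write-other x A (ℕ.<⇒≢ i<h)

        scanned : ∀ k → toℕ k ℕ.< suc (toℕ h) →
          EpochRange k (write I layout (ints s′ P) (ints s′ LO) (intA s′ LOA) (toℕ k))
                       (write I layout (ints s′ P) (ints s′ HI) (intA s′ HIA) (toℕ k))
        scanned k k≤h with ℕ.m≤n⇒m<n∨m≡n (ℕ.≤-pred k≤h)
        ... | inj₁ k<h = subst₂ (EpochRange k) (sym (old p≡ loA≡ k<h)) (sym (old p≡ hiA≡ k<h)) (inv k k<h)
        ... | inj₂ k≡h with refl ← Fin.toℕ-injective k≡h =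
          subst₂ (EpochRange h) (sym (new (intA s′ LOA) p≡)) (sym (new (intA s′ HIA) p≡)) (all-seen seen)
  -- Filling the table

  Relaxed-up-to : ℕ → Store → Set (c Level.⊔ ℓ)
  Relaxed-up-to i s = EpochRanges (intA s LOA) (intA s HIA) × (∀ j z → Cell j z i (entry s (index j z)))

  relax-blocks-steps : ℕ
  relax-blocks-steps = 10 ℕ.+ m ℕ.* (95 ℕ.+ sites-loop)

  relax-blocks-rule : ∀ p {s} → Relaxed-up-to (toℕ p) s →
                      Runs relax-blocks relax-blocks-steps (Relaxed-up-to (suc (toℕ p))) (setI P (toℕ p) s)
  relax-blocks-rule p {s} (ranges , cells) = weaken bound
    (seq-rule (setI-rule (epoch<X p) (seq-rule (setI-rule (epoch<X p)
      (conseq (loop-rule (BlockInv p) (λ _ → 94 ℕ.+ sites-loop) refl z≤n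
          (record { p≡ = refl ; sites = sites₀ ; ranges = ranges ; tables = tables₀ })
          (λ d s d< inv → row d s inv (finite
            (subst (toℕ p ℕ.+ d ℕ.<_) (ℕ.m+[n∸m]≡n (Fin.toℕ≤n p)) (ℕ.+-monoʳ-< (toℕ p) d<)))))
        λ s′ inv → BlockInv.ranges inv , λ j z → proj₁ (BlockInv.tables inv j z)
          (subst (λ k → index j z ℕ.< k ℕ.* N) (sym (ℕ.m+[n∸m]≡n (Fin.toℕ≤n p))) (index<X j z)))))))
    where
    -- A pass has m - p rows; counting m of them changes only the constant.
    bound : 10 ℕ.+ Σ< (m ℕ.∸ toℕ p) (λ _ → 95 ℕ.+ sites-loop) ℕ.≤ relax-blocks-steps
    bound = ℕ.+-monoʳ-≤ 10 (ℕ.≤-trans (ℕ.≤-reflexive (Σ<-const (m ℕ.∸ toℕ p) _))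
      (ℕ.*-monoˡ-≤ (95 ℕ.+ sites-loop) (ℕ.m∸n≤m m (toℕ p))))

    row : ∀ d s → BlockInv p d s → ∃[ j ] toℕ {m} j ≡ toℕ p ℕ.+ d →
          Runs relax-row (94 ℕ.+ sites-loop) (BlockInv p (suc d)) (setI D d s)
    row d s inv (j , j≡) = relax-row-rule {j = j} (sym j≡) inv

    sites₀ : Range (InBlock p 0) (intA s LOA (toℕ p)) (intA s HIA (toℕ p))
    sites₀ = range-resp (λ v∈ → p , ℕ.≤-refl , inj₂ refl , v∈)
      (λ { (h , p≤h , inj₁ h<p , _) → contradiction (subst (toℕ h ℕ.<_) (ℕ.+-identityʳ (toℕ p)) h<p) (ℕ.≤⇒≯ p≤h)
         ; (h , p≤h , inj₂ refl , v∈) → v∈ })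
      (ranges p)

    tables₀ : Tables p ((toℕ p ℕ.+ 0) ℕ.* N) (entry s)
    -- Rows before p take part in no block of this pass and count as relaxed from the outset.
    tables₀ j z = (λ lt → cell-skip (ℕ.*-cancelʳ-< N (toℕ j) (toℕ p) (ℕ.≤-<-trans (ℕ.m≤m+n (toℕ j ℕ.* N) (toℕ z))
                      (subst (λ k → index j z ℕ.< k ℕ.* N) (ℕ.+-identityʳ (toℕ p)) lt))) (cells j z))
                , λ _ → cells j z
  -- Reading out

  Output : Store → Set (c Level.⊔ ℓ)
  Output s = (∀ j z → Cell j z m (entry s (index j z)))
           × [ reals s BEST ] ≡ minF I
           × (∃[ z ] toℕ z ≡ ints s AM × F° (final I) z ≡ minF I)

  minimal : ∀ {v} z → [ v ] ≡ F° (final I) z → (∀ z′ → [ v ] ≤⁺ F° (final I) z′) → [ v ] ≡ minF I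
  minimal z eq least =
    let z′ , eq′ = minF-attained (≤⁺-trans (minF≤ z) (≤⁺-reflexive (sym eq)))
    in ≤⁺-antisym (≤⁺-trans (least z′) (≤⁺-reflexive (sym eq′))) (≤⁺-trans (minF≤ z) (≤⁺-reflexive (sym eq)))

  record Minimum (A : ℕ → Entry) (i : ℕ) (s : Store) : Set (c Level.⊔ ℓ) where
    field
      entries : entry s ≡ A
      best    : Fin N
      am≡     : ints s AM ≡ toℕ best
      best≡   : [ reals s BEST ] ≡ F° (final I) best
      least   : ∀ z → toℕ z ℕ.< i → [ reals s BEST ] ≤⁺ F° (final I) z

  -- The last row is scanned only if there is an epoch, so its 23 steps per site fit under m · (N ·
  -- 23). This keeps a bare N out of the time bound.
  read-out-steps : ℕ
  read-out-steps = 20 ℕ.+ m ℕ.* (N ℕ.* 23)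

  read-out-rule : ∀ {s} → (∀ j z → Cell j z m (entry s (index j z))) → Runs read-out read-out-steps Output s
  read-out-rule {s} cells = cond-rule z≤n
    (λ eq → weaken (ℕ.m≤m+n 6 (10 ℕ.+ m ℕ.* (N ℕ.* 23)))
      (seq-rule (setI-rule z≤n (setR-rule z≤n (empty (does⇒ (_ ℕ.<? _) eq))))))
    (λ eq → nonempty (ℕ.≮⇒≥ (does⇒¬ (_ ℕ.<? _) eq)))
    where
    empty : m ℕ.< 1 → Output (setR BEST (reals s BEST - reals s BEST) (setI AM (toℕ s₀) s))
    empty m<1 = cells , value , s₀ , refl , trans (sym value₀) value
      where
      final≡ : final I ≡ zero
      final≡ = Fin.toℕ-injective (trans (Fin.toℕ-fromℕ m) (ℕ.n<1⇒n≡0 m<1))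

      value₀ : [ reals s BEST - reals s BEST ] ≡ F° (final I) s₀
      value₀ = trans (cong [_] (+-inverseʳ (reals s BEST))) (trans (sym F-zero-start) (cong (λ i → F° i s₀) (sym final≡)))

      below : ∀ z v → F° zero z ≡ v → [ reals s BEST - reals s BEST ] ≤⁺ v
      below z ⊤⁺    eq = _ ≤⊤⁺
      below z [ v ] eq with refl ← F-zero-finite {z} (≤⁺-reflexive eq) =
        ≤⁺-reflexive (trans value₀ (trans (cong (λ i → F° i s₀) final≡) eq))

      value : [ reals s BEST - reals s BEST ] ≡ minF I
      value = minimal s₀ value₀ (λ z →
        subst (λ i → [ reals s BEST - reals s BEST ] ≤⁺ F° i z) (sym final≡) (below z (F° zero z) refl))

    nonempty : 1 ℕ.≤ m → Runs (setᴵ AM startSite ⨾ setᴿ BEST (get TAB (final-cell AM)) ⨾ for Z #sites compare)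
                           (16 ℕ.+ m ℕ.* (N ℕ.* 23)) Output s
    nonempty 1≤m = weaken (ℕ.+-monoʳ-≤ 13 bound) (seq-rule (setI-rule z≤n (seq-rule (setR-rule (access s₀ refl)
      (conseq (loop-rule (Minimum (entry s)) (λ _ → 22) refl z≤n
          (record { entries = refl ; best = s₀ ; am≡ = refl ; best≡ = value s₀ refl ; least = λ _ () })
          (λ i s′ i<N inv → step s′ inv (finite i<N)))
        λ s′ inv → let open Minimum inv
                       v≡ = minimal best best≡ (λ z → least z (Fin.toℕ<n z))
                   in subst (λ A → ∀ j z → Cell j z m (A (index j z))) (sym entries) cells ,
                      v≡ , best , sym am≡ , trans (sym best≡) v≡)))))
      where
      bound : Σ< N (λ _ → 23) ℕ.≤ 3 ℕ.+ m ℕ.* (N ℕ.* 23)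
      bound = ℕ.≤-trans (ℕ.≤-reflexive (Σ<-const N 23)) (ℕ.≤-trans
        (ℕ.≤-trans (ℕ.≤-reflexive (sym (ℕ.*-identityˡ _))) (ℕ.*-monoˡ-≤ (N ℕ.* 23) 1≤m)) (ℕ.m≤n+m _ 3))

      last : ∃[ j ] toℕ {m} j ≡ m ℕ.∸ 1
      last = finite (ℕ.≤-reflexive (ℕ.m+[n∸m]≡n 1≤m))

      j : Fin m
      j = proj₁ last

      final≡ : Fin.suc j ≡ final I
      final≡ = Fin.toℕ-injective (trans (cong suc (proj₂ last)) (trans (ℕ.m+[n∸m]≡n 1≤m) (sym (Fin.toℕ-fromℕ m))))

      location : ∀ {a} z → a ≡ toℕ z → (m ℕ.∸ 1) ℕ.* N ℕ.+ a ≡ index j z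
      location z refl = cong (λ k → k ℕ.* N ℕ.+ toℕ z) (sym (proj₂ last))

      access : ∀ {a} z → a ≡ toℕ z → suc ((m ℕ.∸ 1) ℕ.* N ℕ.+ a) ℕ.≤ X
      access z a≡ = subst (ℕ._< X) (sym (location z a≡)) (index<X j z)

      value : ∀ {a} z → a ≡ toℕ z → [ realA s TAB ((m ℕ.∸ 1) ℕ.* N ℕ.+ a) ] ≡ F° (final I) z
      value z a≡ = trans (cong (λ k → [ realA s TAB k ]) (location z a≡))
        (trans (cell-value (Fin.toℕ<n j) (cells j z)) (cong (λ i → F° i z) final≡))

      step : ∀ s′ {i} → Minimum (entry s) i s′ → ∃[ z ] toℕ {N} z ≡ i →
             Runs compare 22 (Minimum (entry s) (suc i)) (setI Z i s′)
      step s′ inv (z , refl) = cond-rule (ℕ.⊔-lub z≤n (access z refl))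
        (λ eq → within 11 (skip-rule record
          { entries = entries ; best = best ; am≡ = am≡ ; best≡ = best≡
          ; least = λ w w≤z → least′ ≤-refl (does⇒ (_ ≤? _) eq) w (ℕ.m≤n⇒m<n∨m≡n (ℕ.≤-pred w≤z)) }))
        (λ eq → seq-rule (setR-rule (access z refl) (setI-rule z≤n record
          { entries = entries ; best = z ; am≡ = refl ; best≡ = value′
          ; least = λ w w≤z → least′ (≰⇒≥ (does⇒¬ (_ ≤? _) eq)) ≤-refl w (ℕ.m≤n⇒m<n∨m≡n (ℕ.≤-pred w≤z)) })))
        where
        open Minimum inv

        x : Carrier
        x = realA s′ TAB ((m ℕ.∸ 1) ℕ.* N ℕ.+ toℕ z)

        value′ : [ x ] ≡ F° (final I) z
        value′ = trans (cong (λ A → [ proj₁ (A ((m ℕ.∸ 1) ℕ.* N ℕ.+ toℕ z)) ]) entries) (value z refl)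

        least′ : ∀ {v} → v ≤ reals s′ BEST → v ≤ x → ∀ w → toℕ w ℕ.< toℕ z ⊎ toℕ w ≡ toℕ z →
                 [ v ] ≤⁺ F° (final I) w
        least′ ≤best ≤x w (inj₁ w<z) = ≤⁺-trans [ ≤best ] (least w w<z)
        least′ ≤best ≤x w (inj₂ w≡z) with refl ← Fin.toℕ-injective w≡z = ≤⁺-trans [ ≤x ] (≤⁺-reflexive value′)
  -- The whole program

  total-steps : ℕ
  total-steps = (2 ℕ.+ Σ< m (λ i → suc (17 ℕ.+ 17 ℕ.* requests i))) ℕ.+
                ((2 ℕ.+ Σ< m (λ _ → suc relax-blocks-steps)) ℕ.+ read-out-steps)

  program-runs : ∀ s → Runs (Program.body program) total-steps Output s
  program-runs s = seq-rule (conseq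
    (loop-rule Scanned (λ i → 17 ℕ.+ 17 ℕ.* requests i) refl z≤n (λ _ ()) (λ i s i<m inv → scan s inv (finite i<m)))
    λ s inv → seq-rule (conseq
      (loop-rule Relaxed-up-to (λ _ → relax-blocks-steps) refl z≤n
        ((λ h → inv h (Fin.toℕ<n h)) , λ _ _ → cell-zero)
        (λ i s i<m inv → relax s inv (finite i<m)))
      λ s inv → read-out-rule (proj₂ inv)))
    where
    scan : ∀ s {i} → Scanned i s → ∃[ h ] toℕ {m} h ≡ i →
           Runs scan-epoch (17 ℕ.+ 17 ℕ.* requests i) (Scanned (suc i)) (setI P i s)
    scan s inv (h , refl) = scan-epoch-rule h inv

    relax : ∀ s {i} → Relaxed-up-to i s → ∃[ p ] toℕ {m} p ≡ i →
            Runs relax-blocks relax-blocks-steps (Relaxed-up-to (suc i)) (setI P i s)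
    relax s inv (p , refl) = relax-blocks-rule p inv

-- Total time and space, and the final statement.

module Costs {c ℓ} {R : LinearlyOrderedAbelianGroup c ℓ} (I : Input R) where

  open Input I
  open Recurrence I
  open Relaxation I
  open Code
  open Verification I
  open ProgramCorrect I
  open Machine I layout
  open Bounded X

  private
    final-memory : Result (total-steps ℕ.+ 0) Output (result program I)
    final-memory = run-program program I X (program-runs (store (blank I layout)))

    output : Output (store (result program I))
    output = proj₁ final-memory

  computes : ComputesRecurrence program I
  computes = record
    { value    = proj₁ (proj₂ output)
    ; argmin   = let z , z≡ , eq = proj₂ (proj₂ output) in z , z≡ , trans (sym (F°≡F (final I) z)) eq
    ; table    = λ j z → trans (cell-value (Fin.toℕ<n j) (proj₁ output j z)) (F°≡F (Fin.suc j) z)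
    ; pointers = λ j z → cell-pointers (Fin.toℕ<n j) (proj₁ output j z)
    }

  private
    requests≡Q : Σ< m requests ≡ Q
    requests≡Q = trans (Σ<-tabulate m (List⁺.length ∘ epoch) requests (readOr-toℕ 0 (List⁺.length ∘ epoch)))
      (cong sum (sym (map-tabulate id (List⁺.length ∘ epoch))))

    total≡ : total-steps ≡ (2 ℕ.+ (m ℕ.* 18 ℕ.+ 17 ℕ.* Q)) ℕ.+
                           ((2 ℕ.+ m ℕ.* (11 ℕ.+ m ℕ.* (97 ℕ.+ N ℕ.* 201))) ℕ.+ (20 ℕ.+ m ℕ.* (N ℕ.* 23)))
    total≡ = cong₂ (λ a b → (2 ℕ.+ a) ℕ.+ ((2 ℕ.+ b) ℕ.+ read-out-steps))
      (trans (Σ<-linear m 18 17 requests) (cong (λ q → m ℕ.* 18 ℕ.+ 17 ℕ.* q) requests≡Q))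
      (trans (Σ<-const m (suc relax-blocks-steps))
        (cong (λ k → m ℕ.* (11 ℕ.+ m ℕ.* (97 ℕ.+ k))) (Σ<-const N 201)))

  -- Each of m, m · m and m · N is at most m · m · N, and 350 is the sum 29 + 97 + 201 + 23 of the
  -- resulting coefficients; it also exceeds 24 and 17.
  total≤ : total-steps ℕ.≤ 350 ℕ.* (1 ℕ.+ Q ℕ.+ m ℕ.* m ℕ.* N)
  total≤ = begin
    total-steps                                                           ≡⟨ total≡ ⟩
    _                                                                     ≡⟨ expand m N Q ⟩
    24 ℕ.+ 17 ℕ.* Q ℕ.+ (29 ℕ.* m ℕ.+ 97 ℕ.* (m ℕ.* m) ℕ.+ 201 ℕ.* W ℕ.+ 23 ℕ.* (m ℕ.* N))
      ≤⟨ ℕ.+-mono-≤ (ℕ.+-mono-≤ (ℕ.m≤m+n 24 326) (ℕ.*-monoˡ-≤ Q {17} {350} (ℕ.m≤m+n 17 333)))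
           (ℕ.+-mono-≤ (ℕ.+-monoˡ-≤ (201 ℕ.* W) (ℕ.+-mono-≤ (ℕ.*-monoʳ-≤ 29 (ℕ.≤-trans m≤m*m m*m≤W))
             (ℕ.*-monoʳ-≤ 97 m*m≤W))) (ℕ.*-monoʳ-≤ 23 (ℕ.*-monoˡ-≤ N m≤m*m))) ⟩
    350 ℕ.+ 350 ℕ.* Q ℕ.+ (29 ℕ.* W ℕ.+ 97 ℕ.* W ℕ.+ 201 ℕ.* W ℕ.+ 23 ℕ.* W)  ≡⟨ collect Q W ⟩
    350 ℕ.* (1 ℕ.+ Q ℕ.+ W)                                               ∎
    where
    open ℕ.≤-Reasoning

    W : ℕ
    W = m ℕ.* m ℕ.* N

    m≤m*m : m ℕ.≤ m ℕ.* m
    m≤m*m = square m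
      where
      square : ∀ n → n ℕ.≤ n ℕ.* n
      square zero    = z≤n
      square (suc n) = ℕ.m≤m*n (suc n) (suc n)

    m*m≤W : m ℕ.* m ℕ.≤ W
    m*m≤W = ℕ.≤-trans (ℕ.≤-reflexive (sym (ℕ.*-identityʳ (m ℕ.* m)))) (ℕ.*-monoʳ-≤ (m ℕ.* m) 1≤N)

    expand : ∀ m N Q → (2 ℕ.+ (m ℕ.* 18 ℕ.+ 17 ℕ.* Q)) ℕ.+
                       ((2 ℕ.+ m ℕ.* (11 ℕ.+ m ℕ.* (97 ℕ.+ N ℕ.* 201))) ℕ.+ (20 ℕ.+ m ℕ.* (N ℕ.* 23)))
                     ≡ 24 ℕ.+ 17 ℕ.* Q ℕ.+ (29 ℕ.* m ℕ.+ 97 ℕ.* (m ℕ.* m) ℕ.+ 201 ℕ.* (m ℕ.* m ℕ.* N) ℕ.+ 23 ℕ.* (m ℕ.* N))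
    expand = solve-∀

    collect : ∀ Q W → 350 ℕ.+ 350 ℕ.* Q ℕ.+ (29 ℕ.* W ℕ.+ 97 ℕ.* W ℕ.+ 201 ℕ.* W ℕ.+ 23 ℕ.* W) ≡ 350 ℕ.* (1 ℕ.+ Q ℕ.+ W)
    collect = solve-∀

  time≤ : time-used program I ℕ.≤ 350 ℕ.* (1 ℕ.+ Q ℕ.+ m ℕ.* m ℕ.* N)
  time≤ = ℕ.≤-trans (proj₂ (proj₂ final-memory)) (ℕ.≤-trans (ℕ.≤-reflexive (ℕ.+-identityʳ total-steps)) total≤)

  space≤ : space-used program I ℕ.≤ 350 ℕ.* (1 ℕ.+ m ℕ.* N)
  space≤ = ℕ.≤-trans
    -- There are 8 + 4 registers and 4 + 1 arrays, each array of extent at most m · N.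
    (ℕ.+-mono-≤ (ℕ.m≤m+n 12 338) (ℕ.*-mono-≤ {5} {350} (ℕ.m≤m+n 5 345) (proj₁ (proj₂ final-memory))))
    (ℕ.≤-reflexive (sym (ℕ.*-suc 350 (m ℕ.* N))))

open import Data.Nat.Base using (_+_; _*_; _≤_)

corollary4p10 : ∀ {c ℓ} (R : LinearlyOrderedAbelianGroup c ℓ) →
    let open Input in
    ((I : Input R) → IsOPTauto I (minF I))
    × (∃[ P ] ∃[ C ] ((I : Input R) →
    ComputesRecurrence P I
    × time-used P I ≤ C * (1 + Q I + m I * m I * N I)
    × space-used P I ≤ C * (1 + m I * N I)))
    × ((I : Input R) → ∀ z → F I (final I) z ≡ minF I →
    Reconstruction I (final I) z
    × ((r : Reconstruction I (final I) z) → OptimalAuto I (replay I r)))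
corollary4p10 R =
    (λ I → Replay.minF-isOPT I)
  , (Code.program , 350 , λ I → Costs.computes I , Costs.time≤ I , Costs.space≤ I)
  , λ I z eq → let eq° = trans (Recurrence.F°≡F I (final I) z) eq in
      Replay.reconstruction I z eq° , λ r → Replay.replay-optimal I r eq°
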